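{- There is an algorithm that, given a graph $G$ with vertex integrity $k$, computes ${\rm I}_v(G)$ in time $f(k)\cdot |V(G)|^{\mathcal{O}(1)}$ for some computable function $f$ (i.e., the problem is FPT parameterised by vertex integrity).
   Context: A graph $G=(V,E)$ has vertex integrity at most $k$ if there is a set $U\subseteq V$ with $|U|=k'\le k$ such that every connected component of $G[V\setminus U]$ has at most $k-k'$ vertices. A graph is locally irregular if no two adjacent vertices have the same degree. A vertex-irregulator of $G$ is a set $S\subseteq V$ such that $G[V\setminus S]$ is locally irregular; ${\rm I}_v(G)$ denotes the minimum cardinality of a vertex-irregulator. -}

module Defs where

open import Data.Bool using (Bool; true; false)
open import Data.Fin using (Fin; zero; suc)
open import Data.Fin.Subset using (Subset; _∈_; _∩_; ∁; ∣_∣)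
open import Data.List using (List; foldr)
import Data.List as List
open import Data.Nat using (ℕ; zero; suc; _+_; _∸_; _≤_)
open import Data.Product using (∃-syntax; _×_)
open import Data.Vec using (Vec; _∷_; lookup; replicate; tabulate; _[_]≔_)
open import Function.Bundles using (_⇔_)
open import Relation.Binary.Construct.Closure.ReflexiveTransitive using (Star)
open import Relation.Binary.PropositionalEquality using (_≡_; _≢_)

------------------------------------------------------------------------
-- Finite simple graphs

record Graph (n : ℕ) : Set where
  field
    adj        : Fin n → Fin n → Bool
    adj-sym    : ∀ u v → adj u v ≡ adj v u
    adj-irrefl : ∀ v → adj v v ≡ false

open Graph public

module _ {n : ℕ} (G : Graph n) where

  neighbours : Fin n → Subset n
  neighbours v = tabulate (adj G v)

  -- In the following definitions W is the vertex set of the induced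
  -- subgraph G[W].

  degree : (W : Subset n) → Fin n → ℕ
  degree W v = ∣ neighbours v ∩ W ∣

  LocallyIrregular : (W : Subset n) → Set
  LocallyIrregular W =
    ∀ u v → u ∈ W → v ∈ W → adj G u v ≡ true → degree W u ≢ degree W v

  Edge : (W : Subset n) → Fin n → Fin n → Set
  Edge W u v = u ∈ W × v ∈ W × adj G u v ≡ true

  IsComponent : (W C : Subset n) → Set
  IsComponent W C = ∃[ v ] (v ∈ W × (∀ u → u ∈ C ⇔ Star (Edge W) v u))

  VertexIntegrityAtMost : ℕ → Set
  VertexIntegrityAtMost k =
    ∃[ U ] (∣ U ∣ ≤ k × (∀ C → IsComponent (∁ U) C → ∣ C ∣ ≤ k ∸ ∣ U ∣))

  HasVertexIntegrity : ℕ → Set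
  HasVertexIntegrity k =
    VertexIntegrityAtMost k × (∀ j → VertexIntegrityAtMost j → k ≤ j)

  IsVertexIrregulator : Subset n → Set
  IsVertexIrregulator S = LocallyIrregular (∁ S)

  -- IsIᵥ m states that m is the minimum cardinality of a vertex-irregulator.
  IsIᵥ : ℕ → Set
  IsIᵥ m =
    (∃[ S ] (IsVertexIrregulator S × ∣ S ∣ ≡ m))
    × (∀ S → IsVertexIrregulator S → m ≤ ∣ S ∣)

------------------------------------------------------------------------
-- Algorithms: the language WHILE of N. D. Jones, "Computability and
-- Complexity from a Programming Perspective" (1997), over binary trees
-- with the single atom nil, and with its unit-cost time measure. It is
-- Turing complete, and polynomially equivalent to Turing machines: each
-- unit of time allocates at most one cell, and values can be shared.

data 𝔻 : Set where
  nil  : 𝔻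
  cons : 𝔻 → 𝔻 → 𝔻

head tail : 𝔻 → 𝔻
head nil        = nil
head (cons a b) = a
tail nil        = nil
tail (cons a b) = b

data Exp (r : ℕ) : Set where
  var  : Fin r → Exp r
  nil  : Exp r
  cons : Exp r → Exp r → Exp r
  hd   : Exp r → Exp r
  tl   : Exp r → Exp r

infix  6 _:=_
infixr 4 _⨾_
infix  5 if_then_else_ while_loop_

data Cmd (r : ℕ) : Set where
  _:=_          : Fin r → Exp r → Cmd r
  _⨾_           : Cmd r → Cmd r → Cmd r
  if_then_else_ : Exp r → Cmd r → Cmd r → Cmd r
  while_loop_   : Exp r → Cmd r → Cmd r

Store : ℕ → Set
Store r = Vec 𝔻 r

eval : ∀ {r} → Exp r → Store r → 𝔻
eval (var x)    σ = lookup σ x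
eval nil        σ = nil
eval (cons d e) σ = cons (eval d σ) (eval e σ)
eval (hd e)     σ = head (eval e σ)
eval (tl e)     σ = tail (eval e σ)

time : ∀ {r} → Exp r → ℕ
time (var x)    = 1
time nil        = 1
time (cons d e) = 1 + time d + time e
time (hd e)     = 1 + time e
time (tl e)     = 1 + time e

-- ⟨ C , σ ⟩⇓ τ ∶ t : started in store σ, the command C terminates in
-- store τ after time t. In tests, nil is false and any other tree true.
data ⟨_,_⟩⇓_∶_ {r : ℕ} : Cmd r → Store r → Store r → ℕ → Set where
  ⇓-assign : ∀ {x e σ} →
    ⟨ x := e , σ ⟩⇓ (σ [ x ]≔ eval e σ) ∶ (1 + time e)
  ⇓-seq : ∀ {C D σ τ υ s t} →
    ⟨ C , σ ⟩⇓ τ ∶ s → ⟨ D , τ ⟩⇓ υ ∶ t →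
    ⟨ C ⨾ D , σ ⟩⇓ υ ∶ (1 + s + t)
  ⇓-if-true : ∀ {e C D σ τ a b t} →
    eval e σ ≡ cons a b → ⟨ C , σ ⟩⇓ τ ∶ t →
    ⟨ if e then C else D , σ ⟩⇓ τ ∶ (1 + time e + t)
  ⇓-if-false : ∀ {e C D σ τ t} →
    eval e σ ≡ nil → ⟨ D , σ ⟩⇓ τ ∶ t →
    ⟨ if e then C else D , σ ⟩⇓ τ ∶ (1 + time e + t)
  ⇓-while-true : ∀ {e C σ τ υ a b s t} →
    eval e σ ≡ cons a b → ⟨ C , σ ⟩⇓ τ ∶ s → ⟨ while e loop C , τ ⟩⇓ υ ∶ t →
    ⟨ while e loop C , σ ⟩⇓ υ ∶ (1 + time e + s + t)
  ⇓-while-false : ∀ {e C σ} →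
    eval e σ ≡ nil →
    ⟨ while e loop C , σ ⟩⇓ σ ∶ (1 + time e)

-- Variable zero holds the input and, on termination, the output; the
-- other variables are initially nil.
record Program : Set where
  constructor program
  field
    extraVars : ℕ
    body      : Cmd (suc extraVars)

Runs : Program → (input output : 𝔻) → (t : ℕ) → Set
Runs (program r C) d e t =
  ∃[ τ ] (⟨ C , d ∷ replicate r nil ⟩⇓ τ ∶ t × lookup τ zero ≡ e)

------------------------------------------------------------------------
-- Encodings: unary numerals, and graphs as adjacency matrices

encodeℕ : ℕ → 𝔻
encodeℕ zero    = nil
encodeℕ (suc n) = cons nil (encodeℕ n)

encodeBool : Bool → 𝔻
encodeBool false = nil
encodeBool true  = cons nil nil

encodeList : List 𝔻 → 𝔻
encodeList = foldr cons nil

encodeGraph : ∀ {n} → Graph n → 𝔻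
encodeGraph G =
  encodeList (List.tabulate λ u →
    encodeList (List.tabulate λ v → encodeBool (adj G u v)))

Computable : (ℕ → ℕ) → Set
Computable f =
  ∃[ P ] (∀ n → ∃[ t ] Runs P (encodeℕ n) (encodeℕ (f n)) t)

{-# OPTIONS --safe #-}

-- Let H be the set of vertices of degree greater than K. If G has vertex
-- integrity k then, for K = k, the set H has at most k vertices and every
-- component of G − H has at most k + k³ vertices. The algorithm picks the K
-- minimising the sum of K, |H| and the largest component size. A dynamic
-- program then introduces H and after it the components one at a time,
-- forgetting each component before the next one. For every kept vertex it
-- guesses the residue of the final degree modulo p, counts degrees modulo p,
-- and demands different residues at adjacent vertices. Since vertices outside H
-- have degree at most K, only K + 1 + |H| degrees have to be told apart; every
-- common multiple of 1, …, r + 1 is at least 2 ^ r, so some p of order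
-- (K + |H|)² log n divides none of the nonzero differences of these degrees.
-- With bags of size j there are n (log n) ^ O(j) states, which is
-- fixed-parameter tractable because q ^ j ≤ j ^ j 2 ^ q.
--
-- Programs are written in a first-order functional language whose only loops
-- are folds over lists. If all lists folded over have length at most N, then
-- the compiled WHILE program runs in time N ^ d with d depending on the program
-- only.

module Submission where

open import Data.Bool using (Bool; true; false; if_then_else_; _∧_; _∨_; not)
import Data.Bool.Properties as Bool
open import Data.Bool.Properties using (∧-zeroʳ; ∧-identityʳ; not-involutive)
open import Data.Bool.ListAction using (any)
open import Data.Empty using (⊥-elim)
open import Data.Fin using (Fin; zero; suc; toℕ)
import Data.Fin.Properties as Fin
open import Data.Fin.Subset using (Subset; ∣_∣; _∩_; ∁)
import Data.Fin.Subset as Subset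
import Data.Fin.Subset.Properties as Subset
open import Data.List using (List; []; _∷_; _++_; length; map; foldl; concat; reverse; _ʳ++_; upTo; applyUpTo; allFin; filter; concatMap; cartesianProductWith; tabulate)
open import Data.List.Properties using (length-++; length-map; map-∘; map-cong; length-upTo; map-tabulate; ʳ++-defn; ʳ++-ʳ++; length-reverse; ++-assoc)
import Data.List.Properties as List
open import Data.List.Membership.Propositional using (_∈_; _∉_)
open import Data.List.Membership.Propositional.Properties
open import Data.List.Relation.Unary.All as All using (All; []; _∷_)
open import Data.List.Relation.Unary.Any as Any using (here; there)
open import Data.List.Relation.Unary.AllPairs using (AllPairs; []; _∷_)
open import Data.List.Relation.Unary.Unique.Propositional using (Unique)
open import Data.List.Relation.Unary.Unique.Propositional.Properties using (allFin⁺)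
import Data.List.Relation.Unary.Unique.Propositional.Properties as Unique
open import Data.List.Relation.Binary.Pointwise using (Pointwise; []; _∷_)
open import Data.List.Relation.Binary.Permutation.Propositional using (_↭_; prep; swap; ↭-sym; ↭-trans; ↭-reflexive; module PermutationReasoning)
open import Data.List.Relation.Binary.Permutation.Propositional.Properties using (∈-resp-↭; shift; shifts; ++⁺ˡ; ++⁺ʳ)
import Data.List.Relation.Binary.Permutation.Propositional.Properties as Perm
open import Data.Maybe as Maybe using (Maybe; just; nothing; is-just; is-nothing)
open import Data.Nat
open import Data.Nat.Properties
open import Data.Nat.Divisibility
open import Data.Nat.DivMod using (_/_; m/n*n≤m; m≡m%n+[m/n]*n; m%n<n)
open import Data.Nat.ListAction using (product)
open import Data.Nat.ListAction.Properties using (∈⇒∣product)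
open import Data.Nat.Tactic.RingSolver using (solve-∀)
open import Data.Product using (∃-syntax; Σ-syntax; _×_; _,_; proj₁; proj₂)
open import Data.Sum as Sum using (_⊎_; inj₁; inj₂)
open import Data.Unit using (⊤; tt)
open import Data.Vec using (Vec; []; _∷_; lookup)
import Data.Vec as Vec
import Data.Vec.Properties as Vec
open import Function using (_∘_; id; case_of_)
open import Function.Bundles using (mk⇔)
open import Relation.Binary.Construct.Closure.ReflexiveTransitive as Star using (Star; ε; _◅_; _◅◅_)
open import Relation.Binary.Definitions using (DecidableEquality)
open import Relation.Binary.PropositionalEquality using (_≡_; _≢_; refl; sym; trans; cong; cong₂; subst; subst₂)
open import Relation.Nullary using (¬_; Dec; yes; no; does; ¬?)
open import Relation.Nullary.Decidable using (dec-true; dec-false; decidable-stable)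
open import Defs renaming (if_then_else_ to IF_THEN_ELSE_)

-- Residues are used because a vertex of H may have degree up to n: storing true degrees for all of
-- H would multiply the number of states by n to the power |H|. The price is that no good modulus is
-- known in advance, since the degrees to be separated depend on the unknown solution. So all moduli
-- below the bound run side by side. Different residues certify different degrees whatever the
-- modulus, hence a bad modulus can lose solutions but never creates a false one, and the minimum
-- over all moduli is right as soon as one of them is good for an optimal solution. The residue of
-- the final degree has to be guessed because an edge is checked when its later end is introduced,
-- before the degrees of its ends are complete; the guess is verified when the vertex is forgotten.
-- Neither k nor an optimal separator is given to the program; trying all degree thresholds replaces
-- a search for them. The components of G - H stay small because a vertex of an optimal separator
-- outside H has at most k neighbours and so links few of the small components.

-- In the body of a fold, variable 0 is the remaining list, whose head is the
-- current element, and variable 1 is the accumulator.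
data Tm (m : ℕ) : Set where
  ret  : Exp m → Tm m
  bind : Tm m → Tm (suc m) → Tm m
  call : ∀ {l} → Tm l → Vec (Exp m) l → Tm m
  ifte : Exp m → Tm m → Tm m → Tm m
  fold : (list init : Exp m) → Tm (2 + m) → Tm m

len : 𝔻 → ℕ
len nil        = 0
len (cons _ d) = suc (len d)

evals : ∀ {l m} → Vec (Exp m) l → Vec 𝔻 m → Vec 𝔻 l
evals es ρ = Vec.map (λ e → eval e ρ) es

-- Ev Ok ρ t v: in the environment ρ the term t evaluates to v, and Ok holds
-- of the lengths of all lists that are folded over.
mutual
  data Ev (Ok : ℕ → Set) {m : ℕ} (ρ : Vec 𝔻 m) : Tm m → 𝔻 → Set where
    ev-ret  : ∀ {e} → Ev Ok ρ (ret e) (eval e ρ)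
    ev-bind : ∀ {a b u v} → Ev Ok ρ a u → Ev Ok (u ∷ ρ) b v → Ev Ok ρ (bind a b) v
    ev-call : ∀ {l} {f : Tm l} {es v} → Ev Ok (evals es ρ) f v → Ev Ok ρ (call f es) v
    ev-then : ∀ {e a b x y v} → eval e ρ ≡ cons x y → Ev Ok ρ a v → Ev Ok ρ (ifte e a b) v
    ev-else : ∀ {e a b v} → eval e ρ ≡ nil → Ev Ok ρ b v → Ev Ok ρ (ifte e a b) v
    ev-fold : ∀ {l i b v} → Ok (len (eval l ρ)) → EvFold Ok ρ b (eval l ρ) (eval i ρ) v →
              Ev Ok ρ (fold l i b) v

  data EvFold (Ok : ℕ → Set) {m : ℕ} (ρ : Vec 𝔻 m) (b : Tm (2 + m)) : 𝔻 → 𝔻 → 𝔻 → Set where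
    done : ∀ {a} → EvFold Ok ρ b nil a a
    step : ∀ {x xs a a′ v} → Ev Ok (cons x xs ∷ a ∷ ρ) b a′ → EvFold Ok ρ b xs a′ v →
           EvFold Ok ρ b (cons x xs) a v

-- Compilation into WHILE programs with a single variable

X : Exp 1
X = var zero

tls : ℕ → Exp 1 → Exp 1
tls zero    e = e
tls (suc i) e = tls i (tl e)

access : ∀ {m} → Fin m → Exp 1 → Exp 1
access zero    e = hd e
access (suc i) e = access i (tl e)

translate : ∀ {m} → Exp m → Exp 1
translate (var i)    = access i X
translate nil        = nil
translate (cons d e) = cons (translate d) (translate e)
translate (hd e)     = hd (translate e)
translate (tl e)     = tl (translate e)

-- All arguments refer to the caller's environment and are pushed above it at once. The callee then
-- finds its own frame on top of the stack, from where `access` counts.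
pushAll : ∀ {l m} → Vec (Exp m) l → Exp 1
pushAll []       = X
pushAll (e ∷ es) = cons (translate e) (pushAll es)

set : Exp 1 → Cmd 1
set e = zero := e

-- The environment is kept as a stack in the only variable, and the value of
-- the term is pushed onto it.
compile : ∀ {m} → Tm m → Cmd 1
foldBody : ∀ {m} → Tm (2 + m) → Cmd 1
compile (ret e)          = set (cons (translate e) X)
compile (bind a b)       = compile a ⨾ compile b ⨾ set (cons (hd X) (tl (tl X)))
compile (call {l} f es)  = set (pushAll es) ⨾ compile f ⨾ set (cons (hd X) (tls l (tl X)))
compile (ifte e a b)     = IF translate e THEN compile a ELSE compile b
compile (fold l i b)     =
  set (cons (translate l) (cons (translate i) X)) ⨾ while hd X loop (foldBody b) ⨾ set (tl X)
-- The body leaves the new accumulator above the remaining list and the old accumulator; the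
-- assignment restores the frame of the loop with the tail of the list.
foldBody b = compile b ⨾ set (cons (tl (hd (tl X))) (cons (hd X) (tl (tl (tl X)))))

stack : ∀ {m} → Vec 𝔻 m → 𝔻 → 𝔻
stack []      s = s
stack (d ∷ ρ) s = cons d (stack ρ s)

eval-access : ∀ {m} (i : Fin m) e (ρ : Vec 𝔻 m) {s σ} → eval e σ ≡ stack ρ s →
  eval (access i e) σ ≡ lookup ρ i
eval-access zero    e (d ∷ ρ) eq = cong head eq
eval-access (suc i) e (d ∷ ρ) eq = eval-access i (tl e) ρ (cong tail eq)

eval-translate : ∀ {m} (e : Exp m) ρ {s} → eval (translate e) (stack ρ s ∷ []) ≡ eval e ρ
eval-translate (var i)    ρ = eval-access i X ρ refl
eval-translate nil        ρ = refl
eval-translate (cons d e) ρ = cong₂ cons (eval-translate d ρ) (eval-translate e ρ)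
eval-translate (hd e)     ρ = cong head (eval-translate e ρ)
eval-translate (tl e)     ρ = cong tail (eval-translate e ρ)

eval-pushAll : ∀ {l m} (es : Vec (Exp m) l) ρ {s} →
  eval (pushAll es) (stack ρ s ∷ []) ≡ stack (evals es ρ) (stack ρ s)
eval-pushAll []       ρ = refl
eval-pushAll (e ∷ es) ρ = cong₂ cons (eval-translate e ρ) (eval-pushAll es ρ)

eval-tls : ∀ {l} (ρ : Vec 𝔻 l) e {s σ} → eval e σ ≡ stack ρ s → eval (tls l e) σ ≡ s
eval-tls []      e eq = eq
eval-tls (d ∷ ρ) e eq = eval-tls ρ (tl e) (cong tail eq)

run-set : ∀ {e d d′} → eval e (d ∷ []) ≡ d′ → ⟨ set e , d ∷ [] ⟩⇓ (d′ ∷ []) ∶ (1 + time e)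
run-set refl = ⇓-assign

module _ {Ok : ℕ → Set} where

  -- This is the exact running time. The numerals are the times of the fixed bookkeeping commands: 7
  -- to drop a bound value, 13 to restore the frame of a fold, 3 for a loop test or for the final
  -- pop.
  cost : ∀ {m ρ} {t : Tm m} {v} → Ev Ok ρ t v → ℕ
  costFold : ∀ {m} {ρ : Vec 𝔻 m} {b l a v} → EvFold Ok ρ b l a v → ℕ
  cost {t = ret e} ev-ret             = 1 + time (cons (translate e) X)
  cost (ev-bind p q)                  = 1 + cost p + (1 + cost q + 7)
  cost {t = call {l} f es} (ev-call p) =
    1 + (1 + time (pushAll es)) + (1 + cost p + (1 + time (cons (hd X) (tls l (tl X)))))
  cost {t = ifte e a b} (ev-then _ p) = 1 + time (translate e) + cost p
  cost {t = ifte e a b} (ev-else _ p) = 1 + time (translate e) + cost p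
  cost {t = fold l i b} (ev-fold _ p) =
    1 + (1 + time (cons (translate l) (cons (translate i) X))) + (1 + costFold p + 3)
  costFold done       = 3
  costFold (step p q) = 3 + (1 + cost p + 13) + costFold q

  run : ∀ {m ρ} {t : Tm m} {v} (p : Ev Ok ρ t v) s →
    ⟨ compile t , stack ρ s ∷ [] ⟩⇓ (cons v (stack ρ s) ∷ []) ∶ cost p
  runFold : ∀ {m} {ρ : Vec 𝔻 m} {b l a v} (p : EvFold Ok ρ b l a v) s →
    ⟨ while hd X loop foldBody b , stack (l ∷ a ∷ ρ) s ∷ [] ⟩⇓ (stack (nil ∷ v ∷ ρ) s ∷ []) ∶ costFold p
  run {ρ = ρ} {ret e} ev-ret s = run-set (cong₂ cons (eval-translate e ρ) refl)
  run (ev-bind p q) s = ⇓-seq (run p s) (⇓-seq (run q s) (run-set refl))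
  run {ρ = ρ} {call f es} (ev-call p) s =
    ⇓-seq (run-set (eval-pushAll es ρ))
      (⇓-seq (run p (stack ρ s))
        (run-set (cong (cons _) (eval-tls (evals es ρ) (tl X) refl))))
  run {ρ = ρ} {ifte e a b} (ev-then eq p) s = ⇓-if-true (trans (eval-translate e ρ) eq) (run p s)
  run {ρ = ρ} {ifte e a b} (ev-else eq p) s = ⇓-if-false (trans (eval-translate e ρ) eq) (run p s)
  run {ρ = ρ} {fold l i b} (ev-fold _ p) s =
    ⇓-seq (run-set (cong₂ cons (eval-translate l ρ) (cong₂ cons (eval-translate i ρ) refl)))
      (⇓-seq (runFold p s) (run-set refl))
  runFold done s = ⇓-while-false refl
  runFold (step p q) s = ⇓-while-true refl (⇓-seq (run p s) (run-set refl)) (runFold q s)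

-- An exponent for `cost`, built by the same recursion: a constant c is its own exponent because c ≤
-- N ^ c, a sum takes one more than the sum of the exponents, and a loop of at most N rounds adds
-- one.
deg : ∀ {m} → Tm m → ℕ
deg (ret e)         = 1 + time (cons (translate e) X)
deg (bind a b)      = 1 + (1 + deg a) + (1 + (1 + deg b) + 7)
deg (call {l} f es) =
  1 + (1 + (1 + time (pushAll es))) + (1 + (1 + deg f) + (1 + time (cons (hd X) (tls l (tl X)))))
deg (ifte e a b)    = 1 + (1 + time (translate e)) + (1 + deg a + deg b)
deg (fold l i b)    =
  1 + (1 + (1 + time (cons (translate l) (cons (translate i) X)))) +
    (1 + suc (1 + suc (1 + 3 + (1 + suc (deg b) + 13)) + 3) + 3)

-- Exponents of a base N ≥ 2 absorb constants and sums.
module _ {N : ℕ} (2≤N : 2 ≤ N) where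

  private
    instance
      N-nonZero : NonZero N
      N-nonZero = >-nonZero (≤-trans (s≤s z≤n) 2≤N)

    -- A record rather than the bare inequality, so that the exponent can be inferred, which `N ^ a`
    -- alone does not allow.
    record _⊑_ (x a : ℕ) : Set where
      constructor below
      field bound : x ≤ N ^ a
    open _⊑_

    pow-mono : ∀ {a b} → a ≤ b → N ^ a ≤ N ^ b
    pow-mono = ^-monoʳ-≤ N

    weaken : ∀ {x a b} → x ⊑ a → a ≤ b → x ⊑ b
    weaken p a≤b = below (≤-trans (bound p) (pow-mono a≤b))

    double : ∀ a → N ^ a + N ^ a ≤ N ^ suc a
    double a = begin
      N ^ a + N ^ a  ≡⟨ cong (N ^ a +_) (sym (+-identityʳ _)) ⟩
      2 * N ^ a      ≤⟨ *-monoˡ-≤ (N ^ a) 2≤N ⟩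
      N * N ^ a      ∎
      where open ≤-Reasoning

    const-⊑ : ∀ c → c ⊑ c
    const-⊑ zero    = below z≤n
    const-⊑ (suc c) = below (≤-trans (+-mono-≤ (m^n>0 N c) (bound (const-⊑ c))) (double c))

    sum-⊑ : ∀ {x y a b} → x ⊑ a → y ⊑ b → (x + y) ⊑ (1 + a + b)
    sum-⊑ {a = a} {b} p q = below (≤-trans
      (+-mono-≤ (bound (weaken p (m≤m+n a b))) (bound (weaken q (m≤n+m b a)))) (double (a + b)))

    suc-⊑ : ∀ {x a} → x ⊑ a → suc x ⊑ suc a
    suc-⊑ p = sum-⊑ {a = 0} (below ≤-refl) p

    times-⊑ : ∀ {l x a} → l ≤ N → x ⊑ a → (l * x) ⊑ suc a
    times-⊑ l≤N p = below (*-mono-≤ l≤N (bound p))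

    cost-⊑ : ∀ {m ρ} {t : Tm m} {v} (p : Ev (_≤ N) ρ t v) → cost p ⊑ deg t
    costFold-≤ : ∀ {m} {ρ : Vec 𝔻 m} {b l a v} (p : EvFold (_≤ N) ρ b l a v) →
      costFold p ≤ len l * (3 + (1 + N ^ deg b + 13)) + 3
    cost-⊑ {t = ret e} ev-ret = const-⊑ (1 + time (cons (translate e) X))
    cost-⊑ (ev-bind p q) =
      sum-⊑ (suc-⊑ (cost-⊑ p)) (sum-⊑ (suc-⊑ (cost-⊑ q)) (const-⊑ 7))
    cost-⊑ {t = call {l} f es} (ev-call p) =
      sum-⊑ (const-⊑ (1 + (1 + time (pushAll es))))
        (sum-⊑ (suc-⊑ (cost-⊑ p)) (const-⊑ (1 + time (cons (hd X) (tls l (tl X))))))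
    cost-⊑ {t = ifte e a b} (ev-then _ p) =
      sum-⊑ (const-⊑ (1 + time (translate e)))
        (weaken (cost-⊑ p) (≤-trans (m≤m+n (deg a) (deg b)) (n≤1+n _)))
    cost-⊑ {t = ifte e a b} (ev-else _ p) =
      sum-⊑ (const-⊑ (1 + time (translate e)))
        (weaken (cost-⊑ p) (≤-trans (m≤n+m (deg b) (deg a)) (n≤1+n _)))
    cost-⊑ {t = fold l i b} (ev-fold ok p) =
      sum-⊑ (const-⊑ (1 + (1 + time (cons (translate l) (cons (translate i) X)))))
        (sum-⊑ (suc-⊑ (below (≤-trans (costFold-≤ p) (bound
          (sum-⊑ (times-⊑ ok (sum-⊑ (const-⊑ 3) (sum-⊑ (suc-⊑ {a = deg b} (below ≤-refl)) (const-⊑ 13))))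
            (const-⊑ 3)))))) (const-⊑ 3))
    costFold-≤ done = ≤-refl
    costFold-≤ {b = b} {l = cons _ xs} (step p q) = begin
      3 + (1 + cost p + 13) + costFold q
        ≤⟨ +-mono-≤ (+-monoʳ-≤ 3 (+-monoˡ-≤ 13 (s≤s (bound (cost-⊑ p))))) (costFold-≤ q) ⟩
      B + (len xs * B + 3)
        ≡⟨ +-assoc B _ 3 ⟨
      B + len xs * B + 3
        ∎
      where
      open ≤-Reasoning
      B = 3 + (1 + N ^ deg b + 13)

  -- The 4 and the last 3 on the left pay for the two assignments that `toProgram` wraps around the
  -- compiled term.
  runtime-≤ : ∀ {m ρ} {t : Tm m} {v} (p : Ev (_≤ N) ρ t v) →
    1 + 4 + (1 + cost p + 3) ≤ N ^ (1 + 5 + (1 + suc (deg t) + 3))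
  runtime-≤ p = bound (sum-⊑ (const-⊑ 5) (sum-⊑ (suc-⊑ (cost-⊑ p)) (const-⊑ 3)))

toProgram : Tm 1 → Program
toProgram t = program 0 (set (cons X nil) ⨾ compile t ⨾ set (hd X))

runs : ∀ {Ok t d v} (p : Ev Ok (d ∷ []) t v) → Runs (toProgram t) d v (1 + 4 + (1 + cost p + 3))
runs p = _ , ⇓-seq (run-set refl) (⇓-seq (run p nil) (run-set refl)) , refl

-- Common multiples of 1, …, n + 1

binomial : ℕ → ℕ → ℕ
binomial n       zero    = 1
binomial zero    (suc k) = 0
binomial (suc n) (suc k) = binomial n k + binomial n (suc k)

binomial-absorb : ∀ n k → suc k * binomial (suc n) (suc k) ≡ suc n * binomial n k
binomial-absorb zero    zero    = refl
binomial-absorb zero    (suc k) = *-zeroʳ (suc (suc k))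
binomial-absorb (suc n) zero    = cong suc (binomial-absorb n 0)
binomial-absorb (suc n) (suc k) = begin-equality
  suc (suc k) * (a + b)               ≡⟨ split k a b ⟩
  a + suc k * a + suc (suc k) * b     ≡⟨ cong₂ (λ u v → a + u + v) (binomial-absorb n k)
    (binomial-absorb n (suc k)) ⟩
  a + suc n * c + suc n * d           ≡⟨ join n a c d ⟩
  a + suc n * (c + d)                 ∎
  where
  open ≤-Reasoning
  a = binomial (suc n) (suc k)
  b = binomial (suc n) (suc (suc k))
  c = binomial n k
  d = binomial n (suc k)
  split : ∀ k a b → suc (suc k) * (a + b) ≡ a + suc k * a + suc (suc k) * b
  split = solve-∀
  join : ∀ n a c d → a + suc n * c + suc n * d ≡ a + suc n * (c + d)
  join = solve-∀

binomial>0 : ∀ {n k} → k ≤ n → 0 < binomial n k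
binomial>0 z≤n       = s≤s z≤n
binomial>0 (s≤s k≤n) = ≤-trans (binomial>0 k≤n) (m≤m+n _ _)

binomial≡0 : ∀ {n k} → n < k → binomial n k ≡ 0
binomial≡0 {zero}  (s≤s _)   = refl
binomial≡0 {suc n} (s≤s n<k) = cong₂ _+_ (binomial≡0 n<k) (binomial≡0 (m<n⇒m<1+n n<k))

rowSum : ℕ → ℕ → ℕ
rowSum n zero    = 0
rowSum n (suc m) = rowSum n m + binomial n m

rowSum-pascal : ∀ n m → rowSum (suc n) (suc m) ≡ rowSum n (suc m) + rowSum n m
rowSum-pascal n zero    = refl
rowSum-pascal n (suc m) =
  trans (cong (_+ (binomial n m + binomial n (suc m))) (rowSum-pascal n m))
    (rearrange (rowSum n m) (binomial n m) (binomial n (suc m)))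
  where
  rearrange : ∀ a b c → a + b + a + (b + c) ≡ a + b + c + (a + b)
  rearrange = solve-∀

rowSum≡2^ : ∀ n → rowSum n (suc n) ≡ 2 ^ n
rowSum≡2^ zero    = refl
rowSum≡2^ (suc n) = begin-equality
  rowSum (suc n) (2 + n)                             ≡⟨ rowSum-pascal n (suc n) ⟩
  rowSum n (suc n) + binomial n (suc n) + rowSum n (suc n)
    ≡⟨ cong (λ z → rowSum n (suc n) + z + rowSum n (suc n)) (binomial≡0 {n} ≤-refl) ⟩
  rowSum n (suc n) + 0 + rowSum n (suc n)            ≡⟨ cong (λ z → z + 0 + z) (rowSum≡2^ n) ⟩
  2 ^ n + 0 + 2 ^ n                                  ≡⟨ +-comm (2 ^ n + 0) (2 ^ n) ⟩
  2 ^ suc n                                          ∎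
  where open ≤-Reasoning

-- From 1/x = 1/y − 1/z, in the form x z = y z + x y.
difference-∣ : ∀ {x y z M} → .{{NonZero y}} → .{{NonZero z}} → y ≤ z →
  x * z ≡ y * z + x * y → y ∣ M → z ∣ M → x ∣ M
difference-∣ {x} {y} {z} {M} y≤z xz≡ (divides a M≡ay) (divides b M≡bz) =
  divides (a ∸ b) (trans (*-cancelʳ-≡ M (x * (a ∸ b)) (y * z) {{m*n≢0 y z}} key) (*-comm x (a ∸ b)))
  where
  open ≤-Reasoning
  b≤a : b ≤ a
  b≤a = *-cancelʳ-≤ b a y (begin
    b * y  ≤⟨ *-monoʳ-≤ b y≤z ⟩
    b * z  ≡⟨ M≡bz ⟨
    M      ≡⟨ M≡ay ⟩
    a * y  ∎)
  d = a ∸ b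
  e₁ : ∀ b d x y z → (b + d) * y * (x * z) ≡ b * z * (x * y) + x * d * (y * z)
  e₁ = solve-∀
  M-split : M * (y * z) + M * (x * y) ≡ x * d * (y * z) + M * (x * y)
  M-split = begin-equality
    M * (y * z) + M * (x * y)             ≡⟨ *-distribˡ-+ M (y * z) (x * y) ⟨
    M * (y * z + x * y)                   ≡⟨ cong (M *_) xz≡ ⟨
    M * (x * z)                           ≡⟨ cong (_* (x * z)) M≡ay ⟩
    a * y * (x * z)                       ≡⟨ cong (λ w → w * y * (x * z)) (m+[n∸m]≡n b≤a) ⟨
    (b + d) * y * (x * z)                 ≡⟨ e₁ b d x y z ⟩
    b * z * (x * y) + x * d * (y * z)     ≡⟨ cong (λ w → w * (x * y) + x * d * (y * z)) M≡bz ⟨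
    M * (x * y) + x * d * (y * z)         ≡⟨ +-comm (M * (x * y)) _ ⟩
    x * d * (y * z) + M * (x * y)         ∎
  key : M * (y * z) ≡ x * d * (y * z)
  key = +-cancelʳ-≡ (M * (x * y)) _ _ M-split

-- The entries of the Leibniz harmonic triangle are 1 / ((n + 1) C(n , k)).
leibniz-∣ : ∀ k n {M} → (∀ i → i ≤ n → suc i ∣ M) → k ≤ n → suc n * binomial n k ∣ M
leibniz-∣ zero    n       {M} div _         = subst (_∣ M) (sym (*-identityʳ (suc n))) (div n ≤-refl)
leibniz-∣ (suc k) (suc n) div (s≤s k≤n) =
  -- The recurrence of the triangle: entry (n + 1 , k + 1) is entry (n , k) minus entry (n + 1 , k).
  difference-∣ {{m*n≢0 (suc n) c {{_}} {{>-nonZero (binomial>0 k≤n)}}}}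
    {{m*n≢0 (2 + n) a {{_}} {{>-nonZero (binomial>0 (m≤n⇒m≤1+n k≤n))}}}}
    (*-mono-≤ (n≤1+n (suc n)) c≤a) identity
    (leibniz-∣ k n (λ i i≤n → div i (m≤n⇒m≤1+n i≤n)) k≤n)
    (leibniz-∣ k (suc n) div (m≤n⇒m≤1+n k≤n))
  where
  open ≤-Reasoning
  a = binomial (suc n) k
  b = binomial (suc n) (suc k)
  c = binomial n k
  c≤a : c ≤ a
  c≤a = pascal-mono k
    where
    pascal-mono : ∀ k → binomial n k ≤ binomial (suc n) k
    pascal-mono zero    = ≤-refl
    pascal-mono (suc k) = m≤n+m _ _
  e₁ : ∀ k m a b → suc k * (suc m * b * (suc m * a)) ≡ (suc k * b) * (suc m * a) * suc m
  e₁ = solve-∀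
  e₂ : ∀ k m a b c → suc m * c * (suc k * (a + b)) * suc (suc m) ≡
                     suc k * (suc m * c * (suc (suc m) * a) + suc (suc m) * b * (suc m * c))
  e₂ = solve-∀
  identity : (2 + n) * b * ((2 + n) * a) ≡ suc n * c * ((2 + n) * a) + (2 + n) * b * (suc n * c)
  -- The factor k + 1 lets both absorption identities apply, to C(n + 1 , k + 1) and to C(n + 2 , k
  -- + 1) = a + b.
  identity = *-cancelˡ-≡ _ _ (suc k) (begin-equality
    suc k * ((2 + n) * b * ((2 + n) * a))                 ≡⟨ e₁ k (suc n) a b ⟩
    (suc k * b) * ((2 + n) * a) * (2 + n)
      ≡⟨ cong₂ (λ u v → u * v * (2 + n)) (binomial-absorb n k) (sym (binomial-absorb (suc n) k)) ⟩
    suc n * c * (suc k * (a + b)) * (2 + n)               ≡⟨ e₂ k n a b c ⟩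
    suc k * (suc n * c * ((2 + n) * a) + (2 + n) * b * (suc n * c)) ∎)

rowSum-≤ : ∀ n {M} → (∀ k → k ≤ n → suc n * binomial n k ≤ M) →
  ∀ m → m ≤ suc n → suc n * rowSum n m ≤ m * M
rowSum-≤ n     h zero    _         = ≤-reflexive (*-zeroʳ (suc n))
rowSum-≤ n {M} h (suc m) (s≤s m≤n) = begin
  suc n * (rowSum n m + binomial n m)             ≡⟨ *-distribˡ-+ (suc n) (rowSum n m) _ ⟩
  suc n * rowSum n m + suc n * binomial n m       ≤⟨ +-mono-≤ (rowSum-≤ n h m (m≤n⇒m≤1+n m≤n)) (h m m≤n) ⟩
  m * M + M                                       ≡⟨ +-comm (m * M) M ⟩
  suc m * M                                       ∎
  where open ≤-Reasoning

-- Each (n + 1) C(n , k) divides M and is thus at most M. Summing over the n + 1 entries of the row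
-- gives (n + 1) 2 ^ n ≤ (n + 1) M.
common-multiple-≥ : ∀ n {M} → .{{NonZero M}} → (∀ i → i ≤ n → suc i ∣ M) → 2 ^ n ≤ M
common-multiple-≥ n {M} div = *-cancelˡ-≤ (suc n) (begin
  suc n * 2 ^ n             ≡⟨ cong (suc n *_) (rowSum≡2^ n) ⟨
  suc n * rowSum n (suc n)  ≤⟨ rowSum-≤ n (λ k k≤n → ∣⇒≤ (leibniz-∣ k n div k≤n)) (suc n) ≤-refl ⟩
  suc n * M                 ∎)
  where open ≤-Reasoning

-- Residues, counted downwards: ν p′ x represents − x modulo p′ + 1

dec : ℕ → ℕ → ℕ
dec p′ zero    = p′
dec p′ (suc r) = r

-- Counting down makes the wrap-around a test against zero, which the language decides by looking at
-- one node; counting up would need a comparison with the modulus at every step.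
ν : ℕ → ℕ → ℕ
ν p′ zero    = 0
ν p′ (suc x) = dec p′ (ν p′ x)

dec-≤ : ∀ {p′ r} → r ≤ p′ → dec p′ r ≤ p′
dec-≤ {r = zero}  _   = ≤-refl
dec-≤ {r = suc r} r≤p = <⇒≤ r≤p

ν-≤ : ∀ p′ x → ν p′ x ≤ p′
ν-≤ p′ zero    = z≤n
ν-≤ p′ (suc x) = dec-≤ (ν-≤ p′ x)

ν-∣ : ∀ p′ x → suc p′ ∣ ν p′ x + x
ν-∣ p′ zero    = suc p′ ∣0
ν-∣ p′ (suc x) with ν p′ x | ν-∣ p′ x
... | zero  | d = subst (suc p′ ∣_) (sym (+-suc p′ x)) (∣m∣n⇒∣m+n ∣-refl d)
... | suc r | d = subst (suc p′ ∣_) (sym (+-suc r x)) d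

ν-≡⇒∣∸ : ∀ p′ {x y} → x ≤ y → ν p′ x ≡ ν p′ y → suc p′ ∣ y ∸ x
ν-≡⇒∣∸ p′ {x} {y} x≤y eq = ∣m+n∣m⇒∣n (subst (suc p′ ∣_) split (ν-∣ p′ y)) (ν-∣ p′ x)
  where
  split : ν p′ y + y ≡ ν p′ x + x + (y ∸ x)
  split = trans (cong₂ _+_ (sym eq) (sym (m+[n∸m]≡n x≤y))) (sym (+-assoc (ν p′ x) x (y ∸ x)))

ν-≡⇒∣ : ∀ p′ x y → ν p′ x ≡ ν p′ y → suc p′ ∣ ∣ x - y ∣
ν-≡⇒∣ p′ x y eq with ≤-total x y
... | inj₁ x≤y = subst (suc p′ ∣_) (sym (m≤n⇒∣m-n∣≡n∸m x≤y)) (ν-≡⇒∣∸ p′ x≤y eq)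
... | inj₂ y≤x = subst (suc p′ ∣_) (sym (m≤n⇒∣n-m∣≡n∸m y≤x)) (ν-≡⇒∣∸ p′ y≤x (sym eq))

length-cartesianProductWith : ∀ {A B C : Set} (f : A → B → C) xs ys →
  length (cartesianProductWith f xs ys) ≡ length xs * length ys
length-cartesianProductWith f []       ys = refl
length-cartesianProductWith f (x ∷ xs) ys = trans (length-++ (map (f x) ys))
  (cong₂ _+_ (length-map (f x) ys) (length-cartesianProductWith f xs ys))

product-≤ : ∀ {B} xs → All (_≤ B) xs → product xs ≤ B ^ length xs
product-≤ []       []       = ≤-refl
product-≤ (x ∷ xs) (p ∷ ps) = *-mono-≤ p (product-≤ xs ps)

product>0 : ∀ {xs} → All (0 <_) xs → 0 < product xs
product>0 []       = s≤s z≤n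
product>0 (p ∷ ps) = *-mono-≤ p (product>0 ps)

nondivisor : ∀ m M → (∀ i → i ≤ m → suc i ∣ M) ⊎ (∃[ i ] (i ≤ m × suc i ∤ M))
nondivisor m M with anyUpTo? (λ i → ¬? (suc i ∣? M)) (suc m)
... | yes (i , s≤s i≤m , i∤M) = inj₂ (i , i≤m , i∤M)
... | no none = inj₁ λ i i≤m → decidable-stable (suc i ∣? M) λ i∤M → none (i , s≤s i≤m , i∤M)

-- The modulus is any number up to the bound not dividing the product of all
-- nonzero differences.
distinguishing-modulus : ∀ L (D : List ℕ) → (∀ {x} → x ∈ D → x < 2 ^ L) →
  ∃[ p′ ] (p′ ≤ suc (length D * length D * L) ×
           (∀ {x y} → x ∈ D → y ∈ D → ν p′ x ≡ ν p′ y → x ≡ y))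
distinguishing-modulus L D D< with nondivisor (suc (length D * length D * L)) Π
  where
  -- Taking the maximum with 1 neutralises the pairs with x = y, so the product is nonzero.
  Π = product (cartesianProductWith (λ x y → 1 ⊔ ∣ x - y ∣) D D)
... | inj₂ (p′ , p′≤ , p∤Π) = p′ , p′≤ , λ {x} {y} x∈D y∈D eq → separate x y x∈D y∈D (ν-≡⇒∣ p′ x y eq) p∤Π
  where
  separate : ∀ x y {p} → x ∈ D → y ∈ D → p ∣ ∣ x - y ∣ →
    p ∤ product (cartesianProductWith (λ x y → 1 ⊔ ∣ x - y ∣) D D) → x ≡ y
  separate x y x∈D y∈D p∣ p∤ with ∣ x - y ∣ in eq
  ... | zero  = ∣m-n∣≡0⇒m≡n eq
  ... | suc d = ⊥-elim (p∤ (∣-trans p∣ (∈⇒∣product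
    (subst (λ z → (1 ⊔ z) ∈ _) eq (∈-cartesianProductWith⁺ (λ x y → 1 ⊔ ∣ x - y ∣) x∈D y∈D)))))
-- If all of 1, ..., l + 2 divided the product, it would be at least 2 ^ (l + 1). But it has |D|²
-- factors of size at most 2 ^ L and so is at most 2 ^ l.
... | inj₁ all = ⊥-elim (<-irrefl refl (begin-strict
    2 ^ l            <⟨ m<m+n (2 ^ l) (≤-trans (m^n>0 2 l) (m≤m+n (2 ^ l) 0)) ⟩
    2 ^ suc l        ≤⟨ common-multiple-≥ (suc l) {{>-nonZero (product>0 (All.tabulate factor>0))}} all ⟩
    product factors  ≤⟨ product-≤ factors (All.tabulate factor≤) ⟩
    (2 ^ L) ^ length factors  ≡⟨ cong ((2 ^ L) ^_) (length-cartesianProductWith _ D D) ⟩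
    (2 ^ L) ^ (length D * length D)  ≡⟨ ^-*-assoc 2 L _ ⟩
    2 ^ (L * (length D * length D))  ≡⟨ cong (2 ^_) (*-comm L _) ⟩
    2 ^ l            ∎))
  where
  open ≤-Reasoning
  l = length D * length D * L
  factors = cartesianProductWith (λ x y → 1 ⊔ ∣ x - y ∣) D D
  factor>0 : ∀ {z} → z ∈ factors → 0 < z
  factor>0 z∈ with ∈-cartesianProductWith⁻ _ D D z∈
  ... | x , y , _ , _ , refl = m≤m⊔n 1 ∣ x - y ∣
  factor≤ : ∀ {z} → z ∈ factors → z ≤ 2 ^ L
  factor≤ z∈ with ∈-cartesianProductWith⁻ _ D D z∈
  ... | x , y , x∈ , y∈ , refl =
    ⊔-lub (m^n>0 2 L) (≤-trans (∣m-n∣≤m⊔n x y) (⊔-lub (<⇒≤ (D< x∈)) (<⇒≤ (D< y∈))))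

-- Counting in lists

private
  variable
    A : Set

unique-⊆⇒length-≤ : ∀ {xs ys : List A} → Unique xs → (∀ {x} → x ∈ xs → x ∈ ys) →
  length xs ≤ length ys
unique-⊆⇒length-≤ [] _ = z≤n
unique-⊆⇒length-≤ {xs = x ∷ xs} (x≢ ∷ u) sub with ∈-∃++ (sub (here refl))
... | as , bs , refl = begin
  suc (length xs)              ≤⟨ s≤s (unique-⊆⇒length-≤ u sub′) ⟩
  suc (length (as ++ bs))      ≡⟨ cong suc (length-++ as) ⟩
  suc (length as + length bs)  ≡⟨ +-suc (length as) (length bs) ⟨
  length as + suc (length bs)  ≡⟨ length-++ as ⟨
  length (as ++ x ∷ bs)        ∎
  where
  open ≤-Reasoning
  sub′ : ∀ {y} → y ∈ xs → y ∈ as ++ bs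
  sub′ y∈xs with ∈-++⁻ as (sub (there y∈xs))
  ... | inj₁ y∈as         = ∈-++⁺ˡ y∈as
  ... | inj₂ (here refl)  = ⊥-elim (All.lookup x≢ y∈xs refl)
  ... | inj₂ (there y∈bs) = ∈-++⁺ʳ as y∈bs

count : (A → Bool) → List A → ℕ
count f []       = 0
count f (x ∷ xs) = if f x then suc (count f xs) else count f xs

count-++ : ∀ (f : A → Bool) xs ys → count f (xs ++ ys) ≡ count f xs + count f ys
count-++ f []       ys = refl
count-++ f (x ∷ xs) ys with f x
... | true  = cong suc (count-++ f xs ys)
... | false = count-++ f xs ys

count-↭ : ∀ (f : A → Bool) {xs ys} → xs ↭ ys → count f xs ≡ count f ys
count-↭ f _↭_.refl          = refl
count-↭ f (prep x p)        = cong (λ c → if f x then suc c else c) (count-↭ f p)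
count-↭ f (swap x y p) with f x | f y
... | true  | true  = cong (2 +_) (count-↭ f p)
... | true  | false = cong suc (count-↭ f p)
... | false | true  = cong suc (count-↭ f p)
... | false | false = count-↭ f p
count-↭ f (_↭_.trans p q)   = trans (count-↭ f p) (count-↭ f q)

count-cong : ∀ {f g : A → Bool} xs → (∀ {x} → x ∈ xs → f x ≡ g x) → count f xs ≡ count g xs
count-cong []       eq = refl
count-cong (x ∷ xs) eq rewrite eq (here refl) =
  cong (λ c → if _ then suc c else c) (count-cong xs (eq ∘ there))

count≡0 : ∀ {f : A → Bool} xs → (∀ {x} → x ∈ xs → f x ≡ false) → count f xs ≡ 0
count≡0 []       eq = refl
count≡0 (x ∷ xs) eq rewrite eq (here refl) = count≡0 xs (eq ∘ there)

count-map : ∀ {B : Set} (f : B → Bool) (g : A → B) xs → count f (map g xs) ≡ count (f ∘ g) xs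
count-map f g []       = refl
count-map f g (x ∷ xs) = cong (λ c → if f (g x) then suc c else c) (count-map f g xs)

count-allFin : ∀ {n} (p : Subset n) → count (lookup p) (allFin n) ≡ ∣ p ∣
count-allFin Vec.[] = refl
count-allFin {suc n} (b Vec.∷ p) = trans (cong (λ c → if b then suc c else c) rest) (size b)
  where
  rest : count (lookup (b Vec.∷ p)) (tabulate suc) ≡ ∣ p ∣
  rest = trans (cong (count (lookup (b Vec.∷ p))) (sym (map-tabulate id suc)))
    (trans (count-map (lookup (b Vec.∷ p)) suc (allFin n)) (count-allFin p))
  size : ∀ b → (if b then suc ∣ p ∣ else ∣ p ∣) ≡ ∣ b Vec.∷ p ∣
  size true  = refl
  size false = refl

-- Encodings and accumulating loops

_≟𝔻_ : DecidableEquality 𝔻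
nil      ≟𝔻 nil        = yes refl
nil      ≟𝔻 cons _ _   = no λ ()
cons _ _ ≟𝔻 nil        = no λ ()
cons a b ≟𝔻 cons c d with a ≟𝔻 c | b ≟𝔻 d
... | yes refl | yes refl = yes refl
... | no a≢c   | _        = no λ { refl → a≢c refl }
... | yes _    | no b≢d   = no λ { refl → b≢d refl }

encList : (A → 𝔻) → List A → 𝔻
encList enc []       = nil
encList enc (x ∷ xs) = cons (enc x) (encList enc xs)

encodeℕ-injective : ∀ {a b} → encodeℕ a ≡ encodeℕ b → a ≡ b
encodeℕ-injective {zero}  {zero}  _  = refl
encodeℕ-injective {suc a} {suc b} eq = cong suc (encodeℕ-injective (cong tail eq))

encList-injective : {enc : A → 𝔻} → (∀ {x y} → enc x ≡ enc y → x ≡ y) →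
  ∀ {xs ys} → encList enc xs ≡ encList enc ys → xs ≡ ys
encList-injective inj {[]}     {[]}     _  = refl
encList-injective inj {x ∷ xs} {y ∷ ys} eq =
  cong₂ _∷_ (inj (cong head eq)) (encList-injective inj (cong tail eq))

-- The counterpart of a fold over a unary numeral: the successive tails of `encodeℕ j` encode j - 1,
-- ..., 0.
countdown : (A → ℕ → A) → A → ℕ → A
countdown g a zero    = a
countdown g a (suc j) = countdown g (g a j) j

countdown-invariant : ∀ {I : A → Set} {g} n →
  (∀ {a} j → j < n → I a → I (g a j)) → ∀ {a} → I a → I (countdown g a n)
countdown-invariant zero    pres i = i
countdown-invariant {I = I} (suc n) pres i =
  countdown-invariant {I = I} n (λ j j<n → pres j (m<n⇒m<1+n j<n)) (pres n ≤-refl i)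

foldl-invariant : ∀ {B : Set} {I : A → Set} {g : A → B → A} xs →
  (∀ {a x} → x ∈ xs → I a → I (g a x)) → ∀ {a} → I a → I (foldl g a xs)
foldl-invariant []       pres i = i
foldl-invariant {I = I} (x ∷ xs) pres i =
  foldl-invariant {I = I} xs (λ x∈ → pres (there x∈)) (pres (here refl) i)

-- The set semantics of one pass of a loop: it adds to the accumulator exactly the elements
-- satisfying R. Order and multiplicity are forgotten, which makes the property stable under folds
-- and composition.
record Collects (f : List A → List A) (R : A → Set) : Set where
  constructor collects
  field
    only : ∀ acc {z} → z ∈ f acc → z ∈ acc ⊎ R z
    keep : ∀ acc {z} → z ∈ acc → z ∈ f acc
    add  : ∀ acc {z} → R z → z ∈ f acc
open Collects

collects-foldl : ∀ {B : Set} {g : List A → B → List A} {R : B → A → Set} →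
  (∀ x → Collects (λ acc → g acc x) (R x)) →
  ∀ xs → Collects (λ acc → foldl g acc xs) (λ z → ∃[ x ] (x ∈ xs × R x z))
collects-foldl c []       = collects (λ _ → inj₁) (λ _ → id) λ _ → λ { (_ , () , _) }
collects-foldl {g = g} {R} c (x ∷ xs) = collects onl (λ acc z∈ → keep IH (g acc x) (keep (c x) acc z∈)) ad
  where
  IH = collects-foldl c xs
  onl : ∀ acc {z} → z ∈ foldl g (g acc x) xs → z ∈ acc ⊎ (∃[ y ] (y ∈ x ∷ xs × R y z))
  onl acc z∈ with only IH _ z∈
  ... | inj₂ (y , y∈ , r) = inj₂ (y , there y∈ , r)
  ... | inj₁ z∈′ with only (c x) acc z∈′
  ...   | inj₁ z∈acc = inj₁ z∈acc
  ...   | inj₂ r     = inj₂ (x , here refl , r)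
  ad : ∀ acc {z} → ∃[ y ] (y ∈ x ∷ xs × R y z) → z ∈ foldl g (g acc x) xs
  ad acc (y , here refl , r) = keep IH _ (add (c x) acc r)
  ad acc (y , there y∈  , r) = add IH _ (y , y∈ , r)

collects-countdown : ∀ {g : List A → ℕ → List A} {R : ℕ → A → Set} →
  (∀ j → Collects (λ acc → g acc j) (R j)) →
  ∀ n → Collects (λ acc → countdown g acc n) (λ z → ∃[ j ] (j < n × R j z))
collects-countdown c zero    = collects (λ _ → inj₁) (λ _ → id) λ _ → λ { (_ , () , _) }
collects-countdown {g = g} {R} c (suc n) = collects onl (λ acc z∈ → keep IH (g acc n) (keep (c n) acc z∈)) ad
  where
  IH = collects-countdown c n
  onl : ∀ acc {z} → z ∈ countdown g (g acc n) n → z ∈ acc ⊎ (∃[ j ] (j < suc n × R j z))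
  onl acc z∈ with only IH _ z∈
  ... | inj₂ (j , j< , r) = inj₂ (j , m<n⇒m<1+n j< , r)
  ... | inj₁ z∈′ with only (c n) acc z∈′
  ...   | inj₁ z∈acc = inj₁ z∈acc
  ...   | inj₂ r     = inj₂ (n , ≤-refl , r)
  ad : ∀ acc {z} → ∃[ j ] (j < suc n × R j z) → z ∈ countdown g (g acc n) n
  ad acc (j , s≤s j≤n , r) with m≤n⇒m<n∨m≡n j≤n
  ... | inj₁ j<n  = add IH _ (j , j<n , r)
  ... | inj₂ refl = keep IH _ (add (c n) acc r)

collects-∘ : ∀ {f g : List A → List A} {R S} → Collects f R → Collects g S →
  Collects (g ∘ f) (λ z → R z ⊎ S z)
collects-∘ {f = f} {g} {R} {S} cf cg = collects onl (λ acc → keep cg (f acc) ∘ keep cf acc)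
  λ acc → λ { (inj₁ r) → keep cg (f acc) (add cf acc r) ; (inj₂ s) → add cg (f acc) s }
  where
  onl : ∀ acc {z} → z ∈ g (f acc) → z ∈ acc ⊎ (R z ⊎ S z)
  onl acc z∈ with only cg (f acc) z∈
  ... | inj₂ s = inj₂ (inj₂ s)
  ... | inj₁ z∈′ with only cf acc z∈′
  ...   | inj₁ z∈acc = inj₁ z∈acc
  ...   | inj₂ r     = inj₂ (inj₁ r)

-- The dynamic program

module DP {n : ℕ} (G : Graph n) where

  V : Set
  V = Fin n

  -- nothing stands for a deleted vertex, and just (v , t , r) for a kept
  -- vertex v with guessed final residue t and current residue r of its degree.
  Entry : Set
  Entry = Maybe (V × ℕ × ℕ)

  -- The modulus minus one, the number of deleted vertices, and the bag.
  State : Set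
  State = ℕ × ℕ × List Entry

  encV : V → 𝔻
  encV v = encodeℕ (toℕ v)

  encE : Entry → 𝔻
  encE nothing            = nil
  encE (just (v , t , r)) = cons (encV v) (cons (encodeℕ t) (encodeℕ r))

  encS : State → 𝔻
  encS (p′ , c , bag) = cons (encodeℕ p′) (cons (encodeℕ c) (encList encE bag))

  encE-injective : ∀ {x y} → encE x ≡ encE y → x ≡ y
  encE-injective {nothing} {nothing} _ = refl
  encE-injective {just _}  {just _}  eq = cong just (cong₂ _,_
    (Fin.toℕ-injective (encodeℕ-injective (cong head eq)))
    (cong₂ _,_ (encodeℕ-injective (cong (head ∘ tail) eq)) (encodeℕ-injective (cong (tail ∘ tail) eq))))

  encS-injective : ∀ {x y} → encS x ≡ encS y → x ≡ y
  encS-injective eq = cong₂ _,_ (encodeℕ-injective (cong head eq))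
    (cong₂ _,_ (encodeℕ-injective (cong (head ∘ tail) eq))
      (encList-injective encE-injective (cong (tail ∘ tail) eq)))

  -- States are compared through their encodings because the program can only compare trees;
  -- `encS-injective` turns this into equality of states.
  isMember : State → List State → Bool
  isMember s = any (λ z → does (encS s ≟𝔻 encS z))

  -- Duplicates are dropped because the running time rests on bounding the length of these lists by
  -- the number of possible states.
  insert : State → List State → List State
  insert s acc = if isMember s acc then acc else s ∷ acc

  isMember⁺ : ∀ {s} acc → s ∈ acc → isMember s acc ≡ true
  isMember⁺ {s} (z ∷ acc) s∈ with encS s ≟𝔻 encS z | s∈
  ... | yes _  | _         = refl
  ... | no s≢z | here refl = ⊥-elim (s≢z refl)
  ... | no _   | there s∈′ = isMember⁺ acc s∈′

  isMember⁻ : ∀ {s} acc → isMember s acc ≡ true → s ∈ acc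
  isMember⁻ {s} (z ∷ acc) eq with encS s ≟𝔻 encS z
  ... | yes s≡z = here (encS-injective s≡z)
  ... | no _    = there (isMember⁻ acc eq)

  collects-insert : ∀ s → Collects (insert s) (_≡ s)
  collects-insert s = collects onl kee ad
    where
    onl : ∀ acc {z} → z ∈ insert s acc → z ∈ acc ⊎ z ≡ s
    onl acc z∈ with isMember s acc | z∈
    ... | true  | z∈acc       = inj₁ z∈acc
    ... | false | here eq     = inj₂ eq
    ... | false | there z∈acc = inj₁ z∈acc
    kee : ∀ acc {z} → z ∈ acc → z ∈ insert s acc
    kee acc z∈ with isMember s acc
    ... | true  = z∈
    ... | false = there z∈
    ad : ∀ acc {z} → z ≡ s → z ∈ insert s acc
    ad acc refl with isMember s acc in eq
    ... | true  = isMember⁻ acc eq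
    ... | false = here refl

  unique-insert : ∀ {s acc} → Unique acc → Unique (insert s acc)
  unique-insert {s} {acc} u with isMember s acc in eq
  ... | true  = u
  ... | false = All.tabulate (λ { z∈ refl → case trans (sym eq) (isMember⁺ acc z∈) of λ () }) ∷ u

  deleted : State → State
  deleted (p′ , c , bag) = p′ , suc c , nothing ∷ bag

  touches : V → Entry → Bool
  touches v nothing            = false
  touches v (just (x , _ , _)) = adj G v x

  residue : ℕ → V → ℕ → List Entry → ℕ
  residue p′ v = foldl (λ r e → if touches v e then dec p′ r else r)

  bump : ℕ → V → Entry → Entry
  bump p′ v nothing            = nothing
  bump p′ v (just (x , t , r)) = just (x , t , (if adj G v x then dec p′ r else r))

  clash : V → ℕ → Entry → Bool
  clash v t nothing            = false
  clash v t (just (x , u , _)) = if adj G v x then does (encodeℕ t ≟𝔻 encodeℕ u) else false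

  -- Guessed final residues are compared, not current ones: the degrees of v and of the vertices in
  -- the bag may still grow.
  conflict : V → ℕ → State → Bool
  conflict v t (_ , _ , bag) = any (clash v t) bag

  kept : V → ℕ → State → State
  kept v t (p′ , c , bag) = p′ , c , just (v , t , residue p′ v 0 bag) ∷ map (bump p′ v) bag

  tryKeep : V → State → List State → ℕ → List State
  tryKeep v s acc t = if conflict v t s then acc else insert (kept v t s) acc

  introState : V → List State → State → List State
  introState v acc s = countdown (tryKeep v s) (insert (deleted s) acc) (suc (proj₁ s))

  intro : V → List State → List State
  intro v = foldl (introState v) []

  -- When a vertex is forgotten all its neighbours have been introduced, so its current residue is
  -- final and can be checked against the guess.
  topSettled : State → Bool
  topSettled (_ , _ , just (_ , t , r) ∷ _) = does (encodeℕ t ≟𝔻 encodeℕ r)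
  topSettled _                              = true

  pop : State → State
  pop (p′ , c , [])      = p′ , c , []
  pop (p′ , c , _ ∷ bag) = p′ , c , bag

  forgetState : List State → State → List State
  forgetState acc s = if topSettled s then insert (pop s) acc else acc

  forget : List State → List State
  forget = foldl forgetState []

  introAll : List V → List State → List State
  introAll vs sts = foldl (λ sts v → intro v sts) sts vs

  -- The vertices of a block lie on top of the bag in reverse order of introduction, so one pop per
  -- vertex removes exactly that block.
  forgetAll : List V → List State → List State
  forgetAll vs sts = foldl (λ sts _ → forget sts) sts vs

  runBlock : List State → List V → List State
  runBlock sts B = forgetAll B (introAll B sts)

  solve : List V → List (List V) → List State → List State
  solve U Bs sts = forgetAll U (foldl runBlock (introAll U sts) Bs)

  data IntroStep (v : V) (s : State) : State → Set where
    delete-step : IntroStep v s (deleted s)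
    keep-step   : ∀ t → t ≤ proj₁ s → conflict v t s ≡ false → IntroStep v s (kept v t s)

  data ForgetStep (s : State) : State → Set where
    forget-step : topSettled s ≡ true → ForgetStep s (pop s)

  private
    collects-tryKeep : ∀ v s t →
      Collects (λ acc → tryKeep v s acc t) (λ z → conflict v t s ≡ false × z ≡ kept v t s)
    collects-tryKeep v s t with conflict v t s
    ... | true  = collects (λ _ → inj₁) (λ _ → id) λ _ → λ { (() , _) }
    ... | false = let c = collects-insert (kept v t s) in
      collects (λ acc → Sum.map₂ (refl ,_) ∘ only c acc) (keep c) (λ acc → add c acc ∘ proj₂)

    collects-introState : ∀ v s → Collects (λ acc → introState v acc s) (IntroStep v s)
    collects-introState v s = collects
      (λ acc → Sum.map₂ (λ { (inj₁ refl) → delete-step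
                            ; (inj₂ (t , s≤s t≤ , nc , refl)) → keep-step t t≤ nc }) ∘ only c acc)
      (keep c)
      λ acc → λ { delete-step → add c acc (inj₁ refl)
                ; (keep-step t t≤ nc) → add c acc (inj₂ (t , s≤s t≤ , nc , refl)) }
      where
      c = collects-∘ (collects-insert (deleted s)) (collects-countdown (collects-tryKeep v s) (suc (proj₁ s)))

    collects-forgetState : ∀ s → Collects (λ acc → forgetState acc s) (ForgetStep s)
    collects-forgetState s with topSettled s in eq
    ... | true  = let c = collects-insert (pop s) in
      collects (λ acc → Sum.map₂ (λ { refl → forget-step eq }) ∘ only c acc) (keep c)
        (λ acc → λ { (forget-step _) → add c acc refl })
    ... | false = collects (λ _ → inj₁) (λ _ → id) λ _ →
      λ { (forget-step eq′) → case trans (sym eq) eq′ of λ () }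

  intro⁻ : ∀ {v sts z} → z ∈ intro v sts → ∃[ s ] (s ∈ sts × IntroStep v s z)
  intro⁻ {v} {sts} z∈ with only (collects-foldl (collects-introState v) sts) [] z∈
  ... | inj₂ r = r

  intro⁺ : ∀ {v sts s z} → s ∈ sts → IntroStep v s z → z ∈ intro v sts
  intro⁺ {v} {sts} s∈ st = add (collects-foldl (collects-introState v) sts) [] (_ , s∈ , st)

  forget⁻ : ∀ {sts z} → z ∈ forget sts → ∃[ s ] (s ∈ sts × ForgetStep s z)
  forget⁻ {sts} z∈ with only (collects-foldl collects-forgetState sts) [] z∈
  ... | inj₂ r = r

  forget⁺ : ∀ {sts s z} → s ∈ sts → ForgetStep s z → z ∈ forget sts
  forget⁺ {sts} s∈ st = add (collects-foldl collects-forgetState sts) [] (_ , s∈ , st)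

  unique-tryKeep : ∀ v s {acc} t → Unique acc → Unique (tryKeep v s acc t)
  unique-tryKeep v s t u with conflict v t s
  ... | true  = u
  ... | false = unique-insert u

  unique-introState : ∀ v {acc} s → Unique acc → Unique (introState v acc s)
  unique-introState v s u =
    countdown-invariant {I = Unique} (suc (proj₁ s)) (λ t _ → unique-tryKeep v s t) (unique-insert u)

  unique-intro : ∀ v sts → Unique (intro v sts)
  unique-intro v sts = foldl-invariant {I = Unique} sts (λ {_} {s} _ → unique-introState v s) []

  unique-forgetState : ∀ {acc} s → Unique acc → Unique (forgetState acc s)
  unique-forgetState s u with topSettled s
  ... | true  = unique-insert u
  ... | false = u

  unique-forget : ∀ sts → Unique (forget sts)
  unique-forget sts = foldl-invariant {I = Unique} sts (λ {_} {s} _ → unique-forgetState s) []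

-- Single steps: shape of states, soundness and completeness

module Correct {n : ℕ} (G : Graph n) where

  open DP G

  data FitsE (p′ : ℕ) (v : V) : Entry → Set where
    none : FitsE p′ v nothing
    some : ∀ {t r} → t ≤ p′ → r ≤ p′ → FitsE p′ v (just (v , t , r))

  record Fits (P j : ℕ) (B : List V) (s : State) : Set where
    constructor fits
    field
      modulus< : proj₁ s < P
      cost≤    : proj₁ (proj₂ s) ≤ j
      entries  : Pointwise (FitsE (proj₁ s)) B (proj₂ (proj₂ s))
  open Fits

  allEntries : ℕ → V → List Entry
  allEntries P v = nothing ∷ cartesianProductWith (λ t r → just (v , t , r)) (upTo P) (upTo P)

  allBags : ℕ → List V → List (List Entry)
  allBags P []      = [] ∷ []
  allBags P (v ∷ B) = cartesianProductWith _∷_ (allEntries P v) (allBags P B)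

  allStates : ℕ → ℕ → List V → List State
  allStates P j B =
    cartesianProductWith _,_ (upTo P) (cartesianProductWith _,_ (upTo (suc j)) (allBags P B))

  -- One factor for the modulus, one for the number of deletions, and for each bag vertex either the
  -- deleted entry or one of P * P pairs of residues.
  stateBound : ℕ → ℕ → ℕ → ℕ
  stateBound P j w = P * (suc j * (1 + P * P) ^ w)

  length-allBags : ∀ P B → length (allBags P B) ≡ (1 + P * P) ^ length B
  length-allBags P []      = refl
  length-allBags P (v ∷ B) = trans
    (length-cartesianProductWith _∷_ (allEntries P v) (allBags P B))
    (cong₂ _*_ (cong suc (trans (length-cartesianProductWith _ (upTo P) (upTo P))
      (cong₂ _*_ (length-upTo P) (length-upTo P)))) (length-allBags P B))

  length-allStates : ∀ P j B → length (allStates P j B) ≡ stateBound P j (length B)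
  length-allStates P j B = trans
    (length-cartesianProductWith _,_ (upTo P) (cartesianProductWith _,_ (upTo (suc j)) (allBags P B)))
    (cong₂ _*_ (length-upTo P) (trans (length-cartesianProductWith _,_ (upTo (suc j)) (allBags P B))
      (cong₂ _*_ (length-upTo (suc j)) (length-allBags P B))))

  ∈-allEntries : ∀ {P p′ v e} → p′ < P → FitsE p′ v e → e ∈ allEntries P v
  ∈-allEntries p<P none         = here refl
  ∈-allEntries p<P (some t≤ r≤) = there (∈-cartesianProductWith⁺ _
    (∈-upTo⁺ (≤-<-trans t≤ p<P)) (∈-upTo⁺ (≤-<-trans r≤ p<P)))

  ∈-allBags : ∀ {P p′ B bag} → p′ < P → Pointwise (FitsE p′) B bag → bag ∈ allBags P B
  ∈-allBags p<P []       = here refl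
  ∈-allBags p<P (f ∷ fs) = ∈-cartesianProductWith⁺ _∷_ (∈-allEntries p<P f) (∈-allBags p<P fs)

  ∈-allStates : ∀ {P j B s} → Fits P j B s → s ∈ allStates P j B
  ∈-allStates (fits p<P c≤ es) = ∈-cartesianProductWith⁺ _,_ (∈-upTo⁺ p<P)
    (∈-cartesianProductWith⁺ _,_ (∈-upTo⁺ (s≤s c≤)) (∈-allBags p<P es))

  length-states-≤ : ∀ {P j B sts} → Unique sts → (∀ {s} → s ∈ sts → Fits P j B s) →
    length sts ≤ stateBound P j (length B)
  length-states-≤ {P} {j} {B} u f = subst (_ ≤_) (length-allStates P j B)
    (unique-⊆⇒length-≤ u (∈-allStates ∘ f))

  residue-≤ : ∀ {p′} v bag {r} → r ≤ p′ → residue p′ v r bag ≤ p′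
  residue-≤ v []        r≤ = r≤
  residue-≤ v (e ∷ bag) r≤ with touches v e
  ... | true  = residue-≤ v bag (dec-≤ r≤)
  ... | false = residue-≤ v bag r≤

  fits-bump : ∀ {p′} v {B bag} → Pointwise (FitsE p′) B bag → Pointwise (FitsE p′) B (map (bump p′ v) bag)
  fits-bump v []                  = []
  fits-bump v (none ∷ fs)         = none ∷ fits-bump v fs
  fits-bump {p′} v (some {r = r} t≤ r≤ ∷ fs) = some t≤ (bumped _) ∷ fits-bump v fs
    where
    bumped : ∀ b → (if b then dec p′ r else r) ≤ p′
    bumped true  = dec-≤ r≤
    bumped false = r≤

  fits-intro : ∀ {P j B v s z} → Fits P j B s → IntroStep v s z → Fits P (suc j) (v ∷ B) z
  fits-intro (fits p<P c≤ es) delete-step = fits p<P (s≤s c≤) (none ∷ es)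
  fits-intro {v = v} {s = _ , _ , bag} (fits p<P c≤ es) (keep-step t t≤ _) =
    fits p<P (m≤n⇒m≤1+n c≤) (some t≤ (residue-≤ v bag z≤n) ∷ fits-bump v es)

  fits-forget : ∀ {P j B v s z} → Fits P j (v ∷ B) s → ForgetStep s z → Fits P j B z
  fits-forget {s = _ , _ , _ ∷ _} (fits p<P c≤ (_ ∷ es)) (forget-step _) = fits p<P c≤ es

  -- Below, the bag B lists the vertices that can still get new neighbours, and
  -- F those that are settled.

  Assignment : Set
  Assignment = V → Maybe ℕ

  keptNeighbour : Assignment → V → V → Bool
  keptNeighbour a x u = adj G x u ∧ is-just (a u)

  keptDegree : Assignment → List V → V → ℕ
  keptDegree a L x = count (keptNeighbour a x) L

  deletions : Assignment → List V → ℕ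
  deletions a = count (λ x → is-nothing (a x))

  entry : ℕ → Assignment → (F B : List V) → V → Entry
  entry p′ a F B x = Maybe.map (λ t → x , t , ν p′ (keptDegree a F x + keptDegree a B x)) (a x)

  -- The state reached when all choices follow a. Soundness says that every state found has this
  -- form, completeness that the states of a suitable a are all found.
  stateOf : ℕ → Assignment → (F B : List V) → State
  stateOf p′ a F B = p′ , deletions a F + deletions a B , map (entry p′ a F B) B

  Proper : Assignment → List V → Set
  Proper a L = ∀ {x y t} → x ∈ L → y ∈ L → adj G x y ≡ true → a x ≡ just t → a y ≢ just t

  Settled : ℕ → Assignment → (F B : List V) → Set
  Settled p′ a F B = ∀ {x t} → x ∈ F → a x ≡ just t → t ≡ ν p′ (keptDegree a F x + keptDegree a B x)

  NonAdjacent : V → List V → Set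
  NonAdjacent v L = ∀ {u} → u ∈ L → adj G v u ≡ false

  module _ {p′ : ℕ} {a : Assignment} {v : V} {F B : List V} where

    entry-deleted : a v ≡ nothing → ∀ x → entry p′ a F (v ∷ B) x ≡ entry p′ a F B x
    entry-deleted av x rewrite av | ∧-zeroʳ (adj G x v) = refl

    entry-kept : ∀ {t} → a v ≡ just t → ∀ x → entry p′ a F (v ∷ B) x ≡ bump p′ v (entry p′ a F B x)
    entry-kept av x rewrite av | ∧-identityʳ (adj G x v) | adj-sym G x v with a x
    ... | nothing = refl
    ... | just _ with adj G v x
    ...   | true  rewrite +-suc (keptDegree a F x) (keptDegree a B x) = refl
    ...   | false = refl

    -- For the induction, the scanned list C is decoupled from the bag B that determines the
    -- entries, and the count starts at an arbitrary j.
    residue-entries : ∀ C j → residue p′ v (ν p′ j) (map (entry p′ a F B) C) ≡ ν p′ (j + keptDegree a C v)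
    residue-entries []      j = cong (ν p′) (sym (+-identityʳ j))
    residue-entries (x ∷ C) j with a x
    ... | nothing rewrite ∧-zeroʳ (adj G v x) = residue-entries C j
    ... | just _  rewrite ∧-identityʳ (adj G v x) with adj G v x
    ...   | true  rewrite +-suc j (keptDegree a C v) = residue-entries C (suc j)
    ...   | false = residue-entries C j

    deg-self : NonAdjacent v F → keptDegree a F v + keptDegree a (v ∷ B) v ≡ keptDegree a B v
    deg-self v≁F rewrite adj-irrefl G v =
      cong (_+ keptDegree a B v) (count≡0 F (λ u∈ → cong (_∧ is-just (a _)) (v≁F u∈)))

    stateOf-deleted : a v ≡ nothing → stateOf p′ a F (v ∷ B) ≡ deleted (stateOf p′ a F B)
    stateOf-deleted av = cong (p′ ,_) (cong₂ _,_ costs bags)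
      where
      costs : deletions a F + deletions a (v ∷ B) ≡ suc (deletions a F + deletions a B)
      costs rewrite av = +-suc (deletions a F) (deletions a B)
      bags : map (entry p′ a F (v ∷ B)) (v ∷ B) ≡ nothing ∷ map (entry p′ a F B) B
      bags = cong₂ _∷_ (cong (Maybe.map _) av) (map-cong (entry-deleted av) B)

    -- Since v has no neighbour among the forgotten vertices, scanning the bag finds all its kept
    -- neighbours.
    stateOf-kept : NonAdjacent v F → ∀ {t} → a v ≡ just t →
      stateOf p′ a F (v ∷ B) ≡ kept v t (stateOf p′ a F B)
    stateOf-kept v≁F {t} av = cong (p′ ,_) (cong₂ _,_ costs bags)
      where
      costs : deletions a F + deletions a (v ∷ B) ≡ deletions a F + deletions a B
      costs rewrite av = refl
      bags : map (entry p′ a F (v ∷ B)) (v ∷ B) ≡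
             just (v , t , residue p′ v 0 (map (entry p′ a F B) B)) ∷
             map (bump p′ v) (map (entry p′ a F B) B)
      bags = cong₂ _∷_
        (trans (cong (Maybe.map _) av)
          (cong (λ r → just (v , t , r)) (trans (cong (ν p′) (deg-self v≁F)) (sym (residue-entries B 0)))))
        (trans (map-cong (entry-kept av) B) (map-∘ B))

    conflict-false⁺ : ∀ {t} C → (∀ {x} → x ∈ C → adj G v x ≡ true → a x ≢ just t) →
      any (clash v t) (map (entry p′ a F B) C) ≡ false
    conflict-false⁺ []      _ = refl
    conflict-false⁺ {t} (x ∷ C) h with a x in ax
    ... | nothing = conflict-false⁺ C (h ∘ there)
    ... | just u with adj G v x in vx
    ...   | false = conflict-false⁺ C (h ∘ there)
    ...   | true with encodeℕ t ≟𝔻 encodeℕ u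
    ...     | no _  = conflict-false⁺ C (h ∘ there)
    ...     | yes eq = ⊥-elim (h (here refl) vx (trans ax (cong just (sym (encodeℕ-injective eq)))))

    conflict-false⁻ : ∀ {t} C → any (clash v t) (map (entry p′ a F B) C) ≡ false →
      ∀ {x} → x ∈ C → adj G v x ≡ true → a x ≢ just t
    conflict-false⁻ {t} (x ∷ C) eq (here refl) vx ax
      rewrite ax | vx with encodeℕ t ≟𝔻 encodeℕ t | eq
    ... | yes _ | ()
    ... | no ¬p | _ = ¬p refl
    conflict-false⁻ {t} (x ∷ C) eq (there x∈) = conflict-false⁻ C (∨-falseʳ eq) x∈
      where
      ∨-falseʳ : ∀ {b c} → b ∨ c ≡ false → c ≡ false
      ∨-falseʳ {false} eq = eq

  intro-complete : ∀ {p′ a v F B sts} → NonAdjacent v F →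
    (∀ {x t} → x ∈ B → adj G v x ≡ true → a v ≡ just t → a x ≢ just t) →
    (∀ {t} → a v ≡ just t → t ≤ p′) →
    stateOf p′ a F B ∈ sts → stateOf p′ a F (v ∷ B) ∈ intro v sts
  intro-complete {p′} {a} {v} {F} {B} {sts} v≁F proper t≤ s∈ = go (a v) refl
    where
    go : ∀ l → a v ≡ l → stateOf p′ a F (v ∷ B) ∈ intro v sts
    go nothing  av = subst (_∈ intro v sts) (sym (stateOf-deleted {F = F} {B} av)) (intro⁺ s∈ delete-step)
    go (just t) av = subst (_∈ intro v sts) (sym (stateOf-kept v≁F av))
      (intro⁺ s∈ (keep-step t (t≤ av) (conflict-false⁺ {F = F} {B} B (λ x∈ vx → proper x∈ vx av))))

  stateOf-pop : ∀ {p′ a x F B} → pop (stateOf p′ a F (x ∷ B)) ≡ stateOf p′ a (x ∷ F) B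
  stateOf-pop {p′} {a} {x} {F} {B} = cong (p′ ,_) (cong₂ _,_
    (move (λ y → is-nothing (a y)))
    (map-cong (λ y → cong (λ d → Maybe.map (λ t → y , t , ν p′ d) (a y)) (move (keptNeighbour a y))) B))
    where
    move : ∀ f → count f F + count f (x ∷ B) ≡ count f (x ∷ F) + count f B
    move f with f x
    ... | true  = +-suc (count f F) (count f B)
    ... | false = refl

  deg-move : ∀ {a x F B} y →
    keptDegree a F y + keptDegree a (x ∷ B) y ≡ keptDegree a (x ∷ F) y + keptDegree a B y
  deg-move {a} {x} {F} {B} y with keptNeighbour a y x
  ... | true  = +-suc (keptDegree a F y) (keptDegree a B y)
  ... | false = refl

  forget-complete : ∀ {p′ a x F B sts} →
    (∀ {t} → a x ≡ just t → t ≡ ν p′ (keptDegree a F x + keptDegree a (x ∷ B) x)) →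
    stateOf p′ a F (x ∷ B) ∈ sts → stateOf p′ a (x ∷ F) B ∈ forget sts
  forget-complete {p′} {a} {x} {F} {B} {sts} settled s∈ =
    subst (_∈ forget sts) (stateOf-pop {F = F}) (forget⁺ s∈ (forget-step top))
    where
    r = ν p′ (keptDegree a F x + keptDegree a (x ∷ B) x)
    top′ : ∀ l → (∀ {t} → l ≡ just t → t ≡ r) → ∀ c bag →
      topSettled (p′ , c , Maybe.map (λ t → x , t , r) l ∷ bag) ≡ true
    top′ nothing  _ _ _ = refl
    top′ (just t) h _ _ with encodeℕ t ≟𝔻 encodeℕ r
    ... | yes _ = refl
    ... | no ¬p = ⊥-elim (¬p (cong encodeℕ (h refl)))
    top : topSettled (stateOf p′ a F (x ∷ B)) ≡ true
    top = top′ (a x) settled _ _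

  -- Properness is known for every vertex seen so far, whereas guesses are verified on F only: those
  -- of the bag await their forgetting.
  record Realises (p′ : ℕ) (a : Assignment) (F B : List V) : Set where
    constructor realises
    field
      proper  : Proper a (F ++ B)
      settled : Settled p′ a F B

  -- The modulus is read off the state, so that one statement covers the runs for all moduli
  -- together.
  Sound : (F B : List V) → List State → Set
  Sound F B sts = ∀ {s} → s ∈ sts → ∃[ a ] (s ≡ stateOf (proj₁ s) a F B × Realises (proj₁ s) a F B)

  update : Assignment → V → Maybe ℕ → Assignment
  update a v l x = if does (x Fin.≟ v) then l else a x

  update-same : ∀ a v l → update a v l v ≡ l
  update-same a v l with v Fin.≟ v
  ... | yes _  = refl
  ... | no v≢v = ⊥-elim (v≢v refl)

  update-other : ∀ a {v x} l → x ≢ v → update a v l x ≡ a x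
  update-other a {v} {x} l x≢v with x Fin.≟ v
  ... | yes x≡v = ⊥-elim (x≢v x≡v)
  ... | no _    = refl

  deg-cong : ∀ {a a′} L x → (∀ {y} → y ∈ L → a y ≡ a′ y) → keptDegree a L x ≡ keptDegree a′ L x
  deg-cong L x eq = count-cong L (λ y∈ → cong (λ m → adj G x _ ∧ is-just m) (eq y∈))

  module _ {p′ : ℕ} {a a′ : Assignment} {F B : List V}
           (F≡ : ∀ {y} → y ∈ F → a y ≡ a′ y) (B≡ : ∀ {y} → y ∈ B → a y ≡ a′ y) where

    degs-cong : ∀ x → keptDegree a F x + keptDegree a B x ≡ keptDegree a′ F x + keptDegree a′ B x
    degs-cong x = cong₂ _+_ (deg-cong F x F≡) (deg-cong B x B≡)

    stateOf-cong : stateOf p′ a F B ≡ stateOf p′ a′ F B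
    stateOf-cong = cong (p′ ,_) (cong₂ _,_
      (cong₂ _+_ (count-cong F (cong is-nothing ∘ F≡)) (count-cong B (cong is-nothing ∘ B≡)))
      (map-cong-∈ B (λ {x} x∈ → cong₂ (λ d m → Maybe.map (λ t → x , t , ν p′ d) m) (degs-cong x) (B≡ x∈))))
      where
      map-cong-∈ : ∀ {f g : V → Entry} xs → (∀ {x} → x ∈ xs → f x ≡ g x) → map f xs ≡ map g xs
      map-cong-∈ []       eq = refl
      map-cong-∈ (x ∷ xs) eq = cong₂ _∷_ (eq (here refl)) (map-cong-∈ xs (eq ∘ there))

    realises-cong : Realises p′ a F B → Realises p′ a′ F B
    realises-cong (realises pr st) = realises
      (λ x∈ y∈ xy ax ay → pr x∈ y∈ xy (trans (both x∈) ax) (trans (both y∈) ay))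
      (λ {x} x∈ ax → trans (st x∈ (trans (F≡ x∈) ax)) (cong (ν p′) (degs-cong x)))
      where
      both : ∀ {y} → y ∈ F ++ B → a y ≡ a′ y
      both y∈ with ∈-++⁻ F y∈
      ... | inj₁ y∈F = F≡ y∈F
      ... | inj₂ y∈B = B≡ y∈B

  -- With no neighbour in F, the new vertex can neither clash with a settled vertex nor change its
  -- degree.
  realises-intro : ∀ {p′ a v F B} → NonAdjacent v F →
    (∀ {x t} → x ∈ B → adj G v x ≡ true → a v ≡ just t → a x ≢ just t) →
    Realises p′ a F B → Realises p′ a F (v ∷ B)
  realises-intro {p′} {a} {v} {F} {B} v≁F new (realises pr st) = realises pr′ st′
    where
    new′ : ∀ {y t} → y ∈ F ++ B → adj G v y ≡ true → a v ≡ just t → a y ≢ just t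
    new′ {y} y∈ vy with ∈-++⁻ F y∈
    ... | inj₂ y∈B = new y∈B vy
    ... | inj₁ y∈F with trans (sym (v≁F y∈F)) vy
    ...   | ()
    split : ∀ {y} → y ∈ F ++ v ∷ B → y ≡ v ⊎ y ∈ F ++ B
    split y∈ with ∈-++⁻ F y∈
    ... | inj₁ y∈F         = inj₂ (∈-++⁺ˡ y∈F)
    ... | inj₂ (here refl) = inj₁ refl
    ... | inj₂ (there y∈B) = inj₂ (∈-++⁺ʳ F y∈B)
    pr′ : Proper a (F ++ v ∷ B)
    pr′ {x} {y} x∈ y∈ xy ax ay with split x∈ | split y∈
    ... | inj₂ x∈′  | inj₂ y∈′  = pr x∈′ y∈′ xy ax ay
    ... | inj₁ refl | inj₂ y∈′  = new′ y∈′ xy ax ay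
    ... | inj₂ x∈′  | inj₁ refl = new′ x∈′ (trans (adj-sym G v x) xy) ay ax
    ... | inj₁ refl | inj₁ refl with trans (sym (adj-irrefl G v)) xy
    ...   | ()
    st′ : Settled p′ a F (v ∷ B)
    st′ {x} x∈ ax = trans (st x∈ ax) (cong (λ d → ν p′ (keptDegree a F x + d)) (sym same))
      where
      same : keptDegree a (v ∷ B) x ≡ keptDegree a B x
      same rewrite trans (adj-sym G x v) (v≁F x∈) = refl

  -- The assignment behind the old state is overwritten at v with the choice made. As v occurs in
  -- neither F nor B, the old state still belongs to the new assignment.
  intro-sound : ∀ {v F B sts} → NonAdjacent v F → v ∉ F → v ∉ B → Sound F B sts →
    Sound F (v ∷ B) (intro v sts)
  intro-sound {v} {F} {B} v≁F v∉F v∉B snd z∈ with intro⁻ z∈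
  ... | s , s∈ , st with snd s∈
  ...   | a , s≡ , re = extend st
    where
    p′ = proj₁ s
    agree : ∀ l {L y} → v ∉ L → y ∈ L → a y ≡ update a v l y
    agree l v∉L y∈ = sym (update-other a l (λ { refl → v∉L y∈ }))
    s≡′ : ∀ l → s ≡ stateOf p′ (update a v l) F B
    s≡′ l = trans s≡ (stateOf-cong {p′} {F = F} {B} (agree l v∉F) (agree l v∉B))
    re′ : ∀ l → Realises p′ (update a v l) F B
    re′ l = realises-cong {F = F} {B} (agree l v∉F) (agree l v∉B) re
    extend : ∀ {z} → IntroStep v s z →
      ∃[ b ] (z ≡ stateOf (proj₁ z) b F (v ∷ B) × Realises (proj₁ z) b F (v ∷ B))
    extend delete-step = b ,
      trans (cong deleted (s≡′ nothing))
        (sym (stateOf-deleted {p′} {b} {F = F} {B} (update-same a v nothing))) ,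
      realises-intro v≁F new (re′ nothing)
      where
      b = update a v nothing
      new : ∀ {x t} → x ∈ B → adj G v x ≡ true → b v ≡ just t → b x ≢ just t
      new _ _ bv with trans (sym (update-same a v nothing)) bv
      ... | ()
    extend (keep-step t _ nc) = b ,
      trans (cong (kept v t) (s≡′ (just t)))
        (sym (stateOf-kept {p′} {b} {B = B} v≁F (update-same a v (just t)))) ,
      realises-intro v≁F new (re′ (just t))
      where
      b = update a v (just t)
      new : ∀ {x u} → x ∈ B → adj G v x ≡ true → b v ≡ just u → b x ≢ just u
      new x∈ vx bv bx with trans (sym (update-same a v (just t))) bv
      ... | refl = conflict-false⁻ {p′} {b} {F = F} {B} B
        (trans (cong (conflict v t) (sym (s≡′ (just t)))) nc) x∈ vx bx

  -- The passed test `topSettled` settles x itself; for the vertices settled earlier, moving x from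
  -- the bag to F leaves the degree sums unchanged.
  forget-sound : ∀ {x F B sts} → Sound F (x ∷ B) sts → Sound (x ∷ F) B (forget sts)
  forget-sound {x} {F} {B} snd z∈ with forget⁻ z∈
  ... | s , s∈ , forget-step top with snd s∈
  ...   | a , s≡ , realises pr st = a , eq , realises pr′ st′
    where
    p′ = proj₁ s
    pop-modulus : ∀ s → proj₁ (pop s) ≡ proj₁ s
    pop-modulus (_ , _ , [])    = refl
    pop-modulus (_ , _ , _ ∷ _) = refl
    eq : pop s ≡ stateOf (proj₁ (pop s)) a (x ∷ F) B
    eq = trans (cong pop s≡) (trans (stateOf-pop {p′} {a} {x} {F} {B})
      (cong (λ q → stateOf q a (x ∷ F) B) (sym (pop-modulus s))))
    pr′ : Proper a ((x ∷ F) ++ B)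
    pr′ y∈ z∈ = pr (back y∈) (back z∈)
      where
      back : ∀ {y} → y ∈ x ∷ F ++ B → y ∈ F ++ x ∷ B
      back (here refl) = ∈-++⁺ʳ F (here refl)
      back (there y∈) with ∈-++⁻ F y∈
      ... | inj₁ y∈F = ∈-++⁺ˡ y∈F
      ... | inj₂ y∈B = ∈-++⁺ʳ F (there y∈B)
    top′ : topSettled (stateOf p′ a F (x ∷ B)) ≡ true
    top′ = trans (cong topSettled (sym s≡)) top
    r = ν p′ (keptDegree a F x + keptDegree a (x ∷ B) x)
    st-x′ : ∀ {l t c bag} → topSettled (p′ , c , Maybe.map (λ t → x , t , r) l ∷ bag) ≡ true → l ≡ just t →
      t ≡ r
    st-x′ {t = t} top refl with encodeℕ t ≟𝔻 encodeℕ r | top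
    ... | yes q | _ = encodeℕ-injective q
    st-x : ∀ {t} → a x ≡ just t → t ≡ r
    st-x = st-x′ {a x} top′
    st′ : Settled (proj₁ (pop s)) a (x ∷ F) B
    st′ {y} y∈ ay rewrite pop-modulus s = trans (old y∈ ay) (cong (ν p′) (deg-move {a} {x} {F} {B} y))
      where
      old : ∀ {y t} → y ∈ x ∷ F → a y ≡ just t → t ≡ ν p′ (keptDegree a F y + keptDegree a (x ∷ B) y)
      old (here refl) = st-x
      old (there y∈)  = st y∈

-- Duplicates, permutations and reversal in lists

unique-↭ : ∀ {A : Set} {xs ys : List A} → xs ↭ ys → Unique xs → Unique ys
unique-↭ _↭_.refl        u                         = u
unique-↭ (prep x p)      (x≢ ∷ u)                  =
  All.tabulate (λ y∈ → All.lookup x≢ (∈-resp-↭ (↭-sym p) y∈)) ∷ unique-↭ p u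
unique-↭ (swap x y p)    ((x≢y ∷ x≢) ∷ (y≢ ∷ u))   =
  ((x≢y ∘ sym) ∷ All.tabulate (λ z∈ → All.lookup y≢ (∈-resp-↭ (↭-sym p) z∈))) ∷
  All.tabulate (λ z∈ → All.lookup x≢ (∈-resp-↭ (↭-sym p) z∈)) ∷ unique-↭ p u
unique-↭ (_↭_.trans p q) u                         = unique-↭ q (unique-↭ p u)

unique-++⁻ʳ : ∀ {A : Set} (xs : List A) {ys} → Unique (xs ++ ys) → Unique ys
unique-++⁻ʳ []       u       = u
unique-++⁻ʳ (x ∷ xs) (_ ∷ u) = unique-++⁻ʳ xs u

unique-++⁻ˡ : ∀ {A : Set} (xs : List A) {ys} → Unique (xs ++ ys) → Unique xs
unique-++⁻ˡ []       u        = []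
unique-++⁻ˡ (x ∷ xs) (x≢ ∷ u) = All.tabulate (λ y∈ → All.lookup x≢ (∈-++⁺ˡ y∈)) ∷ unique-++⁻ˡ xs u

unique-++⁻-disjoint : ∀ {A : Set} (xs : List A) {ys x} → Unique (xs ++ ys) → x ∈ xs → x ∉ ys
unique-++⁻-disjoint (x ∷ xs) (x≢ ∷ u) (here refl) x∈ys = All.lookup x≢ (∈-++⁺ʳ xs x∈ys) refl
unique-++⁻-disjoint (x ∷ xs) (x≢ ∷ u) (there x∈)  x∈ys = unique-++⁻-disjoint xs u x∈ x∈ys

∈-ʳ++⁻ : ∀ {A : Set} (xs : List A) {ys x} → x ∈ xs ʳ++ ys → x ∈ xs ⊎ x ∈ ys
∈-ʳ++⁻ []       x∈ = inj₂ x∈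
∈-ʳ++⁻ (y ∷ xs) x∈ with ∈-ʳ++⁻ xs x∈
... | inj₁ x∈xs         = inj₁ (there x∈xs)
... | inj₂ (here refl)  = inj₁ (here refl)
... | inj₂ (there x∈ys) = inj₂ x∈ys

∈-reverse⁻ : ∀ {A : Set} (xs : List A) {x} → x ∈ reverse xs → x ∈ xs
∈-reverse⁻ xs x∈ with ∈-ʳ++⁻ xs x∈
... | inj₁ x∈xs = x∈xs

count-ʳ++ : ∀ {A : Set} (f : A → Bool) xs ys → count f (xs ʳ++ ys) ≡ count f xs + count f ys
count-ʳ++ f []       ys = refl
count-ʳ++ f (x ∷ xs) ys with count-ʳ++ f xs (x ∷ ys)
... | eq with f x
...   | true  = trans eq (+-suc (count f xs) (count f ys))
...   | false = eq

-- The dynamic program over a separator and its blocks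

module Decomposition {n : ℕ} (G : Graph n) where

  open DP G
  open Correct G

  introAll-sound : ∀ vs {F B sts} → Unique vs → (∀ {v} → v ∈ vs → NonAdjacent v F × v ∉ F × v ∉ B) →
    Sound F B sts → Sound F (vs ʳ++ B) (introAll vs sts)
  introAll-sound []       u        h snd = snd
  introAll-sound (v ∷ vs) {B = B} (v≢ ∷ u) h snd =
    let (v≁F , v∉F , v∉B) = h (here refl) in
    introAll-sound vs u (λ w∈ → let (w≁F , w∉F , w∉B) = h (there w∈) in w≁F , w∉F , new w∈ w∉B)
      (intro-sound v≁F v∉F v∉B snd)
    where
    new : ∀ {w} → w ∈ vs → w ∉ B → w ∉ v ∷ B
    new w∈ _   (here refl)  = All.lookup v≢ w∈ refl
    new w∈ w∉B (there w∈B) = w∉B w∈B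

  forgetAll-sound : ∀ vs ws {F B sts} → length vs ≡ length ws →
    Sound F (ws ++ B) sts → Sound (ws ʳ++ F) B (forgetAll vs sts)
  forgetAll-sound []       []       eq snd = snd
  forgetAll-sound (v ∷ vs) (w ∷ ws) eq snd =
    forgetAll-sound vs ws (suc-injective eq) (forget-sound snd)

  -- Introduction reverses the block onto the bag and forgetting reverses it again onto F, so it
  -- arrives in its original order.
  forgetAll-reverse-sound : ∀ vs {F B sts} → Sound F (vs ʳ++ B) sts → Sound (vs ++ F) B (forgetAll vs sts)
  forgetAll-reverse-sound vs {F} {B} {sts} snd =
    subst (λ F → Sound F B (forgetAll vs sts)) (ʳ++-ʳ++ vs {[]} {F})
      (forgetAll-sound vs (reverse vs) (sym (length-reverse vs))
        (subst (λ B → Sound F B sts) (ʳ++-defn vs) snd))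

  -- F lists the vertices already settled, U the separator and Bs the blocks
  -- that remain.
  record Layout (F U : List V) (Bs : List (List V)) : Set where
    constructor layout
    field
      cover : F ++ U ++ concat Bs ↭ allFin n
      F≁    : ∀ {x} → x ∈ F → NonAdjacent x (concat Bs)
      apart : AllPairs (λ B C → ∀ {x} → x ∈ B → NonAdjacent x C) Bs
  open Layout

  settle : List V → List (List V) → List V
  settle = foldl (λ F B → B ++ F)

  cover-next : ∀ (F U B : List V) C → F ++ U ++ B ++ C ↭ (B ++ F) ++ U ++ C
  cover-next F U B C = begin
    F ++ U ++ B ++ C      ↭⟨ ++⁺ˡ F (shifts U B) ⟩
    F ++ B ++ U ++ C      ↭⟨ shifts F B ⟩
    B ++ F ++ U ++ C      ≡⟨ ++-assoc B F (U ++ C) ⟨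
    (B ++ F) ++ U ++ C    ∎
    where open PermutationReasoning

  layout-next : ∀ {F U B Bs} → Layout F U (B ∷ Bs) → Layout (B ++ F) U Bs
  layout-next {F} {U} {B} {Bs} (layout co ff (ap ∷ aps)) = layout
    (↭-trans (↭-sym (cover-next F U B (concat Bs))) co) ff′ aps
    where
    ff′ : ∀ {x} → x ∈ B ++ F → NonAdjacent x (concat Bs)
    ff′ x∈ y∈ with ∈-++⁻ B x∈
    ... | inj₂ x∈F = ff x∈F (∈-++⁺ʳ B y∈)
    ... | inj₁ x∈B with ∈-concat⁻′ Bs y∈
    ...   | C , y∈C , C∈ = All.lookup ap C∈ x∈B y∈C

  layout-end : ∀ {F U} Bs → Layout F U Bs → settle F Bs ++ U ↭ allFin n
  layout-end {F} {U} []       l =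
    ↭-trans (↭-reflexive (cong (F ++_) (sym (List.++-identityʳ U)))) (cover l)
  layout-end         (B ∷ Bs) l = layout-end Bs (layout-next l)

  nonAdjacent-sym : ∀ {F L} → (∀ {x} → x ∈ F → NonAdjacent x L) → ∀ {y} → y ∈ L → NonAdjacent y F
  nonAdjacent-sym h y∈ x∈ = trans (adj-sym G _ _) (h x∈ y∈)

  layout-unique : ∀ {F U B Bs} → Layout F U (B ∷ Bs) → Unique B × (∀ {v} → v ∈ B → v ∉ F × v ∉ U)
  layout-unique {F} {U} {B} {Bs} l = unique-++⁻ˡ B uBFU ,
    λ v∈ → (λ v∈F → dis v∈ (∈-++⁺ˡ v∈F)) , (λ v∈U → dis v∈ (∈-++⁺ʳ F (∈-++⁺ˡ v∈U)))
    where
    uBFU : Unique (B ++ F ++ U ++ concat Bs)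
    uBFU = unique-↭ (↭-trans (↭-sym (cover l))
      (↭-trans (cover-next F U B (concat Bs)) (↭-reflexive (++-assoc B F (U ++ concat Bs))))) (allFin⁺ n)
    dis : ∀ {v} → v ∈ B → v ∉ F ++ U ++ concat Bs
    dis = unique-++⁻-disjoint B uBFU

  runBlocks-sound : ∀ Bs {F U sts} → Layout F U Bs → Sound F (reverse U) sts →
    Sound (settle F Bs) (reverse U) (foldl runBlock sts Bs)
  runBlocks-sound []       l snd = snd
  runBlocks-sound (B ∷ Bs) {F} {U} l snd = let (uB , B∉) = layout-unique l in
    runBlocks-sound Bs (layout-next l) (forgetAll-reverse-sound B (introAll-sound B uB
      (λ v∈ → nonAdjacent-sym (F≁ l) (∈-++⁺ˡ v∈) , proj₁ (B∉ v∈) , proj₂ (B∉ v∈) ∘ ∈-reverse⁻ U) snd))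

  solve-sound : ∀ {U Bs sts} → Layout [] U Bs → Sound [] [] sts →
    Sound (U ++ settle [] Bs) [] (solve U Bs sts)
  solve-sound {U} {Bs} l snd = forgetAll-reverse-sound U (runBlocks-sound Bs l
    (introAll-sound U (unique-++⁻ˡ U (unique-↭ (↭-sym (cover l)) (allFin⁺ n)))
      (λ _ → (λ ()) , (λ ()) , (λ ())) snd))

  -- The labels are the residues of the true final degrees, so every test of the dynamic program
  -- succeeds along the run that follows a.
  module _ {p′ : ℕ} {a : Assignment}
           (proper : ∀ {x y t} → adj G x y ≡ true → a x ≡ just t → a y ≢ just t)
           (labels : ∀ {x t} → a x ≡ just t → t ≡ ν p′ (keptDegree a (allFin n) x)) where

    introAll-complete : ∀ vs {F B sts} → (∀ {v} → v ∈ vs → NonAdjacent v F) →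
      stateOf p′ a F B ∈ sts → stateOf p′ a F (vs ʳ++ B) ∈ introAll vs sts
    introAll-complete []       h s∈ = s∈
    introAll-complete (v ∷ vs) h s∈ = introAll-complete vs (h ∘ there) (intro-complete (h (here refl))
      (λ _ vx av → proper vx av) (λ av →
        subst (_≤ p′) (sym (labels av)) (ν-≤ p′ (keptDegree a (allFin n) v))) s∈)

    private
      d : List V → V → ℕ
      d = keptDegree a

    forgetAll-complete : ∀ vs ws {F B sts} → length vs ≡ length ws →
      (∀ {x} → x ∈ ws → d F x + d (ws ++ B) x ≡ d (allFin n) x) →
      stateOf p′ a F (ws ++ B) ∈ sts → stateOf p′ a (ws ʳ++ F) B ∈ forgetAll vs sts
    forgetAll-complete []       []       eq h s∈ = s∈
    forgetAll-complete (v ∷ vs) (w ∷ ws) {F} {B} eq h s∈ =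
      forgetAll-complete vs ws (suc-injective eq)
        (λ {x} x∈ → trans (sym (deg-move {a} {w} {F} {ws ++ B} x)) (h (there x∈)))
        (forget-complete {F = F} (λ aw → trans (labels aw) (cong (ν p′) (sym (h (here refl))))) s∈)

    forgetAll-reverse-complete : ∀ vs {F B sts} →
      (∀ {x} → x ∈ vs → d F x + d (vs ʳ++ B) x ≡ d (allFin n) x) →
      stateOf p′ a F (vs ʳ++ B) ∈ sts → stateOf p′ a (vs ++ F) B ∈ forgetAll vs sts
    forgetAll-reverse-complete vs {F} {B} {sts} h s∈ =
      subst (λ F → stateOf p′ a F B ∈ forgetAll vs sts) (ʳ++-ʳ++ vs {[]} {F})
        (forgetAll-complete vs (reverse vs) (sym (length-reverse vs))
          (λ {x} x∈ → subst (λ C → d F x + d C x ≡ d (allFin n) x) (ʳ++-defn vs) (h (∈-reverse⁻ vs x∈)))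
          (subst (λ C → stateOf p′ a F C ∈ sts) (ʳ++-defn vs) s∈))

    runBlocks-complete : ∀ Bs {F U sts} → Layout F U Bs → stateOf p′ a F (reverse U) ∈ sts →
      stateOf p′ a (settle F Bs) (reverse U) ∈ foldl runBlock sts Bs
    runBlocks-complete []       l s∈ = s∈
    runBlocks-complete (B ∷ Bs) {F} {U} l s∈ = runBlocks-complete Bs (layout-next l)
      (forgetAll-reverse-complete B all-seen
        (introAll-complete B (λ v∈ → nonAdjacent-sym (F≁ l) (∈-++⁺ˡ v∈)) s∈))
      where
      open ≤-Reasoning
      -- When a block is forgotten, its vertices have no neighbours in the later blocks, so F, the
      -- block and the separator already account for the full degree.
      all-seen : ∀ {x} → x ∈ B → d F x + d (B ʳ++ reverse U) x ≡ d (allFin n) x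
      all-seen {x} x∈ = begin-equality
        d F x + d (B ʳ++ reverse U) x    ≡⟨ cong (d F x +_) (count-ʳ++ f B (reverse U)) ⟩
        d F x + (d B x + d (reverse U) x)  ≡⟨ cong (λ z → d F x + (d B x + z))
          (trans (count-ʳ++ f U []) (+-identityʳ _)) ⟩
        d F x + (d B x + d U x)          ≡⟨ cong (d F x +_) (+-comm (d B x) _) ⟩
        d F x + (d U x + d B x)          ≡⟨ cong (λ z → d F x + (d U x + z)) (+-identityʳ _) ⟨
        d F x + (d U x + (d B x + 0))    ≡⟨ cong (λ z → d F x + (d U x + (d B x + z)))
          (count≡0 (concat Bs) rest) ⟨
        d F x + (d U x + (d B x + d (concat Bs) x))
          ≡⟨ cong (d F x +_) (trans (count-++ f U _) (cong (d U x +_) (count-++ f B (concat Bs)))) ⟨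
        d F x + d (U ++ B ++ concat Bs) x  ≡⟨ count-++ f F _ ⟨
        d (F ++ U ++ B ++ concat Bs) x   ≡⟨ count-↭ f (cover l) ⟩
        d (allFin n) x                   ∎
        where
        f = keptNeighbour a x
        rest : ∀ {y} → y ∈ concat Bs → f y ≡ false
        rest y∈ = cong (_∧ _) (F≁ (layout-next l) (∈-++⁺ˡ x∈) y∈)

    solve-complete : ∀ {U Bs sts} → Layout [] U Bs → stateOf p′ a [] [] ∈ sts →
      stateOf p′ a (U ++ settle [] Bs) [] ∈ solve U Bs sts
    solve-complete {U} {Bs} l s∈ = forgetAll-reverse-complete U
      (λ {x} _ → trans (cong (d (settle [] Bs) x +_)
        (trans (count-ʳ++ (keptNeighbour a x) U []) (+-identityʳ _)))
        (trans (sym (count-++ (keptNeighbour a x) (settle [] Bs) U))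
          (count-↭ (keptNeighbour a x) (layout-end Bs l))))
      (runBlocks-complete Bs l (introAll-complete U {F = []} (λ _ ()) s∈))

  -- Solutions of the dynamic program and vertex-irregulators

  lookup-neighbours : ∀ (S : Subset n) x u → lookup (neighbours G x ∩ ∁ S) u ≡ adj G x u ∧ not (lookup S u)
  lookup-neighbours S x u = trans (Vec.lookup-zipWith _∧_ u (neighbours G x) (∁ S))
    (cong₂ _∧_ (Vec.lookup∘tabulate (adj G x) u) (Vec.lookup-map u not S))

  degree≡deg : ∀ (S : Subset n) a → (∀ x → is-just (a x) ≡ not (lookup S x)) →
    ∀ x → degree G (∁ S) x ≡ keptDegree a (allFin n) x
  degree≡deg S a a≡S x = trans (sym (count-allFin (neighbours G x ∩ ∁ S)))
    (count-cong (allFin n) (λ {u} _ → trans (lookup-neighbours S x u) (cong (adj G x u ∧_) (sym (a≡S u)))))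

  size≡deletions : ∀ (S : Subset n) a →
    (∀ x → is-just (a x) ≡ not (lookup S x)) → ∣ S ∣ ≡ deletions a (allFin n)
  size≡deletions S a a≡S = trans (sym (count-allFin S)) (count-cong (allFin n) (λ {u} _ →
    trans (sym (not-involutive (lookup S u))) (cong not (sym (a≡S u)))))

  outside⇒just : ∀ (S : Subset n) (a : Assignment) → (∀ x → is-just (a x) ≡ not (lookup S x)) →
    ∀ {x} → x Subset.∈ ∁ S → ∃[ t ] a x ≡ just t
  outside⇒just S a a≡S {x} x∈ with a x | trans (a≡S x)
    (trans (sym (Vec.lookup-map x not S)) (Vec.[]=⇒lookup x∈))
  ... | just t | _ = t , refl

  -- No property of the modulus enters: once all vertices are settled the labels are residues of the
  -- degrees in G - S, and different residues force different degrees.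
  realises⇒irregulator : ∀ {p′ a F} → F ↭ allFin n → Realises p′ a F [] →
    ∃[ S ] (IsVertexIrregulator G S × ∣ S ∣ ≡ deletions a F + 0)
  realises⇒irregulator {p′} {a} {F} F↭ (realises proper settled) = S , irregular ,
    trans (size≡deletions S a a≡S) (trans (sym (count-↭ _ F↭)) (sym (+-identityʳ _)))
    where
    S : Subset n
    S = Vec.tabulate (λ x → is-nothing (a x))
    a≡S : ∀ x → is-just (a x) ≡ not (lookup S x)
    a≡S x = trans (sym (not-involutive (is-just (a x)))) (cong not (sym (Vec.lookup∘tabulate _ x)))
    everywhere : ∀ x → x ∈ F
    everywhere x = ∈-resp-↭ (↭-sym F↭) (∈-allFin x)
    label : ∀ x {t} → a x ≡ just t → t ≡ ν p′ (degree G (∁ S) x)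
    label x ax = trans (settled (everywhere x) ax) (cong (ν p′) (trans (+-identityʳ _)
      (trans (count-↭ _ F↭) (sym (degree≡deg S a a≡S x)))))
    irregular : IsVertexIrregulator G S
    irregular u v u∈ v∈ uv eq with outside⇒just S a a≡S u∈ | outside⇒just S a a≡S v∈
    ... | t , au | t′ , av = proper (∈-++⁺ˡ (everywhere u)) (∈-++⁺ˡ (everywhere v)) uv au
      (trans av (cong just (trans (label v av) (trans (cong (ν p′) (sym eq)) (sym (label u au))))))

  solve⇒irregulator : ∀ {U Bs sts s} → Layout [] U Bs → Sound [] [] sts → s ∈ solve U Bs sts →
    ∃[ S ] (IsVertexIrregulator G S × ∣ S ∣ ≡ proj₁ (proj₂ s))
  solve⇒irregulator {U} {Bs} l snd s∈ with solve-sound l snd s∈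
  ... | a , s≡ , re with realises⇒irregulator (↭-trans (Perm.++-comm U (settle [] Bs)) (layout-end Bs l)) re
  ...   | S , irr , size = S , irr , trans size (sym (cong (proj₁ ∘ proj₂) s≡))

  -- Kept vertices are labelled with the residues of their degrees in G - S. Adjacent ones have
  -- different degrees, hence different labels by the separation hypothesis.
  irregulator⇒solve : ∀ {U Bs sts} → Layout [] U Bs → ∀ p′ → (p′ , 0 , []) ∈ sts →
    ∀ S → IsVertexIrregulator G S →
    (∀ x y → ν p′ (degree G (∁ S) x) ≡ ν p′ (degree G (∁ S) y) → degree G (∁ S) x ≡ degree G (∁ S) y) →
    ∃[ s ] (s ∈ solve U Bs sts × proj₁ (proj₂ s) ≡ ∣ S ∣)
  irregulator⇒solve {U} {Bs} {sts} l p′ s∈ S irr sep =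
    stateOf p′ a F [] , solve-complete proper
      (λ {x} ax → trans (label ax) (cong (ν p′) (degree≡deg S a a≡S x))) l s∈ ,
    trans (+-identityʳ _) (trans (count-↭ _ F↭) (sym (size≡deletions S a a≡S)))
    where
    F = U ++ settle [] Bs
    F↭ = ↭-trans (Perm.++-comm U (settle [] Bs)) (layout-end Bs l)
    a : Assignment
    a x = if lookup S x then nothing else just (ν p′ (degree G (∁ S) x))
    a≡S : ∀ x → is-just (a x) ≡ not (lookup S x)
    a≡S x with lookup S x
    ... | true  = refl
    ... | false = refl
    label : ∀ {x t} → a x ≡ just t → t ≡ ν p′ (degree G (∁ S) x)
    label {x} ax with lookup S x | ax
    ... | false | refl = refl
    outside : ∀ {x t} → a x ≡ just t → x Subset.∈ ∁ S
    outside {x} ax with lookup S x in eq | ax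
    ... | false | refl = Vec.lookup⇒[]= x (∁ S) (trans (Vec.lookup-map x not S) (cong not eq))
    proper : ∀ {x y t} → adj G x y ≡ true → a x ≡ just t → a y ≢ just t
    proper {x} {y} xy ax ay = irr x y (outside ax) (outside ay) xy
      (sep x y (trans (sym (label ax)) (label ay)))

-- Computing the components that remain without the separator

select : ∀ {A : Set} → (A → Bool) → List A → List A
select f = filter (λ x → f x Bool.≟ true)

length-select : ∀ {A : Set} (f : A → Bool) xs → length (select f xs) ≡ count f xs
length-select f []       = refl
length-select f (x ∷ xs) with f x
... | true  = cong suc (length-select f xs)
... | false = length-select f xs

any⁺ : ∀ {A : Set} (f : A → Bool) {xs x} → x ∈ xs → f x ≡ true → any f xs ≡ true
any⁺ f (here refl) fx rewrite fx = refl
any⁺ f {y ∷ xs} (there x∈) fx with f y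
... | true  = refl
... | false = any⁺ f x∈ fx

any⁻ : ∀ {A : Set} (f : A → Bool) xs → any f xs ≡ true → ∃[ x ] (x ∈ xs × f x ≡ true)
any⁻ f (x ∷ xs) eq with f x in fx
... | true  = x , here refl , fx
... | false = let (y , y∈ , fy) = any⁻ f xs eq in y , there y∈ , fy

length-concatMap-≤ : ∀ {A B : Set} (f : A → List B) {b} xs → (∀ {x} → x ∈ xs → length (f x) ≤ b) →
  length (concatMap f xs) ≤ length xs * b
length-concatMap-≤ f []       h = z≤n
length-concatMap-≤ f {b} (x ∷ xs) h = begin
  length (f x ++ concatMap f xs)         ≡⟨ length-++ (f x) ⟩
  length (f x) + length (concatMap f xs) ≤⟨ +-mono-≤ (h (here refl)) (length-concatMap-≤ f xs (h ∘ there)) ⟩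
  b + length xs * b                      ∎
  where open ≤-Reasoning

∈-ʳ++⁺ʳ : ∀ {A : Set} (xs : List A) {ys x} → x ∈ ys → x ∈ xs ʳ++ ys
∈-ʳ++⁺ʳ []       x∈ = x∈
∈-ʳ++⁺ʳ (y ∷ xs) x∈ = ∈-ʳ++⁺ʳ xs (there x∈)

∈-ʳ++⁺ˡ : ∀ {A : Set} (xs : List A) {ys x} → x ∈ xs → x ∈ xs ʳ++ ys
∈-ʳ++⁺ˡ (y ∷ xs) (here refl) = ∈-ʳ++⁺ʳ xs (here refl)
∈-ʳ++⁺ˡ (y ∷ xs) (there x∈)  = ∈-ʳ++⁺ˡ xs x∈

ʳ++-↭ : ∀ {A : Set} (xs ys : List A) → xs ʳ++ ys ↭ xs ++ ys
ʳ++-↭ []       ys = _↭_.refl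
ʳ++-↭ (x ∷ xs) ys = ↭-trans (ʳ++-↭ xs (x ∷ ys)) (shift x xs ys)

∈-select⁺ : ∀ {A : Set} (f : A → Bool) {xs x} → x ∈ xs → f x ≡ true → x ∈ select f xs
∈-select⁺ f x∈ fx = ∈-filter⁺ (λ x → f x Bool.≟ true) x∈ fx

module Blocks {n : ℕ} (G : Graph n) where

  open DP G
  open Correct G
  open Decomposition G

  elements : Subset n → List V
  elements p = select (lookup p) (allFin n)

  length-elements : ∀ p → length (elements p) ≡ ∣ p ∣
  length-elements p = trans (length-select (lookup p) (allFin n)) (count-allFin p)

  -- M collects v with the blocks it touches, O the other blocks. A block is joined to M by
  -- reverse-append, which a single fold computes.
  mergeStep : V → List V × List (List V) → List V → List V × List (List V)
  mergeStep v (M , O) B = if any (adj G v) B then (B ʳ++ M , O) else (M , B ∷ O)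

  merge : V → List V × List (List V) → List (List V) → List V × List (List V)
  merge v = foldl (mergeStep v)

  uncurry∷ : List V × List (List V) → List (List V)
  uncurry∷ (M , O) = M ∷ O

  addBlock : V → List (List V) → List (List V)
  addBlock v Bs = uncurry∷ (merge v (v ∷ [] , []) Bs)

  splitStep : (V → Bool) → List V × List (List V) → V → List V × List (List V)
  splitStep h (U , Bs) v = if h v then (v ∷ U , Bs) else (U , addBlock v Bs)

  split : (V → Bool) → List V × List (List V)
  split h = foldl (splitStep h) ([] , []) (allFin n)

  Touches : V → List V → Set
  Touches v B = any (adj G v) B ≡ true

  merged⁻ : ∀ v {M O} Bs {x} → x ∈ proj₁ (merge v (M , O) Bs) →
    x ∈ M ⊎ (∃[ B ] (B ∈ Bs × Touches v B × x ∈ B))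
  merged⁻ v []       x∈ = inj₁ x∈
  merged⁻ v (B ∷ Bs) x∈ with any (adj G v) B in eq
  ... | false = Sum.map₂ (λ (C , C∈ , rest) → C , there C∈ , rest) (merged⁻ v Bs x∈)
  ... | true with merged⁻ v Bs x∈
  ...   | inj₂ (C , C∈ , rest) = inj₂ (C , there C∈ , rest)
  ...   | inj₁ x∈′ with ∈-ʳ++⁻ B x∈′
  ...     | inj₁ x∈B = inj₂ (B , here refl , eq , x∈B)
  ...     | inj₂ x∈M = inj₁ x∈M

  merged⁺ : ∀ v {M O} Bs {x} → x ∈ M ⊎ (∃[ B ] (B ∈ Bs × Touches v B × x ∈ B)) →
    x ∈ proj₁ (merge v (M , O) Bs)
  merged⁺ v []       (inj₁ x∈M) = x∈M
  merged⁺ v (B ∷ Bs) p with any (adj G v) B in eq | p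
  ... | true  | inj₁ x∈M                          = merged⁺ v Bs (inj₁ (∈-ʳ++⁺ʳ B x∈M))
  ... | true  | inj₂ (_ , here refl , _ , x∈B)    = merged⁺ v Bs (inj₁ (∈-ʳ++⁺ˡ B x∈B))
  ... | true  | inj₂ (C , there C∈ , rest)        = merged⁺ v Bs (inj₂ (C , C∈ , rest))
  ... | false | inj₁ x∈M                          = merged⁺ v Bs (inj₁ x∈M)
  ... | false | inj₂ (_ , here refl , t , x∈B)    = case trans (sym eq) t of λ ()
  ... | false | inj₂ (C , there C∈ , rest)        = merged⁺ v Bs (inj₂ (C , C∈ , rest))

  others⁻ : ∀ v {M O} Bs {B} → B ∈ proj₂ (merge v (M , O) Bs) → B ∈ O ⊎ (B ∈ Bs × ¬ Touches v B)
  others⁻ v []       B∈ = inj₁ B∈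
  others⁻ v (B ∷ Bs) B∈ with any (adj G v) B in eq
  ... | true  = Sum.map₂ (λ (C∈ , u) → there C∈ , u) (others⁻ v Bs B∈)
  ... | false with others⁻ v Bs B∈
  ...   | inj₂ (C∈ , u)      = inj₂ (there C∈ , u)
  ...   | inj₁ (there C∈O)   = inj₁ C∈O
  ...   | inj₁ (here refl)   = inj₂ (here refl , λ t → case trans (sym eq) t of λ ())

  merge-↭ : ∀ v M O Bs → concat (uncurry∷ (merge v (M , O) Bs)) ↭ (M ++ concat O) ++ concat Bs
  merge-↭ v M O []       = ↭-reflexive (sym (List.++-identityʳ _))
  merge-↭ v M O (B ∷ Bs) with any (adj G v) B
  ... | true  = begin
    concat (uncurry∷ (merge v (B ʳ++ M , O) Bs))    ↭⟨ merge-↭ v (B ʳ++ M) O Bs ⟩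
    ((B ʳ++ M) ++ concat O) ++ concat Bs            ↭⟨ ++⁺ʳ (concat Bs) (++⁺ʳ (concat O) (ʳ++-↭ B M)) ⟩
    ((B ++ M) ++ concat O) ++ concat Bs             ≡⟨ cong (_++ concat Bs) (++-assoc B M (concat O)) ⟩
    (B ++ M ++ concat O) ++ concat Bs               ≡⟨ ++-assoc B _ (concat Bs) ⟩
    B ++ (M ++ concat O) ++ concat Bs               ↭⟨ shifts B (M ++ concat O) ⟩
    (M ++ concat O) ++ B ++ concat Bs               ∎
    where open PermutationReasoning
  ... | false = begin
    concat (uncurry∷ (merge v (M , B ∷ O) Bs))      ↭⟨ merge-↭ v M (B ∷ O) Bs ⟩
    (M ++ B ++ concat O) ++ concat Bs               ↭⟨ ++⁺ʳ (concat Bs) (shifts M B) ⟩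
    (B ++ M ++ concat O) ++ concat Bs               ≡⟨ ++-assoc B _ (concat Bs) ⟩
    B ++ (M ++ concat O) ++ concat Bs               ↭⟨ shifts B (M ++ concat O) ⟩
    (M ++ concat O) ++ B ++ concat Bs               ∎
    where open PermutationReasoning

  addBlock-↭ : ∀ v Bs → concat (addBlock v Bs) ↭ v ∷ concat Bs
  addBlock-↭ v Bs = merge-↭ v (v ∷ []) [] Bs

  module _ (W : Subset n) where

    _~_ : V → V → Set
    _~_ = Star (Edge G W)

    ~-sym : ∀ {x y} → x ~ y → y ~ x
    ~-sym = Star.reverse λ (x∈ , y∈ , xy) → y∈ , x∈ , trans (adj-sym G _ _) xy

    -- Blocks are the components of the graph on the vertices inserted so far, except that
    -- connecting walks may use all of W; connectedness therefore persists while vertices are added.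
    record Good (Bs : List (List V)) : Set where
      constructor mkGood
      field
        inside    : ∀ {x} → x ∈ concat Bs → x Subset.∈ W
        closed    : ∀ {B x y} → B ∈ Bs → x ∈ B → y ∈ concat Bs → adj G x y ≡ true → y ∈ B
        connected : ∀ {B x y} → B ∈ Bs → x ∈ B → y ∈ B → x ~ y

    -- Any two vertices of the merged block are joined by a walk through v. An unmerged block stays
    -- closed because v does not touch it.
    addBlock-good : ∀ {v Bs} → v Subset.∈ W → Good Bs → Good (addBlock v Bs)
    addBlock-good {v} {Bs} v∈W (mkGood ins clo con) = mkGood ins′ clo′ con′
      where
      M = proj₁ (merge v (v ∷ [] , []) Bs)
      O = proj₂ (merge v (v ∷ [] , []) Bs)
      old : ∀ {x} → x ∈ concat (addBlock v Bs) → x ≡ v ⊎ x ∈ concat Bs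
      old x∈ with ∈-resp-↭ (addBlock-↭ v Bs) x∈
      ... | here eq   = inj₁ eq
      ... | there x∈′ = inj₂ x∈′
      v∈M : v ∈ M
      v∈M = merged⁺ v Bs (inj₁ (here refl))
      ins′ : ∀ {x} → x ∈ concat (addBlock v Bs) → x Subset.∈ W
      ins′ x∈ with old x∈
      ... | inj₁ refl = v∈W
      ... | inj₂ x∈′  = ins x∈′
      clo′ : ∀ {B x y} → B ∈ addBlock v Bs → x ∈ B → y ∈ concat (addBlock v Bs) → adj G x y ≡ true → y ∈ B
      clo′ {x = x} {y} (here refl) x∈ y∈ xy with merged⁻ v Bs x∈ | old y∈
      ... | _                         | inj₁ refl = v∈M
      ... | inj₁ (here refl)          | inj₂ y∈′ with ∈-concat⁻′ Bs y∈′
      ...   | C , y∈C , C∈ = merged⁺ v Bs (inj₂ (C , C∈ , any⁺ (adj G v) y∈C xy , y∈C))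
      clo′ {x = x} {y} (here refl) x∈ y∈ xy | inj₂ (B , B∈ , t , x∈B) | inj₂ y∈′ =
        merged⁺ v Bs (inj₂ (B , B∈ , t , clo B∈ x∈B y∈′ xy))
      clo′ {x = x} (there B∈) x∈ y∈ xy with others⁻ v Bs B∈ | old y∈
      ... | inj₂ (B∈′ , ¬t) | inj₁ refl = ⊥-elim (¬t (any⁺ (adj G v) x∈ (trans (adj-sym G v x) xy)))
      ... | inj₂ (B∈′ , ¬t) | inj₂ y∈′  = clo B∈′ x∈ y∈′ xy
      fromV : ∀ {x} → x ∈ M → v ~ x
      fromV x∈ with merged⁻ v Bs x∈
      ... | inj₁ (here refl) = ε
      ... | inj₂ (B , B∈ , t , x∈B) with any⁻ (adj G v) B t
      ...   | w , w∈B , vw = (v∈W , ins (∈-concat⁺′ w∈B B∈) , vw) ◅ con B∈ w∈B x∈B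
      con′ : ∀ {B x y} → B ∈ addBlock v Bs → x ∈ B → y ∈ B → x ~ y
      con′ (here refl) x∈ y∈ = ~-sym (fromV x∈) ◅◅ fromV y∈
      con′ (there B∈) x∈ y∈ with others⁻ v Bs B∈
      ... | inj₂ (B∈′ , _) = con B∈′ x∈ y∈

  -- The predicate h is left general because the splitting serves twice: with high degree it gives
  -- the separator of the algorithm, and with membership in S it lists the components of G - S in
  -- the analysis.
  record Splits (h : V → Bool) (W : Subset n) (vs U : List V) (Bs : List (List V)) : Set where
    constructor splits
    field
      cover : U ++ concat Bs ↭ vs
      highs : ∀ {u} → u ∈ U → h u ≡ true
      good  : Good W Bs

  module _ (h : V → Bool) (W : Subset n) (W≡ : ∀ x → lookup W x ≡ not (h x)) where

    low⇒∈W : ∀ {x} → h x ≡ false → x Subset.∈ W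
    low⇒∈W {x} hx = Vec.lookup⇒[]= x W (trans (W≡ x) (cong not hx))

    splitStep-splits : ∀ {ws U Bs} v → Splits h W ws U Bs →
      Splits h W (v ∷ ws) (proj₁ (splitStep h (U , Bs) v)) (proj₂ (splitStep h (U , Bs) v))
    splitStep-splits {ws} {U} {Bs} v (splits co hi go) with h v in hv
    ... | true  = splits (prep v co) (λ { (here refl) → hv ; (there u∈) → hi u∈ }) go
    ... | false = splits
      (↭-trans (++⁺ˡ U (addBlock-↭ v Bs)) (↭-trans (shift v U (concat Bs)) (prep v co))) hi
      (addBlock-good W (low⇒∈W hv) go)

    split-splits : Splits h W (allFin n) (proj₁ (split h)) (proj₂ (split h))
    split-splits =
      splits (↭-trans (Splits.cover s) (Perm.↭-reverse (allFin n))) (Splits.highs s) (Splits.good s)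
      where
      go : ∀ vs {ws} UBs → Splits h W ws (proj₁ UBs) (proj₂ UBs) →
        Splits h W (vs ʳ++ ws) (proj₁ (foldl (splitStep h) UBs vs)) (proj₂ (foldl (splitStep h) UBs vs))
      go []       UBs s = s
      go (v ∷ vs) UBs s = go vs (splitStep h UBs v) (splitStep-splits v s)
      s : Splits h W (reverse (allFin n)) (proj₁ (split h)) (proj₂ (split h))
      s = go (allFin n) ([] , []) (splits _↭_.refl (λ ()) (mkGood (λ ()) (λ ()) (λ ())))

  unique-concat : ∀ {h W U Bs} → Splits h W (allFin n) U Bs → Unique (concat Bs)
  unique-concat {U = U} s = unique-++⁻ʳ U (unique-↭ (↭-sym (Splits.cover s)) (allFin⁺ n))

  unique-block : ∀ Bs {B : List V} → Unique (concat Bs) → B ∈ Bs → Unique B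
  unique-block (B ∷ Bs) u (here refl) = unique-++⁻ˡ B u
  unique-block (B ∷ Bs) u (there B∈)  = unique-block Bs (unique-++⁻ʳ B u) B∈

  -- By closedness, an edge between two blocks would put one of its ends into both, against the
  -- absence of duplicates.
  splits⇒layout : ∀ {h W U Bs} → Splits h W (allFin n) U Bs → Layout [] U Bs
  splits⇒layout {U = U} {Bs} s = layout (Splits.cover s) (λ ())
    (apart Bs (unique-concat s) (λ B∈ x∈ C∈ y∈ xy → Good.closed (Splits.good s) B∈ x∈ (∈-concat⁺′ y∈ C∈) xy))
    where
    apart : ∀ Cs → Unique (concat Cs) →
      (∀ {B C x y} → B ∈ Cs → x ∈ B → C ∈ Cs → y ∈ C → adj G x y ≡ true → y ∈ B) →
      AllPairs (λ B C → ∀ {x} → x ∈ B → NonAdjacent x C) Cs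
    apart []       u clo = []
    apart (B ∷ Cs) u clo =
      All.tabulate (λ {C} C∈ {x} x∈ {y} y∈ → Bool.¬-not λ xy →
        unique-++⁻-disjoint B u (clo (here refl) x∈ (there C∈) y∈ xy) (∈-concat⁺′ y∈ C∈)) ∷
      apart Cs (unique-++⁻ʳ B u) (λ B∈ x∈ C∈ → clo (there B∈) x∈ (there C∈))

if-dec : ∀ {P A : Set} (Q : A → Set) (d : Dec P) {a b} →
  (P → Q a) → (¬ P → Q b) → Q (if does d then a else b)
if-dec Q (yes p) f g = f p
if-dec Q (no ¬p) f g = g ¬p

-- The degree threshold and its relation to vertex integrity

module Measure {n : ℕ} (G : Graph n) where

  open DP G
  open Correct G
  open Decomposition G
  open Blocks G

  fullDegree : V → ℕ
  fullDegree v = count (adj G v) (allFin n)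

  isHigh : ℕ → V → Bool
  isHigh K v = does (K <? fullDegree v)

  longestStep : ℕ → List V → ℕ
  longestStep m B = if does (length B ≤? m) then m else length B

  longest : List (List V) → ℕ
  longest = foldl longestStep 0

  Candidate : Set
  Candidate = ℕ × List V × List (List V)

  -- One number controls everything later: it bounds K plus the size of the separator, which governs
  -- the modulus, and separator plus largest block, which is the largest bag.
  candidate : ℕ → Candidate
  candidate K =
    K + (length (proj₁ (split (isHigh K))) + longest (proj₂ (split (isHigh K)))) , split (isHigh K)

  better : Candidate → ℕ → Candidate
  better c K = if does (proj₁ c ≤? proj₁ (candidate K)) then c else candidate K

  best : Candidate
  best = countdown better (candidate n) n

  longestStep-≤ : ∀ m B → m ≤ longestStep m B × length B ≤ longestStep m B
  longestStep-≤ m B = if-dec (λ z → m ≤ z × length B ≤ z) (length B ≤? m)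
    (≤-refl ,_) (λ ¬p → <⇒≤ (≰⇒> ¬p) , ≤-refl)

  longest-upper : ∀ Bs m → m ≤ foldl longestStep m Bs × (∀ {B} → B ∈ Bs → length B ≤ foldl longestStep m Bs)
  longest-upper []       m = ≤-refl , λ ()
  longest-upper (B ∷ Bs) m with longest-upper Bs (longestStep m B) | longestStep-≤ m B
  ... | up , all | m≤ , B≤ = ≤-trans m≤ up , λ { (here refl) → ≤-trans B≤ up ; (there B∈) → all B∈ }

  longest-lub : ∀ Bs {m b} → m ≤ b → (∀ {B} → B ∈ Bs → length B ≤ b) → foldl longestStep m Bs ≤ b
  longest-lub []       m≤ h = m≤
  longest-lub (B ∷ Bs) {m} {b} m≤ h = longest-lub Bs
    (if-dec (_≤ b) (length B ≤? m) (λ _ → m≤) (λ _ → h (here refl))) (h ∘ there)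

  better-≤ : ∀ c K → proj₁ (better c K) ≤ proj₁ c × proj₁ (better c K) ≤ proj₁ (candidate K)
  better-≤ c K = if-dec (λ z → proj₁ z ≤ proj₁ c × proj₁ z ≤ proj₁ (candidate K))
    (proj₁ c ≤? proj₁ (candidate K)) (≤-refl ,_) (λ ¬p → <⇒≤ (≰⇒> ¬p) , ≤-refl)

  countdown-better-≤ : ∀ j c → proj₁ (countdown better c j) ≤ proj₁ c ×
    (∀ {K} → K < j → proj₁ (countdown better c j) ≤ proj₁ (candidate K))
  countdown-better-≤ zero    c = ≤-refl , λ ()
  countdown-better-≤ (suc j) c with countdown-better-≤ j (better c j) | better-≤ c j
  ... | up , all | c≤ , j≤ = ≤-trans up c≤ , λ { (s≤s K≤j) → below (m≤n⇒m<n∨m≡n K≤j) }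
    where
    below : ∀ {K} → K < j ⊎ K ≡ j → proj₁ (countdown better (better c j) j) ≤ proj₁ (candidate K)
    below (inj₁ K<j)  = all K<j
    below (inj₂ refl) = ≤-trans up j≤

  best-≤ : ∀ {K} → K ≤ n → proj₁ best ≤ proj₁ (candidate K)
  best-≤ {K} K≤n with m≤n⇒m<n∨m≡n K≤n
  ... | inj₁ K<n  = proj₂ (countdown-better-≤ n (candidate n)) K<n
  ... | inj₂ refl = proj₁ (countdown-better-≤ n (candidate n))

  best-candidate : ∃[ K ] (K ≤ n × best ≡ candidate K)
  best-candidate = countdown-invariant {I = λ c → ∃[ K ] (K ≤ n × c ≡ candidate K)} n kept-form
    (n , ≤-refl , refl)
    where
    kept-form : ∀ {c} j → j < n → ∃[ K ] (K ≤ n × c ≡ candidate K) → ∃[ K ] (K ≤ n × better c j ≡ candidate K)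
    kept-form {c} j j<n (K , K≤n , c≡) = if-dec (λ z → ∃[ K ] (K ≤ n × z ≡ candidate K))
      (proj₁ c ≤? proj₁ (candidate j)) (λ _ → K , K≤n , c≡) (λ _ → j , <⇒≤ j<n , refl)

  lowSet : ℕ → Subset n
  lowSet K = Vec.tabulate (not ∘ isHigh K)

  low⇒degree-≤ : ∀ {K u} → u Subset.∈ lowSet K → fullDegree u ≤ K
  low⇒degree-≤ {K} {u} u∈ = ≮⇒≥ λ K<d → Bool.not-¬ (cong not (dec-true (K <? fullDegree u) K<d))
    (trans (sym (Vec.lookup∘tabulate (not ∘ isHigh K) u)) (Vec.[]=⇒lookup u∈))

  candidate-splits : ∀ K →
    Splits (isHigh K) (lowSet K) (allFin n) (proj₁ (split (isHigh K))) (proj₂ (split (isHigh K)))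
  candidate-splits K = split-splits (isHigh K) (lowSet K) (λ x → Vec.lookup∘tabulate _ x)

  -- The bound on the measure in terms of the vertex integrity

  listSet : List V → Subset n
  listSet B = Vec.tabulate (λ u → any (λ x → does (u Fin.≟ x)) B)

  ∈-listSet⁺ : ∀ {B x} → x ∈ B → x Subset.∈ listSet B
  ∈-listSet⁺ {B} {x} x∈ = Vec.lookup⇒[]= x _ (trans (Vec.lookup∘tabulate _ x)
    (any⁺ (λ y → does (x Fin.≟ y)) x∈ (dec-true (x Fin.≟ x) refl)))

  ∈-listSet⁻ : ∀ {B x} → x Subset.∈ listSet B → x ∈ B
  ∈-listSet⁻ {B} {x} x∈ with any⁻ (λ y → does (x Fin.≟ y)) B
    (trans (sym (Vec.lookup∘tabulate _ x)) (Vec.[]=⇒lookup x∈))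
  ... | y , y∈ , eq with x Fin.≟ y | eq
  ...   | yes refl | _ = y∈

  ∈-elements : ∀ {p x} → x Subset.∈ p → x ∈ elements p
  ∈-elements {p} {x} x∈ = ∈-select⁺ (lookup p) (∈-allFin x) (Vec.[]=⇒lookup x∈)

  length-≤-size : ∀ {B p} → Unique B → (∀ {x} → x ∈ B → x Subset.∈ p) → length B ≤ ∣ p ∣
  length-≤-size {B} {p} u sub = subst (length B ≤_) (length-elements p)
    (unique-⊆⇒length-≤ u (∈-elements ∘ sub))

  module Bound {k : ℕ} (S : Subset n) (S≤k : ∣ S ∣ ≤ k)
               (small : ∀ C → IsComponent G (∁ S) C → ∣ C ∣ ≤ k ∸ ∣ S ∣) where

    private
      parts : List V × List (List V)
      parts = split (lookup S)
      Cs : List (List V)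
      Cs = proj₂ parts
      sp : Splits (lookup S) (∁ S) (allFin n) (proj₁ parts) Cs
      sp = split-splits (lookup S) (∁ S) (λ x → Vec.lookup-map x not S)
      open Good (Splits.good sp)

    outside-covered : ∀ {x} → x Subset.∉ S → x ∈ concat Cs
    outside-covered {x} x∉ with ∈-++⁻ (proj₁ parts) (∈-resp-↭ (↭-sym (Splits.cover sp)) (∈-allFin x))
    ... | inj₂ x∈ = x∈
    ... | inj₁ x∈ = ⊥-elim (x∉ (Vec.lookup⇒[]= x S (Splits.highs sp x∈)))

    ~-closed : ∀ {C x y} → C ∈ Cs → x ∈ C → Star (Edge G (∁ S)) x y → y ∈ C
    ~-closed C∈ x∈ ε                       = x∈
    ~-closed C∈ x∈ ((_ , y∈W , xy) ◅ path) =
      ~-closed C∈ (closed C∈ x∈ (outside-covered (Subset.x∈∁p⇒x∉p y∈W)) xy) path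

    -- Connectedness and closedness make the vertices of the block a component in the sense of
    -- `IsComponent`, to which the integrity bound applies.
    block-≤ : ∀ {C} → C ∈ Cs → length C ≤ k ∸ ∣ S ∣
    block-≤ {[]}    _  = z≤n
    block-≤ {x ∷ C} C∈ = ≤-trans
      (length-≤-size (unique-block Cs (unique-concat sp) C∈) ∈-listSet⁺)
      (small (listSet (x ∷ C)) (x , inside (∈-concat⁺′ (here refl) C∈) , λ u →
        mk⇔ (λ u∈ → connected C∈ (here refl) (∈-listSet⁻ u∈))
          (λ path → ∈-listSet⁺ (~-closed C∈ (here refl) path))))

    blockOf : List (List V) → V → List V
    blockOf []       v = []
    blockOf (B ∷ Bs) v = if any (λ x → does (v Fin.≟ x)) B then B else blockOf Bs v

    component : V → List V
    component = blockOf Cs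

    component-≤ : ∀ v → length (component v) ≤ k ∸ ∣ S ∣
    component-≤ v = go Cs block-≤
      where
      go : ∀ Bs → (∀ {C} → C ∈ Bs → length C ≤ k ∸ ∣ S ∣) → length (blockOf Bs v) ≤ k ∸ ∣ S ∣
      go []       h = z≤n
      go (B ∷ Bs) h with any (λ x → does (v Fin.≟ x)) B
      ... | true  = h (here refl)
      ... | false = go Bs (h ∘ there)

    component-∈ : ∀ {v} → v Subset.∉ S → v ∈ component v × component v ∈ Cs
    component-∈ {v} v∉ = go Cs (outside-covered v∉)
      where
      go : ∀ Bs → v ∈ concat Bs → v ∈ blockOf Bs v × blockOf Bs v ∈ Bs
      go (B ∷ Bs) v∈ with any (λ x → does (v Fin.≟ x)) B in eq
      ... | true with any⁻ (λ x → does (v Fin.≟ x)) B eq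
      ...   | x , x∈ , e with v Fin.≟ x | e
      ...     | yes refl | _ = x∈ , here refl
      go (B ∷ Bs) v∈ | false with ∈-++⁻ B v∈
      ... | inj₂ v∈′ = let (a , b) = go Bs v∈′ in a , there b
      ... | inj₁ v∈B with trans (sym eq) (any⁺ (λ x → does (v Fin.≟ x)) v∈B (dec-true (v Fin.≟ v) refl))
      ...   | ()

    reaches⇒component : ∀ {v w} → v Subset.∉ S → Star (Edge G (∁ S)) v w → w ∈ component v
    reaches⇒component v∉ path = let (v∈ , C∈) = component-∈ v∉ in ~-closed C∈ v∈ path

    neighbourList : V → List V
    neighbourList v = select (adj G v) (allFin n)

    ∈-neighbourList : ∀ {v u} → adj G v u ≡ true → u ∈ neighbourList v
    ∈-neighbourList {v} {u} vu = ∈-select⁺ (adj G v) (∈-allFin u) vu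

    k∸S+S≤k : (k ∸ ∣ S ∣) + ∣ S ∣ ≤ k
    k∸S+S≤k = ≤-reflexive (m∸n+n≡m S≤k)

    -- Each neighbour of v lies in S or in the component of v in G - S, and these sizes add up to at
    -- most k.
    outside⇒degree-≤ : ∀ {v} → v Subset.∉ S → fullDegree v ≤ k
    outside⇒degree-≤ {v} v∉ = begin
      fullDegree v                                 ≡⟨ length-select (adj G v) (allFin n) ⟨
      length (neighbourList v)                     ≤⟨ unique-⊆⇒length-≤ (Unique.filter⁺ _ (allFin⁺ n)) sub ⟩
      length (component v ++ elements S)           ≡⟨ length-++ (component v) ⟩
      length (component v) + length (elements S)   ≤⟨ +-mono-≤ (component-≤ v)
        (≤-reflexive (length-elements S)) ⟩
      (k ∸ ∣ S ∣) + ∣ S ∣                          ≤⟨ k∸S+S≤k ⟩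
      k                                            ∎
      where
      open ≤-Reasoning
      sub : ∀ {u} → u ∈ neighbourList v → u ∈ component v ++ elements S
      sub {u} u∈ with u Subset.∈? S
      ... | yes u∈S = ∈-++⁺ʳ (component v) (∈-elements u∈S)
      ... | no u∉S  = ∈-++⁺ˡ (reaches⇒component v∉ ((Subset.x∉p⇒x∈∁p v∉ , Subset.x∉p⇒x∈∁p u∉S ,
        proj₂ (∈-filter⁻ (λ x → adj G v x Bool.≟ true) {xs = allFin n} u∈)) ◅ ε))

    private
      U : List V
      U = proj₁ (split (isHigh k))
      Bs : List (List V)
      Bs = proj₂ (split (isHigh k))

    -- Vertices outside S have degree at most k, so all vertices above the threshold k lie in S.
    high-≤ : length U ≤ k
    high-≤ = ≤-trans (length-≤-size uU U⊆S) S≤k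
      where
      uU : Unique U
      uU = unique-++⁻ˡ U (unique-↭ (↭-sym (Splits.cover (candidate-splits k))) (allFin⁺ n))
      U⊆S : ∀ {u} → u ∈ U → u Subset.∈ S
      U⊆S {u} u∈ with u Subset.∈? S
      ... | yes u∈S = u∈S
      ... | no u∉S with trans (sym (Splits.highs (candidate-splits k) u∈))
        (dec-false (k <? fullDegree u) (≤⇒≯ (outside⇒degree-≤ u∉S)))
      ...   | ()

    -- The walk is followed up to its first vertex in S.
    first-hit : ∀ {w z} → w Subset.∉ S → Star (Edge G (lowSet k)) w z →
      Star (Edge G (∁ S)) z w ⊎
      (∃[ v ] ∃[ u ] (v Subset.∉ S × u Subset.∈ S × u Subset.∈ lowSet k × adj G u v ≡ true ×
        Star (Edge G (∁ S)) v w))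
    first-hit w∉ ε = inj₁ ε
    first-hit {w} w∉ (_◅_ {j = w′} (w∈W , w′∈W , ww′) path) with w′ Subset.∈? S
    ... | yes w′∈S = inj₂ (w , w′ , w∉ , w′∈S , w′∈W , trans (adj-sym G w′ w) ww′ , ε)
    ... | no w′∉S = Sum.map (_◅◅ back) (λ (v , u , v∉ , u∈ , u∈W , uv , p) →
      v , u , v∉ , u∈ , u∈W , uv , p ◅◅ back)
      (first-hit w′∉S path)
      where
      back : Star (Edge G (∁ S)) w′ w
      back = (Subset.x∉p⇒x∈∁p w′∉S , Subset.x∉p⇒x∈∁p w∉ , trans (adj-sym G w′ w) ww′) ◅ ε

    nearby : V → List V
    nearby u = concatMap component (neighbourList u)

    separatorLow : List V
    separatorLow = filter (Subset._∈? lowSet k) (elements S)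

    -- A vertex of the block lies in S, in the component of b, or, by `first-hit`, in the component
    -- of a neighbour of a low vertex of S. The first two account for k vertices; the last for k³,
    -- from at most k low vertices of S with at most k neighbours each and components of size at
    -- most k.
    low-block-≤ : ∀ {B} → B ∈ Bs → length B ≤ k + k * (k * k)
    low-block-≤ {[]}    _  = z≤n
    low-block-≤ {b ∷ B} B∈ = begin
      length (b ∷ B)                                                     ≤⟨ unique-⊆⇒length-≤ uB sub ⟩
      length (component b ++ elements S ++ concatMap nearby separatorLow)
        ≡⟨ trans (length-++ (component b)) (cong (length (component b) +_) (length-++ (elements S))) ⟩
      length (component b) + (length (elements S) + length (concatMap nearby separatorLow))
        ≤⟨ +-mono-≤ (component-≤ b) (+-mono-≤ (≤-reflexive (length-elements S)) near-≤) ⟩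
      (k ∸ ∣ S ∣) + (∣ S ∣ + k * (k * k))                                ≡⟨ +-assoc (k ∸ ∣ S ∣) _ _ ⟨
      (k ∸ ∣ S ∣) + ∣ S ∣ + k * (k * k)                                  ≤⟨ +-monoˡ-≤ _ k∸S+S≤k ⟩
      k + k * (k * k)                                                    ∎
      where
      open ≤-Reasoning
      sk = candidate-splits k
      uB : Unique (b ∷ B)
      uB = unique-block Bs (unique-concat sk) B∈
      near-≤ : length (concatMap nearby separatorLow) ≤ k * (k * k)
      near-≤ = ≤-trans
        (length-concatMap-≤ nearby separatorLow λ {u} u∈ → ≤-trans
          (length-concatMap-≤ component (neighbourList u) (λ {v} _ → ≤-trans (component-≤ v) (m∸n≤m k ∣ S ∣)))
          (*-monoˡ-≤ k (≤-trans (≤-reflexive (length-select (adj G u) (allFin n)))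
            (low⇒degree-≤ (proj₂ (∈-filter⁻ (Subset._∈? lowSet k) {xs = elements S} u∈))))))
        (*-monoˡ-≤ (k * k) (≤-trans (List.length-filter (Subset._∈? lowSet k) (elements S))
          (≤-trans (≤-reflexive (length-elements S)) S≤k)))
      sub : ∀ {w} → w ∈ b ∷ B → w ∈ component b ++ elements S ++ concatMap nearby separatorLow
      sub {w} w∈ with w Subset.∈? S
      ... | yes w∈S = ∈-++⁺ʳ (component b) (∈-++⁺ˡ (∈-elements w∈S))
      ... | no w∉S with first-hit w∉S (Good.connected (Splits.good sk) B∈ w∈ (here refl))
      ...   | inj₂ (v , u , v∉ , u∈ , u∈W , uv , path) = ∈-++⁺ʳ (component b) (∈-++⁺ʳ (elements S)
        (∈-concatMap⁺ nearby (Any.map (λ { refl →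
            ∈-concatMap⁺ component (Any.map (λ { refl → reaches⇒component v∉ path }) (∈-neighbourList uv)) })
          (∈-filter⁺ (Subset._∈? lowSet k) (∈-elements u∈) u∈W))))
      ...   | inj₁ path with b Subset.∈? S
      ...     | no b∉S  = ∈-++⁺ˡ (reaches⇒component b∉S path)
      ...     | yes b∈S = ⊥-elim (stuck path)
        where
        stuck : ¬ Star (Edge G (∁ S)) b w
        stuck ε                  = w∉S b∈S
        stuck ((b∈∁ , _ , _) ◅ _) = Subset.x∈∁p⇒x∉p b∈∁ b∈S

    candidate-≤ : proj₁ (candidate k) ≤ k + (k + (k + k * (k * k)))
    candidate-≤ = +-monoʳ-≤ k (+-mono-≤ high-≤ (longest-lub Bs z≤n low-block-≤))

  integrity⇒best-≤ : ∀ {k} → HasVertexIntegrity G k → proj₁ best ≤ k + (k + (k + k * (k * k)))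
  integrity⇒best-≤ {k} ((S , S≤k , small) , least) = ≤-trans (best-≤ k≤n) (Bound.candidate-≤ S S≤k small)
    where
    -- Removing the empty set shows that the integrity is at most n, so the threshold k is among
    -- those tried.
    k≤n : k ≤ n
    k≤n = least n (Subset.⊥ , ≤-trans (≤-reflexive (Subset.∣⊥∣≡0 n)) z≤n ,
      λ C _ → subst (λ z → ∣ C ∣ ≤ n ∸ z) (sym (Subset.∣⊥∣≡0 n)) (Subset.∣p∣≤n C))

-- The algorithm and its correctness

n<2^n : ∀ j → j < 2 ^ j
n<2^n zero    = s≤s z≤n
n<2^n (suc j) = ≤-trans (+-mono-≤ (m^n>0 2 j) (n<2^n j)) (≤-reflexive (cong (2 ^ j +_) (sym (+-identityʳ _))))

countdown-+ : ∀ L a j → countdown (λ a _ → L + a) a j ≡ j * L + a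
countdown-+ L a zero    = refl
countdown-+ L a (suc j) = trans (countdown-+ L (L + a) j)
  (trans (sym (+-assoc (j * L) L a)) (cong (_+ a) (+-comm (j * L) L)))

module Algorithm {n : ℕ} (G : Graph n) where

  open DP G
  open Correct G
  open Decomposition G
  open Blocks G
  open Measure G

  -- The pair (L , 2 ^ L).
  logStep : ℕ × ℕ → ℕ × ℕ
  logStep (L , q) = if does (q ≤? n) then (suc L , q + q) else (L , q)

  logPair : ℕ × ℕ
  logPair = countdown (λ a _ → logStep a) (0 , 1) n

  -- The number (M + 1) ² L + 2 of moduli suffices for at most M + 1 degrees
  -- below 2 ^ L.
  moduli : (M L : ℕ) → ℕ
  moduli M L = countdown (λ a _ → countdown (λ a _ → L + a) a (suc M)) 2 (suc M)

  start : ℕ → State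
  start p′ = p′ , 0 , []

  addStart : List State → ℕ → List State
  addStart acc p′ = start p′ ∷ acc

  initial : ℕ → List State
  initial = countdown addStart []

  lesserCost : ℕ → State → ℕ
  lesserCost m s = if does (proj₁ (proj₂ s) ≤? m) then proj₁ (proj₂ s) else m

  M L P : ℕ
  M = proj₁ best
  L = proj₁ logPair
  P = moduli M L

  answer : ℕ
  answer = foldl lesserCost n (solve (proj₁ (proj₂ best)) (proj₂ (proj₂ best)) (initial P))

  -- Either doubling has passed n, or every step so far has increased the exponent; after n steps
  -- the second case also suffices, as n < 2 ^ n. The upper bound `small` is needed for the running
  -- time.
  record LogInv (i : ℕ) (a : ℕ × ℕ) : Set where
    constructor logInv
    field
      power : proj₂ a ≡ 2 ^ proj₁ a
      large : n < proj₂ a ⊎ i ≤ proj₁ a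
      small : proj₂ a ≤ 2 * (1 ⊔ n)
  open LogInv

  logStep-inv : ∀ {i a} → LogInv i a → LogInv (suc i) (logStep a)
  logStep-inv {i} {l , q} (logInv pw lg sm) = if-dec (LogInv (suc i)) (q ≤? n)
    (λ q≤n → logInv
      (trans (cong₂ _+_ pw (trans pw (sym (+-identityʳ _)))) refl)
      (inj₂ (Sum.[ (λ n<q → ⊥-elim (<⇒≱ n<q q≤n)) , s≤s ] lg))
      (≤-trans (≤-reflexive (cong (q +_) (sym (+-identityʳ q)))) (*-monoʳ-≤ 2 (≤-trans q≤n (m≤n⊔m 1 n)))))
    (λ q≰n → logInv pw (inj₁ (≰⇒> q≰n)) sm)

  logLoop-inv : ∀ j {i a} → LogInv i a → LogInv (j + i) (countdown (λ a _ → logStep a) a j)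
  logLoop-inv zero    inv = inv
  logLoop-inv (suc j) {i} {a} inv =
    subst (λ z → LogInv z (countdown (λ a _ → logStep a) (logStep a) j)) (+-suc j i)
      (logLoop-inv j (logStep-inv inv))

  logPair-inv : LogInv (n + 0) logPair
  logPair-inv = logLoop-inv n {0} {0 , 1} (logInv refl (inj₂ z≤n) (≤-trans (m≤m⊔n 1 n) (m≤m+n _ _)))

  n<2^L : n < 2 ^ L
  n<2^L = go logPair-inv
    where
    go : ∀ {a} → LogInv (n + 0) a → n < 2 ^ proj₁ a
    go (logInv refl (inj₁ n<q) _) = n<q
    go (logInv refl (inj₂ n≤L) _) =
      <-≤-trans (n<2^n n) (^-monoʳ-≤ 2 (≤-trans (≤-reflexive (sym (+-identityʳ n))) n≤L))

  2^L≤ : 2 ^ L ≤ 2 * (1 ⊔ n)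
  2^L≤ = subst (_≤ 2 * (1 ⊔ n)) (power logPair-inv) (small logPair-inv)

  moduli≡ : ∀ M L → moduli M L ≡ suc M * (suc M * L) + 2
  moduli≡ M L = go (suc M) 2
    where
    inner = λ a → countdown (λ a _ → L + a) a (suc M)
    go : ∀ j a → countdown (λ a _ → inner a) a j ≡ j * (suc M * L) + a
    go zero    a = refl
    go (suc j) a = trans (go j (inner a)) (trans (cong (j * (suc M * L) +_) (countdown-+ L a (suc M)))
      (trans (sym (+-assoc (j * (suc M * L)) (suc M * L) a))
        (cong (_+ a) (+-comm (j * (suc M * L)) (suc M * L)))))

  initial⁻ : ∀ j {acc s} → s ∈ countdown addStart acc j →
    s ∈ acc ⊎ (∃[ p′ ] (p′ < j × s ≡ start p′))
  initial⁻ zero    s∈ = inj₁ s∈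
  initial⁻ (suc j) s∈ with initial⁻ j s∈
  ... | inj₁ (here refl)      = inj₂ (j , ≤-refl , refl)
  ... | inj₁ (there s∈′)      = inj₁ s∈′
  ... | inj₂ (p′ , p<j , eq)  = inj₂ (p′ , m<n⇒m<1+n p<j , eq)

  initial⁺ : ∀ j {acc p′} → p′ < j ⊎ start p′ ∈ acc →
    start p′ ∈ countdown addStart acc j
  initial⁺ zero    (inj₂ p∈) = p∈
  initial⁺ (suc j) (inj₂ p∈) = initial⁺ j (inj₂ (there p∈))
  initial⁺ (suc j) (inj₁ (s≤s p≤j)) with m≤n⇒m<n∨m≡n p≤j
  ... | inj₁ p<j  = initial⁺ j (inj₁ p<j)
  ... | inj₂ refl = initial⁺ j (inj₂ (here refl))

  initial-fits : ∀ {P s} → s ∈ initial P → Fits P 0 [] s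
  initial-fits {P} s∈ with initial⁻ P s∈
  ... | inj₂ (p′ , p<P , refl) = fits p<P z≤n []

  initial-sound : ∀ P → Sound [] [] (initial P)
  initial-sound P s∈ with initial⁻ P s∈
  ... | inj₂ (p′ , _ , refl) = (λ _ → nothing) , refl , realises (λ ()) (λ ())

  best-layout : Layout [] (proj₁ (proj₂ best)) (proj₂ (proj₂ best))
  best-layout = go best-candidate
    where
    go : ∀ {c} → ∃[ K ] (K ≤ n × c ≡ candidate K) → Layout [] (proj₁ (proj₂ c)) (proj₂ (proj₂ c))
    go (K , _ , refl) = splits⇒layout (candidate-splits K)

  lesserCost-≤ : ∀ m s → lesserCost m s ≤ m × lesserCost m s ≤ proj₁ (proj₂ s)
  lesserCost-≤ m s = if-dec (λ z → z ≤ m × z ≤ proj₁ (proj₂ s)) (proj₁ (proj₂ s) ≤? m)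
    (_, ≤-refl) (λ ¬p → ≤-refl , <⇒≤ (≰⇒> ¬p))

  least-≤ : ∀ sts m → foldl lesserCost m sts ≤ m ×
    (∀ {s} → s ∈ sts → foldl lesserCost m sts ≤ proj₁ (proj₂ s))
  least-≤ []        m = ≤-refl , λ ()
  least-≤ (s ∷ sts) m with least-≤ sts (lesserCost m s) | lesserCost-≤ m s
  ... | low , all | ≤m , ≤s = ≤-trans low ≤m , λ { (here refl) → ≤-trans low ≤s ; (there s∈) → all s∈ }

  least-∈ : ∀ sts {m} → foldl lesserCost m sts ≡ m ⊎
    (∃[ s ] (s ∈ sts × foldl lesserCost m sts ≡ proj₁ (proj₂ s)))
  least-∈ []        = inj₁ refl
  least-∈ (s ∷ sts) {m} with least-∈ sts {lesserCost m s}
  ... | inj₂ (z , z∈ , eq) = inj₂ (z , there z∈ , eq)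
  ... | inj₁ eq = if-dec (λ z → foldl lesserCost (lesserCost m s) sts ≡ z →
      foldl lesserCost (lesserCost m s) sts ≡ m ⊎
        (∃[ z ] (z ∈ s ∷ sts × foldl lesserCost (lesserCost m s) sts ≡ proj₁ (proj₂ z))))
    (proj₁ (proj₂ s) ≤? m) (λ _ eq → inj₂ (s , here refl , eq)) (λ _ → inj₁) eq

  degree-≤ : ∀ W x → degree G W x ≤ fullDegree x
  degree-≤ W x = ≤-trans (Subset.∣p∩q∣≤∣p∣ (neighbours G x) W)
    (≤-reflexive (trans (sym (count-allFin (neighbours G x)))
      (count-cong (allFin n) (λ {u} _ → Vec.lookup∘tabulate (adj G x) u))))

  Distinguishes : ℕ → Subset n → Set
  Distinguishes p′ S =
    ∀ x y → ν p′ (degree G (∁ S) x) ≡ ν p′ (degree G (∁ S) y) → degree G (∁ S) x ≡ degree G (∁ S) y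

  -- Vertices outside the separator have degree at most K, so there are few
  -- degrees to tell apart.
  modulus-exists : ∀ {K L} → K ≤ n → n < 2 ^ L → ∀ S →
    ∃[ p′ ] (p′ < moduli (proj₁ (candidate K)) L × Distinguishes p′ S)
  modulus-exists {K} {L} K≤n n<2^L S = go (distinguishing-modulus L D D<)
    where
    U = proj₁ (split (isHigh K))
    μ = proj₁ (candidate K)
    D = upTo (suc K) ++ map (degree G (∁ S)) U
    D< : ∀ {x} → x ∈ D → x < 2 ^ L
    D< x∈ with ∈-++⁻ (upTo (suc K)) x∈
    ... | inj₁ x∈′ = <-≤-trans (∈-upTo⁻ x∈′) (≤-trans (s≤s K≤n) n<2^L)
    ... | inj₂ x∈′ with ∈-map⁻ (degree G (∁ S)) x∈′
    ...   | u , _ , refl = ≤-<-trans (Subset.∣p∣≤n (neighbours G u ∩ ∁ S)) n<2^L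
    D≤ : length D ≤ suc μ
    D≤ = begin
      length D                                                ≡⟨ length-++ (upTo (suc K)) ⟩
      length (upTo (suc K)) + length (map (degree G (∁ S)) U)
        ≡⟨ cong₂ _+_ (length-upTo (suc K)) (length-map (degree G (∁ S)) U) ⟩
      suc (K + length U)                                      ≤⟨ s≤s (+-monoʳ-≤ K (m≤m+n (length U) _)) ⟩
      suc μ                                                   ∎
      where open ≤-Reasoning
    d∈D : ∀ x → degree G (∁ S) x ∈ D
    d∈D x with ∈-++⁻ U (∈-resp-↭ (↭-sym (Splits.cover (candidate-splits K))) (∈-allFin x))
    ... | inj₁ x∈U = ∈-++⁺ʳ (upTo (suc K)) (∈-map⁺ (degree G (∁ S)) x∈U)
    ... | inj₂ x∈B = ∈-++⁺ˡ (∈-upTo⁺ (s≤s (≤-trans (degree-≤ (∁ S) x)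
      (low⇒degree-≤ (Good.inside (Splits.good (candidate-splits K)) x∈B)))))
    go : ∃[ p′ ] (p′ ≤ suc (length D * length D * L) ×
                  (∀ {x y} → x ∈ D → y ∈ D → ν p′ x ≡ ν p′ y → x ≡ y)) →
         ∃[ p′ ] (p′ < moduli μ L × Distinguishes p′ S)
    go (p′ , p′≤ , sep) = p′ , p<P , λ x y → sep (d∈D x) (d∈D y)
      where
      open ≤-Reasoning
      p<P : p′ < moduli μ L
      -- `distinguishing-modulus` allows p′ up to 1 + |D|² L, and p′ must be strictly below the
      -- number of moduli: hence the summand 2 in `moduli`.
      p<P = begin-strict
        p′                              ≤⟨ p′≤ ⟩
        suc (length D * length D * L)   <⟨ ≤-refl ⟩
        2 + length D * length D * L     ≤⟨ +-monoʳ-≤ 2 (*-monoˡ-≤ L (*-mono-≤ D≤ D≤)) ⟩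
        2 + suc μ * suc μ * L           ≡⟨ cong (2 +_) (*-assoc (suc μ) (suc μ) L) ⟩
        2 + suc μ * (suc μ * L)         ≡⟨ +-comm 2 _ ⟩
        suc μ * (suc μ * L) + 2         ≡⟨ moduli≡ μ L ⟨
        moduli μ L                      ∎

  -- The modulus may depend on S because the states for all moduli below P are present from the
  -- start.
  least-correct : ∀ {U Bs P} → Layout [] U Bs → (∀ S → ∃[ p′ ] (p′ < P × Distinguishes p′ S)) →
    IsIᵥ G (foldl lesserCost n (solve U Bs (initial P)))
  least-correct {U} {Bs} {P} l modulus = attained (least-∈ final) , λ S irr →
      let (p′ , p<P , sep) = modulus S
          (s , s∈ , cost≡) = irregulator⇒solve l p′ (initial⁺ P (inj₁ p<P)) S irr sep
      in ≤-trans (proj₂ (least-≤ final n) s∈) (≤-reflexive cost≡)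
    where
    final = solve U Bs (initial P)
    attained : ∀ {m} → m ≡ n ⊎ (∃[ s ] (s ∈ final × m ≡ proj₁ (proj₂ s))) →
      ∃[ S ] (IsVertexIrregulator G S × ∣ S ∣ ≡ m)
    -- The initial value n of the minimum is attained by deleting all vertices.
    attained (inj₁ eq) = Subset.⊤ ,
      (λ u v u∈ → ⊥-elim (Subset.x∈∁p⇒x∉p u∈ Subset.∈⊤)) , trans (Subset.∣⊤∣≡n n) (sym eq)
    attained (inj₂ (s , s∈ , eq)) =
      let (S , irr , size) = solve⇒irregulator l (initial-sound P) s∈ in S , irr , trans size (sym eq)

  answer-correct : IsIᵥ G answer
  answer-correct = least-correct best-layout (go best-candidate)
    where
    go : ∀ {c} → ∃[ K ] (K ≤ n × c ≡ candidate K) → ∀ S →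
      ∃[ p′ ] (p′ < moduli (proj₁ c) L × Distinguishes p′ S)
    go (K , K≤n , refl) = modulus-exists K≤n n<2^L

-- The algorithm in the functional language

x0 : ∀ {m} → Exp (1 + m)
x0 = var zero
x1 : ∀ {m} → Exp (2 + m)
x1 = var (suc zero)
x2 : ∀ {m} → Exp (3 + m)
x2 = var (suc (suc zero))
x3 : ∀ {m} → Exp (4 + m)
x3 = var (suc (suc (suc zero)))
x4 : ∀ {m} → Exp (5 + m)
x4 = var (suc (suc (suc (suc zero))))
x5 : ∀ {m} → Exp (6 + m)
x5 = var (suc (suc (suc (suc (suc zero)))))
x6 : ∀ {m} → Exp (7 + m)
x6 = var (suc (suc (suc (suc (suc (suc zero))))))

yesE : ∀ {m} → Exp m
yesE = cons nil nil

-- Numerals are lists of nil, so a ≤ b is tested by dropping b elements from a and asking whether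
-- anything is left. With nil as second argument `addT` turns a list into its length.
dropT addT leqT revT : Tm 2
dropT = fold x0 x1 (ret (tl x1))
addT  = fold x0 x1 (ret (cons nil x1))
leqT  = bind (call dropT (x1 ∷ x0 ∷ [])) (ifte x0 (ret nil) (ret yesE))
revT  = fold x0 x1 (ret (cons (hd x0) x1))

adjT : Tm 3
adjT = bind (call dropT (x1 ∷ x0 ∷ [])) (bind (call dropT (x3 ∷ hd x0 ∷ [])) (ret (hd x0)))

anyT : ∀ {m} → Exp m → Tm (2 + m) → Tm m
anyT l b = fold l nil (ifte x1 (ret x1) b)

-- Folds cannot recurse into trees, so equality is unrolled to a fixed nesting depth. The
-- accumulator is nil after a mismatch and otherwise holds a flag with the unread rest of the second
-- list.
eqT : ℕ → Tm 2
eqT zero    = ret yesE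
eqT (suc k) = bind
  (fold x0 (cons yesE x1)
    (ifte (hd x1)
      (ifte (tl x1)
        (bind (call (eqT k) (hd x0 ∷ hd (tl x1) ∷ []))
          (ifte x0 (ret (cons yesE (tl (tl x2)))) (ret nil)))
        (ret nil))
      (ret nil)))
  (ifte (hd x0) (ifte (tl x0) (ret nil) (ret yesE)) (ret nil))

-- Depth 3 suffices for states: a state is a list of p′, c and its entries, an entry is empty or a
-- list of v, t and the units of r, and numerals have depth 1.
memberT insertT : Tm 2
memberT = anyT x1 (call (eqT 3) (x2 ∷ hd x0 ∷ []))
insertT = bind (call memberT (x0 ∷ x1 ∷ [])) (ifte x0 (ret x2) (ret (cons x1 x2)))

-- Evaluation of the basic programs

len-encList : ∀ {A : Set} (enc : A → 𝔻) xs → len (encList enc xs) ≡ length xs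
len-encList enc []       = refl
len-encList enc (x ∷ xs) = cong suc (len-encList enc xs)

len-encodeℕ : ∀ a → len (encodeℕ a) ≡ a
len-encodeℕ zero    = refl
len-encodeℕ (suc a) = cong suc (len-encodeℕ a)

dropD : 𝔻 → 𝔻 → 𝔻
dropD nil        d = d
dropD (cons _ c) d = dropD c (tail d)

isNil : 𝔻 → 𝔻
isNil nil        = cons nil nil
isNil (cons _ _) = nil

-- The condition on fold lengths is `(_≤ N)` for the timed main program and trivial for the
-- computation of f, of which only termination is required.
module Basics (Ok : ℕ → Set) where

  Ok-list : ∀ {A : Set} {enc : A → 𝔻} {xs} → Ok (length xs) → Ok (len (encList enc xs))
  Ok-list {enc = enc} {xs} = subst Ok (sym (len-encList enc xs))

  Ok-ℕ : ∀ {a} → Ok a → Ok (len (encodeℕ a))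
  Ok-ℕ {a} = subst Ok (sym (len-encodeℕ a))

  ev-if : ∀ {A : Set} {m} {ρ : Vec 𝔻 m} {e s t} (f : A → 𝔻) b {p q} → eval e ρ ≡ encodeBool b →
    (b ≡ true → Ev Ok ρ s (f p)) → (b ≡ false → Ev Ok ρ t (f q)) →
    Ev Ok ρ (ifte e s t) (f (if b then p else q))
  ev-if f true  eq yep nope = ev-then eq (yep refl)
  ev-if f false eq yep nope = ev-else eq (nope refl)

  -- The invariant I carries those facts about the accumulator, mostly size bounds, from which the
  -- body justifies its own folds.
  evFold-list : ∀ {A X : Set} {m} {ρ : Vec 𝔻 m} {b} (encA : A → 𝔻) (enc : X → 𝔻) {g : A → X → A}
    (I : A → Set) xs {a} → I a →
    (∀ {a x} → x ∈ xs → I a → I (g a x)) →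
    (∀ {a x ys} → x ∈ xs → I a → Ev Ok (cons (enc x) (encList enc ys) ∷ encA a ∷ ρ) b (encA (g a x))) →
    EvFold Ok ρ b (encList enc xs) (encA a) (encA (foldl g a xs))
  evFold-list encA enc I []       i pres body = done
  evFold-list encA enc I (x ∷ xs) i pres body = step (body (here refl) i)
    (evFold-list encA enc I xs (pres (here refl) i) (λ x∈ → pres (there x∈)) (λ x∈ → body (there x∈)))

  evFold-ℕ : ∀ {A : Set} {m} {ρ : Vec 𝔻 m} {b} (encA : A → 𝔻) {g : A → ℕ → A}
    (I : A → Set) j {a} → I a →
    (∀ {a i} → i < j → I a → I (g a i)) →
    (∀ {a i} → i < j → I a → Ev Ok (encodeℕ (suc i) ∷ encA a ∷ ρ) b (encA (g a i))) →
    EvFold Ok ρ b (encodeℕ j) (encA a) (encA (countdown g a j))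
  evFold-ℕ encA I zero    i pres body = done
  evFold-ℕ encA I (suc j) i pres body = step (body ≤-refl i)
    (evFold-ℕ encA I j (pres ≤-refl i) (λ i<j → pres (m<n⇒m<1+n i<j)) (λ i<j → body (m<n⇒m<1+n i<j)))

  ev-drop : ∀ c d → Ok (len c) → Ev Ok (c ∷ d ∷ []) dropT (dropD c d)
  ev-drop c d ok = ev-fold ok (go c d)
    where
    go : ∀ c′ d′ → EvFold Ok (c ∷ d ∷ []) (ret (tl x1)) c′ d′ (dropD c′ d′)
    go nil         d′ = done
    go (cons _ c′) d′ = step ev-ret (go c′ (tail d′))

  ev-add : ∀ c a → Ok (len c) → Ev Ok (c ∷ encodeℕ a ∷ []) addT (encodeℕ (len c + a))
  ev-add c a ok = ev-fold ok (go c a)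
    where
    go : ∀ c′ b → EvFold Ok (c ∷ encodeℕ a ∷ []) (ret (cons nil x1)) c′ (encodeℕ b) (encodeℕ (len c′ + b))
    go nil         b = done
    go (cons _ c′) b = step ev-ret
      (subst (EvFold Ok _ _ c′ _) (cong encodeℕ (+-suc (len c′) b)) (go c′ (suc b)))

  dropD-leq : ∀ c d → encodeBool (does (len d ≤? len c)) ≡ isNil (dropD c d)
  dropD-leq nil        nil        = refl
  dropD-leq nil        (cons _ d) = refl
  dropD-leq (cons _ c) nil        = dropD-leq c nil
  dropD-leq (cons _ c) (cons _ d) = trans (cong encodeBool (lemma (len d) (len c))) (dropD-leq c d)
    where
    lemma : ∀ a b → does (suc a ≤? suc b) ≡ does (a ≤? b)
    lemma zero    b = refl
    lemma (suc a) b = refl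

  ev-leq : ∀ a b → Ok (len b) → Ev Ok (a ∷ b ∷ []) leqT (encodeBool (does (len a ≤? len b)))
  ev-leq a b ok = ev-bind (ev-call (ev-drop b a ok)) (final (dropD b a) (dropD-leq b a))
    where
    final : ∀ z → encodeBool (does (len a ≤? len b)) ≡ isNil z →
      Ev Ok (z ∷ a ∷ b ∷ []) (ifte x0 (ret nil) (ret yesE)) (encodeBool (does (len a ≤? len b)))
    final nil        eq = subst (Ev Ok _ _) (sym eq) (ev-else refl ev-ret)
    final (cons _ _) eq = subst (Ev Ok _ _) (sym eq) (ev-then refl ev-ret)

  ev-rev : ∀ {A : Set} (enc : A → 𝔻) xs ys → Ok (length xs) →
    Ev Ok (encList enc xs ∷ encList enc ys ∷ []) revT (encList enc (xs ʳ++ ys))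
  ev-rev enc xs ys ok = ev-fold (Ok-list ok)
    (evFold-list (encList enc) enc (λ _ → ⊤) xs tt _ (λ _ _ → ev-ret))

  ev-any : ∀ {A : Set} {m} {ρ : Vec 𝔻 m} {l b} (enc : A → 𝔻) (f : A → Bool) xs → eval l ρ ≡ encList enc xs →
    Ok (length xs) →
    (∀ {x ys} → x ∈ xs → Ev Ok (cons (enc x) (encList enc ys) ∷ nil ∷ ρ) b (encodeBool (f x))) →
    Ev Ok ρ (anyT l b) (encodeBool (any f xs))
  ev-any {ρ = ρ} {l} {b} enc f xs eq ok body = ev-fold (subst (Ok ∘ len) (sym eq) (Ok-list ok))
    (subst (λ z → EvFold Ok ρ _ z nil _) (sym eq) (go xs body))
    where
    found : ∀ xs → EvFold Ok ρ (ifte x1 (ret x1) b) (encList enc xs) (cons nil nil) (cons nil nil)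
    found []       = done
    found (x ∷ xs) = step (ev-then refl ev-ret) (found xs)
    go : ∀ xs → (∀ {x ys} → x ∈ xs → Ev Ok (cons (enc x) (encList enc ys) ∷ nil ∷ ρ) b (encodeBool (f x))) →
      EvFold Ok ρ (ifte x1 (ret x1) b) (encList enc xs) nil (encodeBool (any f xs))
    go []       body = done
    go (x ∷ xs) body = step (ev-else refl (body (here refl))) rest
      where
      rest : EvFold Ok ρ (ifte x1 (ret x1) b) (encList enc xs) (encodeBool (f x))
        (encodeBool (f x ∨ any f xs))
      rest with f x
      ... | true  = found xs
      ... | false = go xs (body ∘ there)

  -- Trees of left depth at most k, whose equality is decided by eqT k.
  Small Elems : ℕ → 𝔻 → Set
  Small zero    d = d ≡ nil
  Small (suc k) d = Ok (len d) × Elems k d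
  Elems k nil        = ⊤
  Elems k (cons a d) = Small k a × Elems k d

  private
    -- Reads the final accumulator of `eqT`: nil records a mismatch or a second list that is too
    -- short, and a nonempty rest one that is too long.
    accepts : 𝔻 → Bool
    accepts nil                          = false
    accepts (cons nil _)                 = false
    accepts (cons (cons _ _) nil)        = true
    accepts (cons (cons _ _) (cons _ _)) = false

    does-cons : ∀ a b c d → does (cons a b ≟𝔻 cons c d) ≡ does (a ≟𝔻 c) ∧ does (b ≟𝔻 d)
    does-cons a b c d with a ≟𝔻 c | b ≟𝔻 d
    ... | yes refl | yes refl = refl
    ... | yes refl | no _     = refl
    ... | no _     | _        = refl

  ev-eq : ∀ k x y → Small k x → Small k y → Ev Ok (x ∷ y ∷ []) (eqT k) (encodeBool (does (x ≟𝔻 y)))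
  ev-eq zero    x y refl refl = ev-ret
  ev-eq (suc k) x y (ok , ex) (_ , ey) with go x y ex ey
    where
    ρ = x ∷ y ∷ []
    B : Tm 4
    B = ifte (hd x1)
      (ifte (tl x1)
        (bind (call (eqT k) (hd x0 ∷ hd (tl x1) ∷ []))
          (ifte x0 (ret (cons yesE (tl (tl x2)))) (ret nil)))
        (ret nil))
      (ret nil)
    failed : ∀ x → EvFold Ok ρ B x nil nil
    failed nil        = done
    failed (cons _ x) = step (ev-else refl ev-ret) (failed x)
    go : ∀ x y → Elems k x → Elems k y →
      ∃[ r ] (EvFold Ok ρ B x (cons (cons nil nil) y) r × accepts r ≡ does (x ≟𝔻 y))
    go nil        nil        _        _        = _ , done , refl
    go nil        (cons _ _) _        _        = _ , done , refl
    go (cons a x) nil        _        _        =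
      _ , step (ev-then refl (ev-else refl ev-ret)) (failed x) , refl
    go (cons a x) (cons b y) (sa , ex) (sb , ey) with does (a ≟𝔻 b) in eq | ev-eq k a b sa sb
    ... | false | ev = nil , step (ev-then refl (ev-then refl (ev-bind (ev-call ev) (ev-else refl ev-ret))))
      (failed x) ,
      sym (trans (does-cons a x b y) (cong (_∧ does (x ≟𝔻 y)) eq))
    ... | true  | ev with go x y ex ey
    ...   | r , evr , acc = r ,
      step (ev-then refl (ev-then refl (ev-bind (ev-call ev) (ev-then refl ev-ret)))) evr ,
      trans acc (sym (trans (does-cons a x b y) (cong (_∧ does (x ≟𝔻 y)) eq)))
  ... | r , evr , acc = ev-bind (ev-fold ok evr) (subst (λ z → Ev Ok _ _ (encodeBool z)) acc (final r))
    where
    final : ∀ r → Ev Ok (r ∷ x ∷ y ∷ []) (ifte (hd x0) (ifte (tl x0) (ret nil) (ret yesE)) (ret nil))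
      (encodeBool (accepts r))
    final nil                          = ev-else refl ev-ret
    final (cons nil _)                 = ev-else refl ev-ret
    final (cons (cons _ _) nil)        = ev-then refl (ev-else refl ev-ret)
    final (cons (cons _ _) (cons _ _)) = ev-then refl (ev-then refl ev-ret)

  small-ℕ : ∀ {a} → Ok a → Small 1 (encodeℕ a)
  small-ℕ {a} ok = Ok-ℕ ok , go a
    where
    go : ∀ a → Elems 0 (encodeℕ a)
    go zero    = tt
    go (suc a) = refl , go a

  dropD-tabulate : ∀ {n} (f : Fin n → 𝔻) i → head (dropD (encodeℕ (toℕ i)) (encodeList (tabulate f))) ≡ f i
  dropD-tabulate f zero    = refl
  dropD-tabulate f (suc i) = dropD-tabulate (f ∘ suc) i

  ev-adj : ∀ {n} (G : Graph n) u v → Ok (toℕ u) → Ok (toℕ v) →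
    Ev Ok (encodeGraph G ∷ encodeℕ (toℕ u) ∷ encodeℕ (toℕ v) ∷ []) adjT (encodeBool (adj G u v))
  ev-adj G u v oku okv = ev-bind (ev-call (ev-drop _ _ (Ok-ℕ oku)))
    (ev-bind (ev-call (ev-drop _ _ (Ok-ℕ okv)))
    (subst (Ev Ok _ _) (trans (cong (λ r → head (dropD (encodeℕ (toℕ v)) r)) (dropD-tabulate _ u))
      (dropD-tabulate _ v)) ev-ret))

-- Programs that need the graph take the adjacency matrix as first argument.

touchesT : Tm 3
touchesT = ifte x2 (call adjT (x0 ∷ x1 ∷ hd x2 ∷ [])) (ret nil)

clashT conflictT : Tm 4
clashT = ifte x3
  (bind (call adjT (x0 ∷ x1 ∷ hd x3 ∷ []))
    (ifte x0 (call (eqT 1) (x3 ∷ hd (tl x4) ∷ [])) (ret nil)))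
  (ret nil)
conflictT = anyT x3 (call clashT (x2 ∷ x3 ∷ x4 ∷ hd x0 ∷ []))

decT : Tm 2
decT = ifte x1 (ret (tl x1)) (ret x0)

residueT bumpT bumpAllT keptT : Tm 4
residueT = fold x3 nil
  (bind (call touchesT (x2 ∷ x3 ∷ hd x0 ∷ []))
    (ifte x0 (call decT (x5 ∷ x2 ∷ [])) (ret x2)))
bumpT = bind (call touchesT (x0 ∷ x1 ∷ x3 ∷ []))
  (ifte x0
    (bind (call decT (x3 ∷ tl (tl x4) ∷ [])) (ret (cons (hd x5) (cons (hd (tl x5)) x0))))
    (ret x4))
bumpAllT = bind
  (fold x3 nil (bind (call bumpT (x2 ∷ x3 ∷ x4 ∷ hd x0 ∷ [])) (ret (cons x0 x2))))
  -- The fold has reversed the bag, which must keep its order to be used as a stack.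
  (call revT (x0 ∷ nil ∷ []))
keptT = bind (call residueT (x0 ∷ x1 ∷ hd x3 ∷ tl (tl x3) ∷ []))
  (bind (call bumpAllT (x1 ∷ x2 ∷ hd x4 ∷ tl (tl x4) ∷ []))
    (ret (cons (hd x5) (cons (hd (tl x5)) (cons (cons x3 (cons x4 x1)) x0)))))

tryKeepT : Tm 5
tryKeepT = bind (call conflictT (x0 ∷ x1 ∷ x4 ∷ tl (tl x2) ∷ []))
  (ifte x0 (ret x4) (bind (call keptT (x1 ∷ x2 ∷ x5 ∷ x3 ∷ [])) (call insertT (x0 ∷ x5 ∷ []))))

introStateT : Tm 4
introStateT = bind
  (call insertT (cons (hd x3) (cons (cons nil (hd (tl x3))) (cons nil (tl (tl x3)))) ∷ x2 ∷ []))
  -- One more than p′, so that the tails passed on as t run through p′, ..., 0.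
  (fold (cons nil (hd x4)) x0 (call tryKeepT (x3 ∷ x4 ∷ x6 ∷ x1 ∷ tl x0 ∷ [])))

introT : Tm 3
introT = fold x2 nil (call introStateT (x2 ∷ x3 ∷ x1 ∷ hd x0 ∷ []))

settledT forgetT : Tm 1
settledT = ifte (hd (tl (tl x0)))
  (call (eqT 1) (hd (tl (hd (tl (tl x0)))) ∷ tl (tl (hd (tl (tl x0)))) ∷ [])) (ret yesE)
forgetT = fold x0 nil
  (bind (call settledT (hd x0 ∷ []))
    (ifte x0
      (call insertT (cons (hd (hd x1)) (cons (hd (tl (hd x1))) (tl (tl (tl (hd x1))))) ∷ x2 ∷ []))
      (ret x2)))

introAllT : Tm 3
introAllT = fold x1 x2 (call introT (x2 ∷ hd x0 ∷ x1 ∷ []))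

forgetAllT : Tm 2
forgetAllT = fold x0 x1 (call forgetT (x1 ∷ []))

solveT : Tm 4
solveT = bind (call introAllT (x0 ∷ x1 ∷ x3 ∷ []))
  (bind
    (fold x3 x0 (bind (call introAllT (x3 ∷ hd x0 ∷ x1 ∷ [])) (call forgetAllT (hd x1 ∷ x0 ∷ []))))
    (call forgetAllT (x3 ∷ x0 ∷ [])))

leastT : Tm 2
leastT = fold x1 x0
  (bind (call leqT (hd (tl (hd x0)) ∷ x1 ∷ []))
    (ifte x0 (ret (hd (tl (hd x1)))) (ret x2)))

-- Evaluation of the dynamic program within the length bound

module EvDP {n : ℕ} (G : Graph n) (N P w : ℕ) (n≤N : n ≤ N) (P<N : P < N) (2+w≤N : 2 + w ≤ N)
            (states≤N : Correct.stateBound G P n w ≤ N) where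

  open DP G
  open Correct G
  open Basics (_≤ N)

  g : 𝔻
  g = encodeGraph G

  V≤N : ∀ (v : V) → toℕ v ≤ N
  V≤N v = ≤-trans (<⇒≤ (Fin.toℕ<n v)) n≤N

  stateBound-mono : ∀ {j j′ b b′} → j ≤ j′ → b ≤ b′ → stateBound P j b ≤ stateBound P j′ b′
  stateBound-mono j≤ b≤ = *-monoʳ-≤ P (*-mono-≤ (s≤s j≤) (^-monoʳ-≤ (1 + P * P) b≤))

  -- Uniqueness turns the shape `Fits` into a bound on the length, so that the membership tests stay
  -- within N even in the middle of a loop.
  record Collection (j : ℕ) (B : List V) (acc : List State) : Set where
    constructor collection
    field
      unique : Unique acc
      fit    : ∀ {s} → s ∈ acc → Fits P j B s
  open Collection

  module _ {j : ℕ} {B : List V} (j≤n : j ≤ n) (B≤w : length B ≤ w) where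

    collection-≤N : ∀ {acc} → Collection j B acc → length acc ≤ N
    collection-≤N c = ≤-trans (length-states-≤ (unique c) (fit c))
      (≤-trans (stateBound-mono j≤n B≤w) states≤N)

    length-bag : ∀ {p′ B bag} → Pointwise (FitsE p′) B bag → length bag ≡ length B
    length-bag []       = refl
    length-bag (_ ∷ fs) = cong suc (length-bag fs)

    bag-≤N : ∀ {s} → Fits P j B s → 2 + length (proj₂ (proj₂ s)) ≤ N
    bag-≤N f = ≤-trans (+-monoʳ-≤ 2 (≤-trans (≤-reflexive (length-bag (Fits.entries f))) B≤w)) 2+w≤N

    small-zeros : ∀ a → Elems 1 (encodeℕ a)
    small-zeros zero    = tt
    small-zeros (suc a) = (z≤n , tt) , small-zeros a

    small-entry : ∀ {p′ v e} → p′ < P → FitsE p′ v e → Small 2 (encE e)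
    small-entry         p<P none = z≤n , tt
    small-entry {v = v} p<P (some {t} {r} t≤ r≤) =
      ≤-trans (s≤s (s≤s (≤-reflexive (len-encodeℕ r)))) (≤-trans (s≤s (≤-<-trans r≤ p<P)) P<N) ,
      small-ℕ (V≤N v) , small-ℕ (≤-trans (<⇒≤ (≤-<-trans t≤ p<P)) (<⇒≤ P<N)) , small-zeros r

    small-bag : ∀ {p′ B bag} → p′ < P → Pointwise (FitsE p′) B bag → Elems 2 (encList encE bag)
    small-bag p<P []       = tt
    small-bag p<P (f ∷ fs) = small-entry p<P f , small-bag p<P fs

    -- A kept entry with residue r is a list of length 2 + r, and a state one of length two plus the
    -- size of the bag; hence P < N and 2 + w ≤ N are asked for.
    small-state : ∀ {s} → Fits P j B s → Small 3 (encS s)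
    small-state {p′ , c , bag} f@(fits p<P c≤ es) =
      ≤-trans (≤-reflexive (cong (2 +_) (len-encList encE bag))) (bag-≤N f) ,
      (Ok-ℕ (≤-trans (<⇒≤ p<P) (<⇒≤ P<N)) , small-zeros p′) ,
      (Ok-ℕ (≤-trans c≤ (≤-trans j≤n n≤N)) , small-zeros c) , small-bag p<P es

    ev-insert : ∀ {s acc} → Fits P j B s → Collection j B acc →
      Ev (_≤ N) (encS s ∷ encList encS acc ∷ []) insertT (encList encS (insert s acc))
    ev-insert {s} {acc} f c = ev-bind
      (ev-call (ev-any encS (λ z → does (encS s ≟𝔻 encS z)) acc refl (collection-≤N c)
        (λ z∈ → ev-call (ev-eq 3 _ _ (small-state f) (small-state (fit c z∈))))))
      (ev-if (encList encS) (isMember s acc) refl (λ _ → ev-ret) (λ _ → ev-ret))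

    insert-collection : ∀ {s acc} → Fits P j B s → Collection j B acc → Collection j B (insert s acc)
    insert-collection {s} {acc} f (collection u h) = collection (unique-insert u) λ z∈ →
      Sum.[ h , (λ { refl → f }) ] (Collects.only (collects-insert s) acc z∈)

  ev-touches : ∀ v e → Ev (_≤ N) (g ∷ encV v ∷ encE e ∷ []) touchesT (encodeBool (touches v e))
  ev-touches v nothing            = ev-else refl ev-ret
  ev-touches v (just (x , t , r)) = ev-then refl (ev-call (ev-adj G v x (V≤N v) (V≤N x)))

  ev-clash : ∀ {p′} v t {x e} → t ≤ N → p′ < P → FitsE p′ x e →
    Ev (_≤ N) (g ∷ encV v ∷ encodeℕ t ∷ encE e ∷ []) clashT (encodeBool (clash v t e))
  ev-clash v t t≤N p<P none = ev-else refl ev-ret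
  ev-clash v t {x} t≤N p<P (some {u} u≤ _) = ev-then refl (ev-bind (ev-call (ev-adj G v x (V≤N v) (V≤N x)))
    (ev-if encodeBool (adj G v x) refl
      (λ _ → ev-call (ev-eq 1 _ _ (small-ℕ t≤N) (small-ℕ (≤-trans (<⇒≤ (≤-<-trans u≤ p<P)) (<⇒≤ P<N)))))
      (λ _ → ev-ret)))

  ∈-fits : ∀ {p′ B bag e} → Pointwise (FitsE p′) B bag → e ∈ bag → ∃[ x ] FitsE p′ x e
  ∈-fits (f ∷ fs) (here refl) = _ , f
  ∈-fits (f ∷ fs) (there e∈)  = ∈-fits fs e∈

  ev-dec : ∀ p′ r → Ev (_≤ N) (encodeℕ p′ ∷ encodeℕ r ∷ []) decT (encodeℕ (dec p′ r))
  ev-dec p′ zero    = ev-else refl ev-ret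
  ev-dec p′ (suc r) = ev-then refl ev-ret

  ev-residue : ∀ p′ v bag → length bag ≤ N →
    Ev (_≤ N) (g ∷ encV v ∷ encodeℕ p′ ∷ encList encE bag ∷ []) residueT (encodeℕ (residue p′ v 0 bag))
  ev-residue p′ v bag ok = ev-fold (Ok-list ok) (evFold-list encodeℕ encE (λ _ → ⊤) bag {0} tt _
    λ {r} {e} _ _ → ev-bind (ev-call (ev-touches v e))
      (ev-if encodeℕ (touches v e) refl (λ _ → ev-call (ev-dec p′ r)) (λ _ → ev-ret)))

  ev-bump : ∀ p′ v e → Ev (_≤ N) (g ∷ encV v ∷ encodeℕ p′ ∷ encE e ∷ []) bumpT (encE (bump p′ v e))
  ev-bump p′ v nothing            = ev-bind (ev-call (ev-touches v nothing)) (ev-else refl ev-ret)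
  ev-bump p′ v (just (x , t , r)) = ev-bind (ev-call (ev-touches v (just (x , t , r))))
    (ev-if (λ r → encE (just (x , t , r))) (adj G v x) refl
      (λ _ → ev-bind (ev-call (ev-dec p′ r)) ev-ret) (λ _ → ev-ret))

  ev-bumpAll : ∀ p′ v bag → length bag ≤ N →
    Ev (_≤ N) (g ∷ encV v ∷ encodeℕ p′ ∷ encList encE bag ∷ []) bumpAllT (encList encE (map (bump p′ v) bag))
  ev-bumpAll p′ v bag ok = ev-bind
    (ev-fold (Ok-list ok) (evFold-list (encList encE) encE (λ _ → ⊤) bag {[]} tt _
      λ {_} {e} _ _ → ev-bind (ev-call (ev-bump p′ v e)) ev-ret))
    (subst (Ev (_≤ N) _ _) (cong (encList encE) (twice bag []))
      (ev-call (ev-rev encE (foldl addBumped [] bag) []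
        (≤-trans (≤-reflexive (lengths bag [])) (≤-trans (≤-reflexive (+-identityʳ _)) ok)))))
    where
    addBumped : List Entry → Entry → List Entry
    addBumped acc e = bump p′ v e ∷ acc
    twice : ∀ bag acc → foldl addBumped acc bag ʳ++ [] ≡ acc ʳ++ map (bump p′ v) bag
    twice []        acc = refl
    twice (e ∷ bag) acc = twice bag (bump p′ v e ∷ acc)
    lengths : ∀ bag acc → length (foldl addBumped acc bag) ≡ length bag + length acc
    lengths []        acc = refl
    lengths (e ∷ bag) acc = trans (lengths bag _) (+-suc (length bag) (length acc))

  module _ {j : ℕ} {B : List V} (v : V) (j<n : j < n) (B<w : length B < w) where

    private
      j≤n = <⇒≤ j<n
      B≤w = <⇒≤ B<w

    ev-tryKeep : ∀ {s acc t} → Fits P j B s → t ≤ proj₁ s → Collection (suc j) (v ∷ B) acc →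
      Ev (_≤ N) (g ∷ encV v ∷ encS s ∷ encList encS acc ∷ encodeℕ t ∷ []) tryKeepT
        (encList encS (tryKeep v s acc t))
    ev-tryKeep {s@(p′ , c , bag)} {acc} {t} f t≤ col = ev-bind
      (ev-call (ev-any encE (clash v t) bag refl bag≤N
        (λ e∈ → ev-call (ev-clash v t t≤N (Fits.modulus< f) (proj₂ (∈-fits (Fits.entries f) e∈))))))
      (ev-if (encList encS) (conflict v t s) refl (λ _ → ev-ret)
        (λ nc → ev-bind
          (ev-call (ev-bind (ev-call (ev-residue p′ v bag bag≤N))
            (ev-bind (ev-call (ev-bumpAll p′ v bag bag≤N)) ev-ret)))
          (ev-call (ev-insert j<n B<w (fits-intro f (keep-step t t≤ nc)) col))))
      where
      bag≤N : length bag ≤ N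
      bag≤N = ≤-trans (m≤n+m (length bag) 2) (bag-≤N j≤n B≤w f)
      t≤N : t ≤ N
      t≤N = ≤-trans (<⇒≤ (≤-<-trans t≤ (Fits.modulus< f))) (<⇒≤ P<N)

    tryKeep-collection : ∀ {s acc t} → Fits P j B s → t ≤ proj₁ s → Collection (suc j) (v ∷ B) acc →
      Collection (suc j) (v ∷ B) (tryKeep v s acc t)
    tryKeep-collection {s} {acc} {t} f t≤ col = go (conflict v t s) refl
      where
      go : ∀ b → conflict v t s ≡ b → Collection (suc j) (v ∷ B) (if b then acc else insert (kept v t s) acc)
      go true  _  = col
      go false nc = insert-collection j<n B<w (fits-intro f (keep-step t t≤ nc)) col

    ev-introState : ∀ {s acc} → Fits P j B s → Collection (suc j) (v ∷ B) acc →
      Ev (_≤ N) (g ∷ encV v ∷ encList encS acc ∷ encS s ∷ []) introStateT (encList encS (introState v acc s))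
    ev-introState {s} {acc} f col = ev-bind
      (ev-call (ev-insert j<n B<w (fits-intro f delete-step) col))
      (ev-fold (Ok-ℕ {suc (proj₁ s)} (≤-trans (Fits.modulus< f) (<⇒≤ P<N)))
        (evFold-ℕ (encList encS) (Collection (suc j) (v ∷ B)) (suc (proj₁ s))
          (insert-collection j<n B<w (fits-intro f delete-step) col)
          (λ { (s≤s t≤) → tryKeep-collection f t≤ })
          (λ { (s≤s t≤) c → ev-call (ev-tryKeep f t≤ c) })))

    introState-collection : ∀ {s acc} → Fits P j B s → Collection (suc j) (v ∷ B) acc →
      Collection (suc j) (v ∷ B) (introState v acc s)
    introState-collection {s} f col = countdown-invariant {I = Collection (suc j) (v ∷ B)} (suc (proj₁ s))
      (λ { t (s≤s t≤) → tryKeep-collection f t≤ }) (insert-collection j<n B<w (fits-intro f delete-step) col)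

    ev-intro : ∀ {sts} → length sts ≤ N → (∀ {s} → s ∈ sts → Fits P j B s) →
      Ev (_≤ N) (g ∷ encV v ∷ encList encS sts ∷ []) introT (encList encS (intro v sts))
    ev-intro {sts} ok h = ev-fold (Ok-list ok)
      (evFold-list (encList encS) encS (Collection (suc j) (v ∷ B)) sts
      (collection [] (λ ())) (λ s∈ → introState-collection (h s∈))
        (λ s∈ c → ev-call (ev-introState (h s∈) c)))

    intro-collection : ∀ {sts} → (∀ {s} → s ∈ sts → Fits P j B s) → Collection (suc j) (v ∷ B) (intro v sts)
    intro-collection {sts} h = collection (unique-intro v sts) λ z∈ →
      let (s , s∈ , st) = intro⁻ z∈ in fits-intro (h s∈) st

  module _ {j : ℕ} {x : V} {B : List V} (j≤n : j ≤ n) (B<w : length B < w) where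

    ev-settled : ∀ {s} → Fits P j (x ∷ B) s → Ev (_≤ N) (encS s ∷ []) settledT (encodeBool (topSettled s))
    ev-settled (fits _   _ (none ∷ _))        = ev-else refl ev-ret
    ev-settled (fits p<P _ (some t≤ r≤ ∷ _)) = ev-then refl (ev-call (ev-eq 1 _ _ (small t≤) (small r≤)))
      where
      small : ∀ {t} → t ≤ _ → Small 1 (encodeℕ t)
      small t≤ = small-ℕ (≤-trans (<⇒≤ (≤-<-trans t≤ p<P)) (<⇒≤ P<N))

    encS-pop : ∀ {s} → Fits P j (x ∷ B) s →
      cons (head (encS s)) (cons (head (tail (encS s))) (tail (tail (tail (encS s))))) ≡ encS (pop s)
    encS-pop (fits _ _ (_ ∷ _)) = refl

    forget-collection : ∀ {sts} → (∀ {s} → s ∈ sts → Fits P j (x ∷ B) s) → Collection j B (forget sts)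
    forget-collection {sts} h = collection (unique-forget sts) λ z∈ →
      let (s , s∈ , st) = forget⁻ z∈ in fits-forget (h s∈) st

    ev-forget : ∀ {sts} → length sts ≤ N → (∀ {s} → s ∈ sts → Fits P j (x ∷ B) s) →
      Ev (_≤ N) (encList encS sts ∷ []) forgetT (encList encS (forget sts))
    ev-forget {sts} ok h = ev-fold (Ok-list ok) (evFold-list (encList encS) encS (Collection j B) sts
      (collection [] (λ ()))
      (λ {acc} {s} s∈ c → step-collection (h s∈) c)
      (λ {acc} {s} s∈ c → ev-bind (ev-call (ev-settled (h s∈)))
        (ev-if (encList encS) (topSettled s) refl
          (λ top → ev-call (subst (λ z → Ev (_≤ N) (z ∷ encList encS acc ∷ []) insertT
            (encList encS (insert (pop s) acc)))
            (sym (encS-pop (h s∈))) (ev-insert j≤n (<⇒≤ B<w) (fits-forget (h s∈) (forget-step top)) c)))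
          (λ _ → ev-ret))))
      where
      step-collection : ∀ {s acc} → Fits P j (x ∷ B) s → Collection j B acc →
        Collection j B (forgetState acc s)
      step-collection {s} {acc} f c = go (topSettled s) refl
        where
        go : ∀ b → topSettled s ≡ b → Collection j B (if b then insert (pop s) acc else acc)
        go true  top = insert-collection j≤n (<⇒≤ B<w) (fits-forget f (forget-step top)) c
        go false _   = c

  -- Here j counts all vertices introduced so far, including forgotten ones. It bounds the
  -- deletions, and staying below n it bounds the list of states.
  record Stage (j : ℕ) (B : List V) (sts : List State) : Set where
    constructor stage
    field
      short : length sts ≤ N
      fit   : ∀ {s} → s ∈ sts → Fits P j B s

  collection⇒stage : ∀ {j B sts} → j ≤ n → length B ≤ w → Collection j B sts → Stage j B sts
  collection⇒stage j≤n B≤w c = stage (collection-≤N j≤n B≤w c) (fit c)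

  ev-introAll : ∀ {j B sts} vs → length vs + j ≤ n → length vs + length B ≤ w → Stage j B sts →
    Ev (_≤ N) (g ∷ encList encV vs ∷ encList encS sts ∷ []) introAllT (encList encS (introAll vs sts)) ×
    Stage (length vs + j) (vs ʳ++ B) (introAll vs sts)
  ev-introAll {j} {B} {sts} vs j≤n B≤w st =
    ev-fold (Ok-list (≤-trans (≤-trans (m≤m+n _ j) j≤n) n≤N)) (proj₁ all) , proj₂ all
    where
    go : ∀ ws {j B sts′} → length ws + j ≤ n → length ws + length B ≤ w → Stage j B sts′ →
      EvFold (_≤ N) (g ∷ encList encV vs ∷ encList encS sts ∷ []) (call introT (x2 ∷ hd x0 ∷ x1 ∷ []))
        (encList encV ws) (encList encS sts′) (encList encS (introAll ws sts′)) ×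
      Stage (length ws + j) (ws ʳ++ B) (introAll ws sts′)
    go []       _   _   st = done , st
    go (v ∷ ws) {j} {B} {sts′} j≤n B≤w st =
      let j<n = ≤-trans (s≤s (m≤n+m j (length ws))) j≤n
          B<w = ≤-trans (s≤s (m≤n+m (length B) (length ws))) B≤w
          (e , st′) = go ws (≤-trans (≤-reflexive (+-suc (length ws) j)) j≤n)
                            (≤-trans (≤-reflexive (+-suc (length ws) (length B))) B≤w)
                            (collection⇒stage j<n B<w (intro-collection v j<n B<w (Stage.fit st)))
      in step (ev-call (ev-intro v j<n B<w (Stage.short st) (Stage.fit st))) e ,
         subst (λ i → Stage i (ws ʳ++ v ∷ B) (introAll ws (intro v sts′))) (+-suc (length ws) j) st′
    all = go vs j≤n B≤w st

  ev-forgetAll : ∀ {j B sts} vs → length vs ≤ N → j ≤ n → length vs + length B ≤ w → Stage j (vs ʳ++ B) sts →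
    Ev (_≤ N) (encList encV vs ∷ encList encS sts ∷ []) forgetAllT (encList encS (forgetAll vs sts)) ×
    Stage j B (forgetAll vs sts)
  ev-forgetAll {j} {B} {sts} vs vs≤N j≤n B≤w st = ev-fold (Ok-list vs≤N) (proj₁ all) , proj₂ all
    where
    go : ∀ us ws {sts′} → length us ≡ length ws → length ws + length B ≤ w → Stage j (ws ++ B) sts′ →
      EvFold (_≤ N) (encList encV vs ∷ encList encS sts ∷ []) (call forgetT (x1 ∷ []))
        (encList encV us) (encList encS sts′) (encList encS (forgetAll us sts′)) ×
      Stage j B (forgetAll us sts′)
    go []       []       eq B≤w st = done , st
    go (u ∷ us) (x ∷ ws) eq B≤w st =
      let B<w = ≤-trans (s≤s (≤-reflexive (length-++ ws))) B≤w
          (e , st′) = go us ws (suc-injective eq) (<⇒≤ B≤w)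
                        (collection⇒stage j≤n (<⇒≤ B<w) (forget-collection j≤n B<w (Stage.fit st)))
      in step (ev-call (ev-forget j≤n B<w (Stage.short st) (Stage.fit st))) e , st′
    all = go vs (reverse vs) (sym (length-reverse vs))
      (≤-trans (≤-reflexive (cong (_+ length B) (length-reverse vs))) B≤w)
      (subst (λ C → Stage j C sts) (ʳ++-defn vs) st)

  ev-blocks : ∀ {m z} {ρ : Vec 𝔻 m} Bs {U sts j} →
    (∀ {B} → B ∈ Bs → length B + length U ≤ w) → length (concat Bs) + j ≤ n → Stage j (reverse U) sts →
    EvFold (_≤ N) (z ∷ g ∷ ρ)
      (bind (call introAllT (x3 ∷ hd x0 ∷ x1 ∷ [])) (call forgetAllT (hd x1 ∷ x0 ∷ [])))
      (encList (encList encV) Bs) (encList encS sts) (encList encS (foldl runBlock sts Bs)) ×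
    ∃[ i ] (i ≤ n × Stage i (reverse U) (foldl runBlock sts Bs))
  ev-blocks []       B≤w j≤n st = done , _ , j≤n , st
  ev-blocks (B ∷ Bs) {U} {j = j} B≤w j≤n st =
    let total = ≤-trans (≤-reflexive
          (trans (sym (+-assoc (length B) _ j)) (cong (_+ j) (sym (length-++ B))))) j≤n
        Bj≤n  = ≤-trans (+-monoʳ-≤ (length B) (m≤n+m j (length (concat Bs)))) total
        BU≤w  = ≤-trans (≤-reflexive (cong (length B +_) (length-reverse U))) (B≤w (here refl))
        (e₁ , st₁) = ev-introAll B Bj≤n BU≤w st
        (e₂ , st₂) = ev-forgetAll B (≤-trans (≤-trans (m≤m+n (length B) j) Bj≤n) n≤N) Bj≤n BU≤w st₁
        (e₃ , i , i≤n , st₃) = ev-blocks Bs {U} (B≤w ∘ there)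
           (≤-trans (≤-reflexive (trans (sym (+-assoc (length (concat Bs)) (length B) j))
             (trans (cong (_+ j) (+-comm (length (concat Bs)) (length B))) (+-assoc (length B) _ j))))
               total) st₂
    in step (ev-bind (ev-call e₁) (ev-call e₂)) e₃ , i , i≤n , st₃

  ev-solve : ∀ {U Bs sts} → length U + length (concat Bs) ≤ n → length Bs ≤ N → length U ≤ w →
    (∀ {B} → B ∈ Bs → length B + length U ≤ w) → Stage 0 [] sts →
    Ev (_≤ N) (g ∷ encList encV U ∷ encList (encList encV) Bs ∷ encList encS sts ∷ [])
      solveT (encList encS (solve U Bs sts)) ×
    length (solve U Bs sts) ≤ N
  ev-solve {U} {Bs} UB≤n Bs≤N U≤w B≤w st =
    let U≤n = ≤-trans (m≤m+n (length U) _) UB≤n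
        (e₁ , st₁) = ev-introAll U (≤-trans (≤-reflexive (+-identityʳ _)) U≤n)
          (≤-trans (≤-reflexive (+-identityʳ _)) U≤w) st
        BU≤n = ≤-trans (≤-reflexive (+-comm (length (concat Bs)) (length U))) UB≤n
        (e₂ , i , i≤n , st₂) = ev-blocks Bs {U} B≤w
          (≤-trans (≤-reflexive (cong (length (concat Bs) +_) (+-identityʳ (length U)))) BU≤n) st₁
        (e₃ , st₃) = ev-forgetAll U (≤-trans U≤n n≤N) i≤n (≤-trans (≤-reflexive (+-identityʳ _)) U≤w) st₂
    in ev-bind (ev-call e₁) (ev-bind (ev-fold (Ok-list Bs≤N) e₂) (ev-call e₃)) ,
       Stage.short st₃

-- Programs for the separator, the logarithm and the moduli

anyAdjT addBlockT highT splitT candidateT bestT : Tm 3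
anyAdjT = anyT x2 (call adjT (x2 ∷ x3 ∷ hd x0 ∷ []))
addBlockT = fold x2 (cons (cons x1 nil) nil)
  (bind (call anyAdjT (x2 ∷ x3 ∷ hd x0 ∷ []))
    (ifte x0
      (bind (call revT (hd x1 ∷ hd x2 ∷ [])) (ret (cons x0 (tl x3))))
      (ret (cons (hd x2) (cons (hd x1) (tl x2))))))
highT = bind (call dropT (x2 ∷ x0 ∷ []))
  -- The counter starts at K + 1 and loses one for each neighbour, stopping at zero since the tail
  -- of nil is nil. It ends at zero exactly when the degree exceeds K.
  (bind (fold (hd x0) (cons nil x2) (ifte (hd x0) (ret (tl x1)) (ret x1)))
    (ifte x0 (ret nil) (ret yesE)))
splitT = fold x2 (cons nil nil)
  (bind (call highT (x2 ∷ x3 ∷ hd x0 ∷ []))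
    (ifte x0
      (ret (cons (cons (hd x1) (hd x2)) (tl x2)))
      (bind (call addBlockT (x3 ∷ hd x1 ∷ tl x2 ∷ [])) (ret (cons (hd x3) x0)))))

longestT logT initialT verticesT : Tm 1
longestT = fold x0 nil
  (bind (call leqT (hd x0 ∷ x1 ∷ [])) (ifte x0 (ret x2) (call addT (hd x1 ∷ nil ∷ []))))
logT = fold x0 (cons nil yesE)
  (bind (call leqT (tl x1 ∷ x2 ∷ []))
    (ifte x0
      (bind (call addT (tl x2 ∷ tl x2 ∷ [])) (ret (cons (cons nil (hd x3)) x0)))
      (ret x2)))
initialT = fold x0 nil (ret (cons (cons (tl x0) (cons nil nil)) x1))
-- The tails of the numeral n are pushed in the order n - 1, ..., 0, which leaves the vertices in
-- increasing order.
verticesT = fold x0 nil (ret (cons (tl x0) x1))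

candidateT = bind (call splitT (x0 ∷ x2 ∷ x1 ∷ []))
  (bind (call longestT (tl x0 ∷ []))
    (bind (call addT (hd x1 ∷ x0 ∷ []))
      (bind (call addT (x5 ∷ x0 ∷ [])) (ret (cons x0 x3)))))
bestT = bind (call candidateT (x0 ∷ x1 ∷ x2 ∷ []))
  (fold x3 x0
    (bind (call candidateT (x3 ∷ x4 ∷ tl x0 ∷ []))
      (bind (call leqT (hd x2 ∷ hd x0 ∷ [])) (ifte x0 (ret x3) (ret x1)))))

moduliT : Tm 2
-- The initial value `cons nil yesE` is the numeral 2.
moduliT = fold (cons nil x0) (cons nil yesE) (fold (cons nil x2) x1 (call addT (x5 ∷ x1 ∷ [])))

mainT : Tm 1
mainT =
  bind (call addT (x0 ∷ nil ∷ []))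
  (bind (call verticesT (x0 ∷ []))
  (bind (call bestT (x2 ∷ x0 ∷ x1 ∷ []))
  (bind (call logT (x2 ∷ []))
  (bind (call moduliT (hd x1 ∷ hd x0 ∷ []))
  (bind (call initialT (x0 ∷ []))
  (bind (call solveT (x6 ∷ hd (tl x3) ∷ tl (tl x3) ∷ x0 ∷ []))
    (call leastT (x6 ∷ x0 ∷ []))))))))

encodeList-tabulate : ∀ {A : Set} {n} (f : A → 𝔻) (h : Fin n → A) →
  encodeList (tabulate (f ∘ h)) ≡ encList f (tabulate h)
encodeList-tabulate {n = zero}  f h = refl
encodeList-tabulate {n = suc n} f h = cong (cons (f (h zero))) (encodeList-tabulate f (h ∘ suc))

-- Evaluation of the main program

module EvMain {n : ℕ} (G : Graph n) (N : ℕ) (3n≤N : 3 * suc n ≤ N) where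

  open DP G
  open Correct G
  open Decomposition G
  open Blocks G
  open Measure G
  open Algorithm G hiding (M; L; P)
  open Basics (_≤ N)

  g : 𝔻
  g = encodeGraph G

  encVs : List V → 𝔻
  encVs = encList encV

  encBs : List (List V) → 𝔻
  encBs = encList encVs

  encUBs : List V × List (List V) → 𝔻
  encUBs (U , Bs) = cons (encVs U) (encBs Bs)

  encC : Candidate → 𝔻
  encC (m , UBs) = cons (encodeℕ m) (encUBs UBs)

  n≤N : n ≤ N
  n≤N = ≤-trans (n≤1+n n) (≤-trans (m≤m+n (suc n) _) 3n≤N)

  V≤N : ∀ (v : V) → toℕ v ≤ N
  V≤N v = ≤-trans (<⇒≤ (Fin.toℕ<n v)) n≤N

  ev-anyAdj : ∀ v B → length B ≤ n →
    Ev (_≤ N) (g ∷ encV v ∷ encVs B ∷ []) anyAdjT (encodeBool (any (adj G v) B))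
  ev-anyAdj v B B≤n = ev-any encV (adj G v) B refl (≤-trans B≤n n≤N)
    (λ {x} _ → ev-call (ev-adj G v x (V≤N v) (V≤N x)))

  ev-addBlock : ∀ v Bs → length Bs ≤ n → (∀ {B} → B ∈ Bs → length B ≤ n) →
    Ev (_≤ N) (g ∷ encV v ∷ encBs Bs ∷ []) addBlockT (encBs (addBlock v Bs))
  ev-addBlock v Bs Bs≤n B≤n = ev-fold (Ok-list (≤-trans Bs≤n n≤N))
    (evFold-list (encBs ∘ uncurry∷) encVs (λ _ → ⊤) Bs {v ∷ [] , []} tt _
      λ {MO} {B} B∈ _ → ev-bind (ev-call (ev-anyAdj v B (B≤n B∈)))
        (ev-if (encBs ∘ uncurry∷) (any (adj G v) B) refl
          (λ _ → ev-bind (ev-call (ev-rev encV B (proj₁ MO) (≤-trans (B≤n B∈) n≤N))) ev-ret)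
          (λ _ → ev-ret)))

  ev-high : ∀ K v → Ev (_≤ N) (g ∷ encodeℕ K ∷ encV v ∷ []) highT (encodeBool (isHigh K v))
  ev-high K v = ev-bind (ev-call (ev-drop _ _ (Ok-ℕ (V≤N v))))
    (ev-bind scan (final (suc K ∸ fullDegree v) refl))
    where
    row : 𝔻
    row = head (dropD (encV v) g)
    row≡ : row ≡ encList (encodeBool ∘ adj G v) (allFin n)
    row≡ = trans (Basics.dropD-tabulate (_≤ N) _ v) (encodeList-tabulate (encodeBool ∘ adj G v) id)
    ρ = dropD (encV v) g ∷ g ∷ encodeℕ K ∷ encV v ∷ []
    body : Tm 6
    body = ifte (hd x0) (ret (tl x1)) (ret x1)
    go : ∀ xs a → EvFold (_≤ N) ρ body (encList (encodeBool ∘ adj G v) xs) (encodeℕ a)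
      (encodeℕ (a ∸ count (adj G v) xs))
    go []       a = done
    go (x ∷ xs) a with adj G v x
    go (x ∷ xs) zero    | true  = step (ev-then refl ev-ret)
      (subst (λ z → EvFold (_≤ N) ρ body (encList (encodeBool ∘ adj G v) xs) nil (encodeℕ z))
      (0∸n≡0 (count (adj G v) xs)) (go xs 0))
    go (x ∷ xs) (suc a) | true  = step (ev-then refl ev-ret) (go xs a)
    go (x ∷ xs) a       | false = step (ev-else refl ev-ret) (go xs a)
    scan : Ev (_≤ N) ρ (fold (hd x0) (cons nil x2) body) (encodeℕ (suc K ∸ fullDegree v))
    scan = ev-fold (subst (λ r → len r ≤ N) (sym row≡)
      (Ok-list (≤-trans (≤-reflexive (List.length-tabulate id)) n≤N)))
      (subst (λ r → EvFold (_≤ N) ρ body r (encodeℕ (suc K)) (encodeℕ (suc K ∸ fullDegree v))) (sym row≡)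
        (go (allFin n) (suc K)))
    test : Tm 5
    test = ifte x0 (ret nil) (ret yesE)
    final : ∀ a → suc K ∸ fullDegree v ≡ a → Ev (_≤ N) (encodeℕ a ∷ ρ) test (encodeBool (isHigh K v))
    final zero    eq = subst (λ b → Ev (_≤ N) (nil ∷ ρ) test (encodeBool b))
      (sym (dec-true (K <? fullDegree v) (m∸n≡0⇒m≤n eq)))
      (ev-else refl ev-ret)
    final (suc a) eq = subst (λ b → Ev (_≤ N) (encodeℕ (suc a) ∷ ρ) test (encodeBool b))
      (sym (dec-false (K <? fullDegree v) (λ K<d → 1+n≢0 (trans (sym eq) (m≤n⇒m∸n≡0 K<d)))))
        (ev-then refl ev-ret)

  length-addBlock : ∀ v Bs → length (addBlock v Bs) ≤ suc (length Bs)
  length-addBlock v Bs = s≤s (≤-trans (go Bs (v ∷ []) []) (≤-reflexive (+-identityʳ (length Bs))))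
    where
    go : ∀ Bs M O → length (proj₂ (merge v (M , O) Bs)) ≤ length Bs + length O
    go []       M O = ≤-refl
    go (B ∷ Bs) M O with any (adj G v) B
    ... | true  = ≤-trans (go Bs _ O) (n≤1+n _)
    ... | false = ≤-trans (go Bs M (B ∷ O)) (≤-reflexive (+-suc (length Bs) (length O)))

  length-∈-concat : ∀ {B : List V} {Bs} → B ∈ Bs → length B ≤ length (concat Bs)
  length-∈-concat {B} {_ ∷ Bs} (here refl) = ≤-trans (m≤m+n (length B) _) (≤-reflexive (sym (length-++ B)))
  length-∈-concat {B} {C ∷ Bs} (there B∈)  =
    ≤-trans (length-∈-concat B∈) (≤-trans (m≤n+m _ (length C)) (≤-reflexive (sym (length-++ C))))

  splits-length : ∀ {h W ws U Bs} → Splits h W ws U Bs → length U + length (concat Bs) ≡ length ws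
  splits-length {U = U} s = trans (sym (length-++ U)) (Perm.↭-length (Splits.cover s))

  -- The number of blocks is bounded along with the evaluation, as `addBlockT` folds over their
  -- list; each vertex adds at most one block.
  ev-split : ∀ K → Ev (_≤ N) (g ∷ encodeℕ K ∷ encVs (allFin n) ∷ []) splitT (encUBs (split (isHigh K))) ×
    length (proj₂ (split (isHigh K))) ≤ n
  ev-split K = let (e , le) = go (allFin n) ([] , []) start₀ z≤n
                     (≤-reflexive (trans (+-identityʳ _) (List.length-tabulate id)))
    in ev-fold (Ok-list (≤-trans (≤-reflexive (List.length-tabulate id)) n≤N)) e ,
       ≤-trans le (≤-reflexive (trans (+-identityʳ _) (List.length-tabulate id)))
    where
    ρ = g ∷ encodeℕ K ∷ encVs (allFin n) ∷ []
    body : Tm 5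
    body = bind (call highT (x2 ∷ x3 ∷ hd x0 ∷ []))
      (ifte x0
        (ret (cons (cons (hd x1) (hd x2)) (tl x2)))
        (bind (call addBlockT (x3 ∷ hd x1 ∷ tl x2 ∷ [])) (ret (cons (hd x3) x0))))
    h = isHigh K
    W = lowSet K
    start₀ : Splits h W [] [] []
    start₀ = splits _↭_.refl (λ ()) (mkGood (λ ()) (λ ()) (λ ()))
    go : ∀ vs {ws} UBs → Splits h W ws (proj₁ UBs) (proj₂ UBs) → length (proj₂ UBs) ≤ length ws →
      length vs + length ws ≤ n →
      EvFold (_≤ N) ρ body (encVs vs) (encUBs UBs) (encUBs (foldl (splitStep h) UBs vs)) ×
      length (proj₂ (foldl (splitStep h) UBs vs)) ≤ length vs + length ws
    go []       UBs s le tot = done , le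
    go (v ∷ vs) {ws} (U , Bs) s le tot =
      let ws≤n = ≤-trans (m≤n+m (length ws) (suc (length vs))) tot
          (e , le′) = go vs (splitStep h (U , Bs) v)
            (splitStep-splits h W (λ x → Vec.lookup∘tabulate _ x) v s) bound
            (≤-trans (≤-reflexive (+-suc (length vs) (length ws))) tot)
      in step (ev-bind (ev-call (ev-high K v)) (ev-if encUBs (h v) refl (λ _ → ev-ret)
           (λ _ → ev-bind (ev-call (ev-addBlock v Bs (≤-trans le ws≤n)
             (λ B∈ → ≤-trans (length-∈-concat B∈)
               (≤-trans (≤-trans (m≤n+m _ (length U)) (≤-reflexive (splits-length s))) ws≤n)))) ev-ret))) e ,
         ≤-trans le′ (≤-reflexive (+-suc (length vs) (length ws)))
      where
      bound : length (proj₂ (splitStep h (U , Bs) v)) ≤ suc (length ws)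
      bound with h v
      ... | true  = m≤n⇒m≤1+n le
      ... | false = ≤-trans (length-addBlock v Bs) (s≤s le)

  ev-longest : ∀ Bs → length Bs ≤ n → (∀ {B} → B ∈ Bs → length B ≤ n) →
    Ev (_≤ N) (encBs Bs ∷ []) longestT (encodeℕ (longest Bs))
  ev-longest Bs Bs≤n B≤n = ev-fold (Ok-list (≤-trans Bs≤n n≤N)) (evFold-list encodeℕ encVs (_≤ n) Bs {0} z≤n
    (λ {m} {B} B∈ m≤n → if-dec (_≤ n) (length B ≤? m) (λ _ → m≤n) (λ _ → B≤n B∈))
    (λ {m} {B} B∈ m≤n → ev-bind
      (ev-call (subst₂ (λ a b → Ev (_≤ N) (encVs B ∷ encodeℕ m ∷ []) leqT (encodeBool (does (a ≤? b))))
        (len-encList encV B) (len-encodeℕ m) (ev-leq (encVs B) (encodeℕ m) (Ok-ℕ (≤-trans m≤n n≤N)))))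
      (ev-if encodeℕ (does (length B ≤? m)) refl (λ _ → ev-ret)
        (λ _ → ev-call (subst (λ a → Ev (_≤ N) (encVs B ∷ nil ∷ []) addT (encodeℕ a))
          (trans (+-identityʳ _) (len-encList encV B))
            (ev-add (encVs B) 0 (Ok-list (≤-trans (B≤n B∈) n≤N))))))))

  ev-leqℕ : ∀ a b → b ≤ N → Ev (_≤ N) (encodeℕ a ∷ encodeℕ b ∷ []) leqT (encodeBool (does (a ≤? b)))
  ev-leqℕ a b b≤N = subst₂ (λ a′ b′ →
    Ev (_≤ N) (encodeℕ a ∷ encodeℕ b ∷ []) leqT (encodeBool (does (a′ ≤? b′))))
    (len-encodeℕ a) (len-encodeℕ b) (ev-leq (encodeℕ a) (encodeℕ b) (Ok-ℕ b≤N))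

  ev-addℕ : ∀ a b → a ≤ N → Ev (_≤ N) (encodeℕ a ∷ encodeℕ b ∷ []) addT (encodeℕ (a + b))
  ev-addℕ a b a≤N = subst (λ a′ → Ev (_≤ N) (encodeℕ a ∷ encodeℕ b ∷ []) addT (encodeℕ (a′ + b)))
    (len-encodeℕ a) (ev-add (encodeℕ a) b (Ok-ℕ a≤N))

  module _ (K : ℕ) where

    private
      U  = proj₁ (split (isHigh K))
      Bs = proj₂ (split (isHigh K))

    candidate-lengths : length U + length (concat Bs) ≡ n
    candidate-lengths = trans (splits-length (candidate-splits K)) (List.length-tabulate id)

    candidate-U≤n : length U ≤ n
    candidate-U≤n = ≤-trans (m≤m+n (length U) _) (≤-reflexive candidate-lengths)

    candidate-block≤n : ∀ {B} → B ∈ Bs → length B ≤ n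
    candidate-block≤n B∈ = ≤-trans (length-∈-concat B∈)
      (≤-trans (m≤n+m _ (length U)) (≤-reflexive candidate-lengths))

    candidate-≤3n : K ≤ n → proj₁ (candidate K) ≤ 3 * n
    candidate-≤3n K≤n = +-mono-≤ K≤n (+-mono-≤ candidate-U≤n
      (≤-trans (longest-lub Bs z≤n candidate-block≤n) (≤-reflexive (sym (+-identityʳ n)))))

    ev-candidate : K ≤ n → Ev (_≤ N) (g ∷ encVs (allFin n) ∷ encodeℕ K ∷ []) candidateT (encC (candidate K))
    ev-candidate K≤n = let (e , Bs≤n) = ev-split K in
      ev-bind (ev-call e) (ev-bind (ev-call (ev-longest Bs Bs≤n candidate-block≤n))
        (ev-bind (ev-call (subst (λ a → Ev (_≤ N) (encVs U ∷ encodeℕ (longest Bs) ∷ []) addT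
          (encodeℕ (a + longest Bs)))
            (len-encList encV U) (ev-add (encVs U) (longest Bs) (Ok-list (≤-trans candidate-U≤n n≤N)))))
          (ev-bind (ev-call (ev-addℕ K (length U + longest Bs) (≤-trans K≤n n≤N))) ev-ret)))

  -- The measures that `bestT` compares are sums of a threshold, a separator size and a block size,
  -- each at most n; this is the origin of the factor 3.
  3n≤N′ : 3 * n ≤ N
  3n≤N′ = ≤-trans (*-monoʳ-≤ 3 (n≤1+n n)) 3n≤N

  ev-best : Ev (_≤ N) (g ∷ encVs (allFin n) ∷ encodeℕ n ∷ []) bestT (encC best)
  ev-best = ev-bind (ev-call (ev-candidate n ≤-refl))
    (ev-fold (Ok-ℕ n≤N) (evFold-ℕ encC (λ _ → ⊤) n {candidate n} tt _
    λ {c} {K} K<n _ → ev-bind (ev-call (ev-candidate K (<⇒≤ K<n)))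
      (ev-bind (ev-call (ev-leqℕ (proj₁ c) (proj₁ (candidate K)) (≤-trans (candidate-≤3n K (<⇒≤ K<n)) 3n≤N′)))
        (ev-if encC (does (proj₁ c ≤? proj₁ (candidate K))) refl (λ _ → ev-ret) (λ _ → ev-ret)))))

  encP : ℕ × ℕ → 𝔻
  encP (a , b) = cons (encodeℕ a) (encodeℕ b)

  2n≤N : 2 * (1 ⊔ n) ≤ N
  2n≤N = ≤-trans (*-mono-≤ (s≤s (s≤s (z≤n {1}))) (⊔-lub (s≤s z≤n) (n≤1+n n))) 3n≤N

  ev-log : Ev (_≤ N) (encodeℕ n ∷ []) logT (encP logPair)
  ev-log = ev-fold (Ok-ℕ n≤N) (evFold-ℕ encP (λ a → proj₂ a ≤ 2 * (1 ⊔ n)) n {0 , 1}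
    (≤-trans (m≤m⊔n 1 n) (m≤m+n _ _))
    (λ {a} _ small → if-dec (λ z → proj₂ z ≤ 2 * (1 ⊔ n)) (proj₂ a ≤? n)
      (λ q≤n → ≤-trans (≤-reflexive (cong (proj₂ a +_) (sym (+-identityʳ (proj₂ a)))))
        (*-monoʳ-≤ 2 (≤-trans q≤n (m≤n⊔m 1 n))))
      (λ _ → small))
    (λ {a} _ small → ev-bind (ev-call (ev-leqℕ (proj₂ a) n n≤N))
      (ev-if encP (does (proj₂ a ≤? n)) refl
        (λ _ → ev-bind (ev-call (ev-addℕ (proj₂ a) (proj₂ a) (≤-trans small 2n≤N))) ev-ret)
        (λ _ → ev-ret))))

  ev-moduli : ∀ M L → suc M ≤ N → L ≤ N →
    Ev (_≤ N) (encodeℕ M ∷ encodeℕ L ∷ []) moduliT (encodeℕ (moduli M L))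
  ev-moduli M L M<N L≤N = ev-fold (Ok-ℕ {suc M} M<N) (evFold-ℕ encodeℕ (λ _ → ⊤) (suc M) {2} tt _
    λ {a} _ _ → ev-fold (Ok-ℕ {suc M} M<N) (evFold-ℕ encodeℕ (λ _ → ⊤) (suc M) {a} tt _
      λ {b} _ _ → ev-call (ev-addℕ L b L≤N)))

  ev-initial : ∀ P → P ≤ N → Ev (_≤ N) (encodeℕ P ∷ []) initialT (encList encS (initial P))
  ev-initial P P≤N = ev-fold (Ok-ℕ P≤N) (evFold-ℕ (encList encS) (λ _ → ⊤) P {[]} tt _ (λ _ _ → ev-ret))

  length-initial : ∀ P → length (initial P) ≡ P
  length-initial P = trans (go P []) (+-identityʳ P)
    where
    go : ∀ j acc → length (countdown addStart acc j) ≡ j + length acc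
    go zero    acc = refl
    go (suc j) acc = trans (go j (start j ∷ acc)) (+-suc j (length acc))

  ev-vertices : Ev (_≤ N) (encodeℕ n ∷ []) verticesT (encVs (allFin n))
  ev-vertices = ev-fold (Ok-ℕ n≤N) (subst (EvFold (_≤ N) _ _ (encodeℕ n) nil) all
    (evFold-ℕ (encList encodeℕ) {g = λ acc j → j ∷ acc} (λ _ → ⊤) n {[]} tt _ (λ _ _ → ev-ret)))
    where
    shiftUp : ∀ j acc → countdown (λ acc j → j ∷ acc) acc j ≡ upTo j ++ acc
    shiftUp zero    acc = refl
    shiftUp (suc j) acc = trans (shiftUp j (j ∷ acc))
      (trans (sym (++-assoc (upTo j) (j ∷ []) acc)) (cong (_++ acc) (List.upTo-∷ʳ j)))
    all : encList encodeℕ (countdown (λ acc j → j ∷ acc) [] n) ≡ encVs (allFin n)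
    all = trans (cong (encList encodeℕ) (trans (shiftUp n []) (List.++-identityʳ (upTo n))))
      (go n id (λ _ → refl))
      where
      go : ∀ j {k} {f : ℕ → ℕ} (h : Fin j → Fin k) → (∀ i → f (toℕ i) ≡ toℕ (h i)) →
        encList encodeℕ (applyUpTo f j) ≡ encList (encodeℕ ∘ toℕ) (tabulate h)
      go zero    h eq = refl
      go (suc j) h eq = cong₂ (λ a b → cons (encodeℕ a) b) (eq zero) (go j (h ∘ suc) (eq ∘ suc))

  ev-least : ∀ sts → length sts ≤ N →
    Ev (_≤ N) (encodeℕ n ∷ encList encS sts ∷ []) leastT (encodeℕ (foldl lesserCost n sts))
  ev-least sts ok = ev-fold (Ok-list ok) (evFold-list encodeℕ encS (_≤ n) sts {n} ≤-refl
    (λ {m} {s} _ m≤n → if-dec (_≤ n) (proj₁ (proj₂ s) ≤? m) (λ c≤m → ≤-trans c≤m m≤n) (λ _ → m≤n))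
    (λ {m} {s} _ m≤n → ev-bind (ev-call (ev-leqℕ (proj₁ (proj₂ s)) m (≤-trans m≤n n≤N)))
      (ev-if encodeℕ (does (proj₁ (proj₂ s) ≤? m)) refl (λ _ → ev-ret) (λ _ → ev-ret))))

  ev-size : Ev (_≤ N) (g ∷ nil ∷ []) addT (encodeℕ n)
  ev-size = subst (λ a → Ev (_≤ N) (g ∷ nil ∷ []) addT (encodeℕ a)) (trans (+-identityʳ _) len-g)
    (ev-add g 0 (≤-trans (≤-reflexive len-g) n≤N))
    where
    len-g : len g ≡ n
    len-g = trans (cong len (encodeList-tabulate _ id))
      (trans (len-encList _ (allFin n)) (List.length-tabulate id))

  -- These bounds do not follow from 3 (n + 1) ≤ N alone; they are supplied from the vertex
  -- integrity by `Estimate`.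
  record Room (c : Candidate) (L P : ℕ) : Set where
    field
      log≤N     : L ≤ N
      moduli<N  : P < N
      bag≤N     : 2 + proj₁ c ≤ N
      states≤N  : stateBound P n (proj₁ c) ≤ N

  ev-solve-candidate : ∀ {K L P} → Room (candidate K) L P →
    let (_ , U , Bs) = candidate K in
    Ev (_≤ N) (g ∷ encVs U ∷ encBs Bs ∷ encList encS (initial P) ∷ []) solveT
      (encList encS (solve U Bs (initial P))) ×
    length (solve U Bs (initial P)) ≤ N
  ev-solve-candidate {K} {P = P} room =
    ev-solve {U} {Bs} {initial P} (≤-reflexive (candidate-lengths K))
          (≤-trans (proj₂ (ev-split K)) n≤N)
          (≤-trans (m≤m+n (length U) _) (m≤n+m _ K))
          (λ {B} B∈ → ≤-trans (≤-reflexive (+-comm (length B) (length U)))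
            (≤-trans (+-monoʳ-≤ (length U) (proj₂ (longest-upper Bs 0) B∈)) (m≤n+m _ K)))
          (stage (≤-trans (≤-reflexive (length-initial P)) (<⇒≤ (Room.moduli<N room))) (initial-fits {P}))
    where
    open EvDP G N P (proj₁ (candidate K)) n≤N (Room.moduli<N room) (Room.bag≤N room) (Room.states≤N room) using (ev-solve; stage)
    U  = proj₁ (proj₂ (candidate K))
    Bs = proj₂ (proj₂ (candidate K))

  -- With variables in place of `best` and `logPair`, the equation with `candidate K` can be matched
  -- by `refl`.
  ev-main-from : ∀ {c lp} → ∃[ K ] (K ≤ n × c ≡ candidate K) →
    Ev (_≤ N) (g ∷ encVs (allFin n) ∷ encodeℕ n ∷ []) bestT (encC c) →
    Ev (_≤ N) (encodeℕ n ∷ []) logT (encP lp) →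
    Room c (proj₁ lp) (moduli (proj₁ c) (proj₁ lp)) →
    Ev (_≤ N) (g ∷ []) mainT
      (encodeℕ (foldl lesserCost n (solve (proj₁ (proj₂ c)) (proj₂ (proj₂ c))
        (initial (moduli (proj₁ c) (proj₁ lp))))))
  ev-main-from {lp = L , _} (K , _ , refl) ev-c ev-lp room =
    let P = moduli (proj₁ (candidate K)) L
        (e , ok) = ev-solve-candidate {K} room
    in ev-bind (ev-call ev-size)
       (ev-bind (ev-call ev-vertices)
       (ev-bind (ev-call ev-c)
       (ev-bind (ev-call ev-lp)
       (ev-bind (ev-call (ev-moduli (proj₁ (candidate K)) L (≤-trans (n≤1+n _) (Room.bag≤N room))
         (Room.log≤N room)))
       (ev-bind (ev-call (ev-initial P (<⇒≤ (Room.moduli<N room))))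
       (ev-bind (ev-call e)
         (ev-call (ev-least _ ok))))))))

  ev-main : Room best (proj₁ logPair) (moduli (proj₁ best) (proj₁ logPair)) →
    Ev (_≤ N) (g ∷ []) mainT (encodeℕ answer)
  ev-main = ev-main-from best-candidate ev-best ev-log

-- Arithmetic functions are computable

data Arith : Set where
  arg          : Arith
  lit          : ℕ → Arith
  _⊕_ _⊗_ _↑_ : Arith → Arith → Arith

infixl 6 _⊕_
infixl 7 _⊗_
infixr 8 _↑_

value : Arith → ℕ → ℕ
value arg     k = k
value (lit c) k = c
value (a ⊕ b) k = value a k + value b k
value (a ⊗ b) k = value a k * value b k
value (a ↑ b) k = value a k ^ value b k

mulT powT : Tm 2
mulT = fold x0 nil (call addT (x3 ∷ x1 ∷ []))
powT = fold x1 yesE (call mulT (x2 ∷ x1 ∷ []))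

numeral : ∀ {m} → ℕ → Exp m
numeral zero    = nil
numeral (suc c) = cons nil (numeral c)

binaryT : Tm 2 → Tm 1 → Tm 1 → Tm 1
binaryT op s t = bind s (bind (call t (x1 ∷ [])) (call op (x1 ∷ x0 ∷ [])))

arithT : Arith → Tm 1
arithT arg     = ret x0
arithT (lit c) = ret (numeral c)
arithT (a ⊕ b) = binaryT addT (arithT a) (arithT b)
arithT (a ⊗ b) = binaryT mulT (arithT a) (arithT b)
arithT (a ↑ b) = binaryT powT (arithT a) (arithT b)

countdown-^ : ∀ a c j → countdown (λ acc _ → a * acc) c j ≡ a ^ j * c
countdown-^ a c zero    = sym (+-identityʳ c)
countdown-^ a c (suc j) = trans (countdown-^ a (a * c) j)
  (trans (sym (*-assoc (a ^ j) a c)) (cong (_* c) (*-comm (a ^ j) a)))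

Any-length : ℕ → Set
Any-length _ = ⊤

open Basics Any-length

ev-plus : ∀ a b → Ev Any-length (encodeℕ a ∷ encodeℕ b ∷ []) addT (encodeℕ (a + b))
ev-plus a b = subst (λ a′ → Ev Any-length (encodeℕ a ∷ encodeℕ b ∷ []) addT (encodeℕ (a′ + b)))
  (len-encodeℕ a) (ev-add (encodeℕ a) b tt)

ev-times : ∀ a b → Ev Any-length (encodeℕ a ∷ encodeℕ b ∷ []) mulT (encodeℕ (a * b))
ev-times a b = subst (λ c → Ev Any-length (encodeℕ a ∷ encodeℕ b ∷ []) mulT (encodeℕ c))
  (trans (countdown-+ b 0 a) (+-identityʳ (a * b)))
  (ev-fold tt (evFold-ℕ encodeℕ (λ _ → ⊤) a {0} tt _ (λ {c} _ _ → ev-call (ev-plus b c))))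

ev-power : ∀ a b → Ev Any-length (encodeℕ a ∷ encodeℕ b ∷ []) powT (encodeℕ (a ^ b))
ev-power a b = subst (λ c → Ev Any-length (encodeℕ a ∷ encodeℕ b ∷ []) powT (encodeℕ c))
  (trans (countdown-^ a 1 b) (*-identityʳ (a ^ b)))
  (ev-fold tt (evFold-ℕ encodeℕ (λ _ → ⊤) b {1} tt _ (λ {c} _ _ → ev-call (ev-times a c))))

eval-numeral : ∀ {m} c {ρ : Vec 𝔻 m} → eval (numeral c) ρ ≡ encodeℕ c
eval-numeral zero    = refl
eval-numeral (suc c) = cong (cons nil) (eval-numeral c)

ev-arith : ∀ e k → Ev Any-length (encodeℕ k ∷ []) (arithT e) (encodeℕ (value e k))
ev-arith arg     k = ev-ret
ev-arith (lit c) k = subst (Ev Any-length (encodeℕ k ∷ []) (ret (numeral c))) (eval-numeral c) ev-ret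
ev-arith (a ⊕ b) k = ev-bind (ev-arith a k)
  (ev-bind (ev-call (ev-arith b k)) (ev-call (ev-plus (value a k) (value b k))))
ev-arith (a ⊗ b) k = ev-bind (ev-arith a k)
  (ev-bind (ev-call (ev-arith b k)) (ev-call (ev-times (value a k) (value b k))))
ev-arith (a ↑ b) k = ev-bind (ev-arith a k)
  (ev-bind (ev-call (ev-arith b k)) (ev-call (ev-power (value a k) (value b k))))

arith-computable : ∀ e → Computable (value e)
arith-computable e = toProgram (arithT e) , λ k → _ , runs (ev-arith e k)

-- The number of states is fixed-parameter tractable

^-distribʳ-* : ∀ j a b → (a * b) ^ j ≡ a ^ j * b ^ j
^-distribʳ-* zero    a b = refl
^-distribʳ-* (suc j) a b = trans (cong (a * b *_) (^-distribʳ-* j a b)) (interchange a b (a ^ j) (b ^ j))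
  where
  interchange : ∀ a b c d → a * b * (c * d) ≡ a * c * (b * d)
  interchange = solve-∀

-- With d = q / j one has q ≤ j (d + 1) ≤ j 2 ^ d.
power-≤-exponential : ∀ q j .{{_ : NonZero j}} → q ^ j ≤ j ^ j * 2 ^ q
power-≤-exponential q j = begin
  q ^ j                    ≤⟨ ^-monoˡ-≤ j q≤ ⟩
  (j * 2 ^ d) ^ j          ≡⟨ ^-distribʳ-* j j (2 ^ d) ⟩
  j ^ j * (2 ^ d) ^ j      ≡⟨ cong (j ^ j *_) (^-*-assoc 2 d j) ⟩
  j ^ j * 2 ^ (d * j)      ≤⟨ *-monoʳ-≤ (j ^ j) (^-monoʳ-≤ 2 (m/n*n≤m q j)) ⟩
  j ^ j * 2 ^ q            ∎
  where
  open ≤-Reasoning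
  d = q / j
  q≤ : q ≤ j * 2 ^ d
  q≤ = begin
    q            ≡⟨ m≡m%n+[m/n]*n q j ⟩
    _            ≤⟨ +-monoˡ-≤ (d * j) (<⇒≤ (m%n<n q j)) ⟩
    suc d * j    ≡⟨ *-comm (suc d) j ⟩
    j * suc d    ≤⟨ *-monoʳ-≤ j (n<2^n d) ⟩
    j * 2 ^ d    ∎

-- `measureE` is the bound on the measure of the best candidate, with value m. The factor base * (L
-- + 1), called Y, exceeds the number P of moduli. Up to n + 1 choices for the cost, the states
-- number at most Y ^ (1 + 2 m): one factor for the modulus and two per bag entry, as 1 + P² ≤ Y².
-- In `sizeE` the power of `exponentE` pays for the powers of L + 1, and 8 is 2 * 4, from n + 1 ≤ 2
-- x and 2 ^ (L + 1) ≤ 4 x for x = 1 ⊔ n.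
measureE base exponentE sizeE : Arith
measureE  = arg ⊕ (arg ⊕ (arg ⊕ arg ⊗ (arg ⊗ arg)))
base      = lit 3 ⊗ ((lit 1 ⊕ measureE) ⊗ (lit 1 ⊕ measureE))
exponentE = lit 1 ⊕ (measureE ⊕ measureE)
sizeE     = lit 8 ⊗ (base ↑ exponentE ⊗ exponentE ↑ exponentE)

module Estimate {k n M L P : ℕ} (M≤ : M ≤ value measureE k) (2^L≤ : 2 ^ L ≤ 2 * (1 ⊔ n))
                (P≡ : P ≡ suc M * (suc M * L) + 2) where

  private
    x m b j Y F N : ℕ
    x = 1 ⊔ n
    m = value measureE k
    b = value base k
    j = value exponentE k
    F = value sizeE k
    Y = b * suc L
    N = F * x ^ 2

    x>0 : 0 < x
    x>0 = m≤m⊔n 1 n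

    instance
      x-nonZero : NonZero x
      x-nonZero = >-nonZero x>0
      b-nonZero : NonZero b
      b-nonZero = _
      Y-nonZero : NonZero Y
      Y-nonZero = m*n≢0 b (suc L)
      bj-nonZero : NonZero (b ^ j * j ^ j)
      bj-nonZero = m*n≢0 (b ^ j) (j ^ j) {{m^n≢0 b j}} {{m^n≢0 j j}}

    open ≤-Reasoning

    P<Y : P < Y
    P<Y = begin
      suc P                                   ≡⟨ cong suc P≡ ⟩
      suc (suc M * (suc M * L) + 2)           ≤⟨ s≤s
        (+-monoˡ-≤ 2 (*-mono-≤ (s≤s M≤) (*-monoˡ-≤ L (s≤s M≤)))) ⟩
      suc (suc m * (suc m * L) + 2)           ≡⟨ +-suc (suc m * (suc m * L)) 2 ⟨
      suc m * (suc m * L) + 3                 ≡⟨ cong (_+ 3) (*-assoc (suc m) (suc m) L) ⟨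
      suc m * suc m * L + 3 * 1               ≤⟨ +-mono-≤ (*-monoˡ-≤ L (m≤n*m (suc m * suc m) 3))
        (*-monoʳ-≤ 3 (s≤s z≤n)) ⟩
      b * L + 3 * (suc m * suc m)             ≡⟨ +-comm (b * L) b ⟩
      b + b * L                               ≡⟨ *-suc b L ⟨
      Y                                       ∎

    1+P²≤Y² : 1 + P * P ≤ Y * Y
    1+P²≤Y² = begin
      1 + P * P        ≤⟨ +-monoʳ-≤ 1 (≤-trans (m≤n+m (P * P) P) (m≤n+m (P + P * P) P)) ⟩
      1 + (P + (P + P * P))   ≡⟨ expand P ⟩
      suc P * suc P    ≤⟨ *-mono-≤ P<Y P<Y ⟩
      Y * Y            ∎
      where
      expand : ∀ p → 1 + (p + (p + p * p)) ≡ suc p * suc p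
      expand = solve-∀

    -- With q = L + 1 the exponential factor is 2 ^ (L + 1) ≤ 4 x, so all powers of the logarithm
    -- together cost one factor x. The other factor x in N is for the number of deletions.
    Y^j≤ : Y ^ j ≤ b ^ j * j ^ j * (4 * x)
    Y^j≤ = begin
      (b * suc L) ^ j                   ≡⟨ ^-distribʳ-* j b (suc L) ⟩
      b ^ j * suc L ^ j                 ≤⟨ *-monoʳ-≤ (b ^ j) (power-≤-exponential (suc L) j) ⟩
      b ^ j * (j ^ j * (2 * 2 ^ L))     ≤⟨ *-monoʳ-≤ (b ^ j) (*-monoʳ-≤ (j ^ j) (*-monoʳ-≤ 2 2^L≤)) ⟩
      b ^ j * (j ^ j * (2 * (2 * x)))   ≡⟨ cong (λ z → b ^ j * (j ^ j * z)) (*-assoc 2 2 x) ⟨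
      b ^ j * (j ^ j * (4 * x))         ≡⟨ *-assoc (b ^ j) (j ^ j) (4 * x) ⟨
      b ^ j * j ^ j * (4 * x)           ∎

    suc-n≤ : suc n ≤ 2 * x
    suc-n≤ = ≤-trans (+-mono-≤ x>0 (m≤n⊔m 1 n)) (≤-reflexive (cong (x +_) (sym (+-identityʳ x))))

    arrange : ∀ c x → 2 * x * (c * (4 * x)) ≡ 8 * c * (x * (x * 1))
    arrange = solve-∀

    Y^j*n≤N : suc n * Y ^ j ≤ N
    Y^j*n≤N = begin
      suc n * Y ^ j                             ≤⟨ *-mono-≤ suc-n≤ Y^j≤ ⟩
      2 * x * (b ^ j * j ^ j * (4 * x))         ≡⟨ arrange (b ^ j * j ^ j) x ⟩
      N                                         ∎

  Y≤N : Y ≤ N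
  Y≤N = begin
    Y              ≡⟨ *-identityʳ Y ⟨
    Y ^ 1          ≤⟨ ^-monoʳ-≤ Y (s≤s (z≤n {m + m})) ⟩
    Y ^ j          ≤⟨ m≤n*m (Y ^ j) (suc n) ⟩
    suc n * Y ^ j  ≤⟨ Y^j*n≤N ⟩
    N              ∎

  P<N : P < N
  P<N = ≤-trans P<Y Y≤N

  2+M≤N : 2 + M ≤ N
  2+M≤N = ≤-trans (begin
    2 + M                    ≤⟨ +-monoʳ-≤ 2 M≤ ⟩
    2 + m                    ≤⟨ +-monoʳ-≤ 2 (n≤1+n m) ⟩
    2 + suc m                ≤⟨ +-monoˡ-≤ (suc m) (*-monoʳ-≤ 2 (s≤s (z≤n {m}))) ⟩
    2 * suc m + suc m        ≡⟨ +-comm (2 * suc m) (suc m) ⟩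
    3 * suc m                ≤⟨ *-monoʳ-≤ 3 (m≤m*n (suc m) (suc m)) ⟩
    b                        ≤⟨ m≤m*n b (suc L) ⟩
    Y                        ∎) Y≤N

  L≤N : L ≤ N
  L≤N = ≤-trans (≤-trans (n≤1+n L) (m≤n*m (suc L) b)) Y≤N

  3n≤N : 3 * suc n ≤ N
  3n≤N = begin
    3 * suc n                                ≤⟨ *-monoʳ-≤ 3 suc-n≤ ⟩
    3 * (2 * x)                              ≡⟨ *-assoc 3 2 x ⟨
    6 * x                                    ≤⟨ *-mono-≤ {6} {8} (m≤m+n 6 2) (m≤m*n x x) ⟩
    8 * (x * x)                              ≤⟨ *-monoˡ-≤ (x * x) (m≤m*n 8 (b ^ j * j ^ j)) ⟩
    8 * (b ^ j * j ^ j) * (x * x)            ≡⟨ cong (λ z → 8 * (b ^ j * j ^ j) * (x * z)) (*-identityʳ x) ⟨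
    N                                        ∎

  2≤N : 2 ≤ N
  2≤N = ≤-trans (m≤m+n 2 M) 2+M≤N

  states≤N : P * (suc n * (1 + P * P) ^ M) ≤ N
  states≤N = begin
    P * (suc n * (1 + P * P) ^ M)     ≤⟨ *-mono-≤ (<⇒≤ P<Y)
      (*-monoʳ-≤ (suc n) (≤-trans (^-monoʳ-≤ (1 + P * P) M≤) (^-monoˡ-≤ m 1+P²≤Y²))) ⟩
    Y * (suc n * (Y * Y) ^ m)         ≡⟨ cong (λ z → Y * (suc n * z))
      (trans (^-distribʳ-* m Y Y) (sym (^-distribˡ-+-* Y m m))) ⟩
    Y * (suc n * Y ^ (m + m))         ≡⟨ *-assoc Y (suc n) _ ⟨
    Y * suc n * Y ^ (m + m)           ≡⟨ cong (_* Y ^ (m + m)) (*-comm Y (suc n)) ⟩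
    suc n * Y * Y ^ (m + m)           ≡⟨ *-assoc (suc n) Y _ ⟩
    suc n * Y ^ j                     ≤⟨ Y^j*n≤N ⟩
    N                                 ∎

-- The final running time

abstract
  -- Abstract, so that the type checker does not unfold the large number `deg mainT`.
  timeExponent : ℕ
  timeExponent = 1 + 5 + (1 + suc (deg mainT) + 3)

  main-time : ∀ {N ρ v} → 2 ≤ N → (p : Ev (_≤ N) ρ mainT v) → 1 + 4 + (1 + cost p + 3) ≤ N ^ timeExponent
  main-time 2≤N p = runtime-≤ 2≤N p

theorem2 : Σ[ P ∈ Program ] Σ[ f ∈ (ℕ → ℕ) ] Σ[ c ∈ ℕ ]
    (Computable f
    × (∀ (n : ℕ) (G : Graph n) (k : ℕ) → HasVertexIntegrity G k →
    ∃[ m ] ∃[ t ]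
    (IsIᵥ G m
    × Runs P (encodeGraph G) (encodeℕ m) t
    × t ≤ f k * (1 ⊔ n) ^ c)))
theorem2 = toProgram mainT , value f , 2 * timeExponent , arith-computable f , solves
  where
  f : Arith
  -- The time bound is a fixed power of N, and N is a function of k times x ^ 2; the power
  -- distributes over the two factors.
  f = sizeE ↑ lit timeExponent
  solves : ∀ n (G : Graph n) k → HasVertexIntegrity G k →
    ∃[ m ] ∃[ t ] (IsIᵥ G m × Runs (toProgram mainT) (encodeGraph G) (encodeℕ m) t × t ≤ value f k *
      (1 ⊔ n) ^ (2 * timeExponent))
  solves n G k vi = answer , _ , answer-correct , runs ev , ≤-trans (main-time 2≤N ev)
    (≤-reflexive split-power)
    where
    open Algorithm G
    open Estimate {k} {n} {M} {L} {P} (Measure.integrity⇒best-≤ G vi) 2^L≤ (moduli≡ M L)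
    N = value sizeE k * (1 ⊔ n) ^ 2
    open EvMain G N 3n≤N using (ev-main)
    ev : Ev (_≤ N) (encodeGraph G ∷ []) mainT (encodeℕ answer)
    ev = ev-main record
      { log≤N = L≤N ; moduli<N = P<N ; bag≤N = 2+M≤N ; states≤N = states≤N }
    split-power : N ^ timeExponent ≡ value f k * (1 ⊔ n) ^ (2 * timeExponent)
    split-power = trans (^-distribʳ-* timeExponent (value sizeE k) ((1 ⊔ n) ^ 2))
      (cong (value sizeE k ^ timeExponent *_) (^-*-assoc (1 ⊔ n) 2 timeExponent))
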